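{- Let $G$ be a graph on $n$ vertices and let $L$ be a $(\deg+2)$-list assignment of $G$. Then the Glauber dynamics on the $L$-colourings of $G$ has mixing time at most $n^{\mathcal{O}(\mathrm{tw}(G)^3)}$, where $\mathrm{tw}(G)$ is the treewidth of $G$.
   Context: A list assignment of a graph $G=(V,E)$ is a map $L$ assigning to each vertex $v$ a finite set $L(v)$ of colours; it is a $(\deg+2)$-list assignment if $|L(v)|\ge \deg(v)+2$ for every vertex $v$. An $L$-colouring is a map $\sigma$ with $\sigma(v)\in L(v)$ for all $v$ and $\sigma(u)\neq\sigma(w)$ for every edge $uw$; $\Omega_{G,L}$ denotes the set of $L$-colourings. The Glauber dynamics on $\Omega_{G,L}$ is the Markov chain which at each step picks a vertex $v$ uniformly at random and a colour $c$ uniformly at random from $L(v)$, and recolours $v$ with $c$ if no neighbour of $v$ currently has colour $c$ (otherwise the colouring is unchanged); equivalently $P[\sigma\to\eta]=\frac{1}{n|L(v)|}$ if $\sigma\ne\eta$ differ only at $v$, and $0$ for other $\sigma\neq\eta$. Under the hypothesis this chain is ergodic with uniform stationary distribution $\pi$. The mixing time is $\min\{t : \max_{x}\|\nu^t_x-\pi\|_{TV}\le 1/4\}$, where $\nu^t_x$ is the distribution after $t$ steps from $x$ and $\|\mu-\nu\|_{TV}=\frac12\sum_x|\mu(x)-\nu(x)|$. -}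

module Defs where

open import Data.Bool using (Bool; true; false; if_then_else_)
open import Data.Nat as ℕ using (ℕ; zero; suc; _≤_)
open import Data.Fin as Fin using (Fin; zero; suc)
open import Data.Fin.Properties using (all?; any?)
open import Data.Nat.ListAction using (sum)
open import Data.Fin.Subset as Subset using (Subset)
open import Data.List as List using (List; []; _∷_; length; map; concatMap; allFin; filter)
open import Data.List.Membership.Propositional using (_∈_)
open import Data.List.Relation.Unary.Unique.Propositional using (Unique)
open import Data.Vec as Vec using (Vec; []; _∷_; lookup; _[_]≔_)
open import Data.Vec.Properties using (≡-dec)
open import Data.Rational as ℚ using (ℚ; 0ℚ; 1ℚ; ½; _+_; _*_; _-_; ∣_∣)
open import Data.Integer using (+_)
open import Data.Product using (Σ; ∃; ∃-syntax; _×_; _,_)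
open import Data.Sum using (_⊎_)
open import Relation.Nullary using (¬_; Dec; yes; no; ¬?; _→-dec_)
open import Relation.Nullary.Decidable using (⌊_⌋)
open import Relation.Binary.PropositionalEquality using (_≡_; _≢_)

record Graph (n : ℕ) : Set where
  field
    adj    : Fin n → Fin n → Bool
    sym    : ∀ u v → adj u v ≡ adj v u
    irrefl : ∀ v → adj v v ≡ false
open Graph public

deg : ∀ {n} → Graph n → Fin n → ℕ
deg {n} G v = sum (map (λ u → if adj G v u then 1 else 0) (allFin n))

record ListAssignment (n : ℕ) : Set where
  field
    colours  : Fin n → List ℕ
    distinct : ∀ v → Unique (colours v)
open ListAssignment public

IsDegPlus2 : ∀ {n} → Graph n → ListAssignment n → Set
IsDegPlus2 G L = ∀ v → deg G v ℕ.+ 2 ≤ length (colours L v)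

Colouring : ℕ → Set
Colouring n = Vec ℕ n

Proper : ∀ {n} → Graph n → Colouring n → Set
Proper G σ = ∀ u v → adj G u v ≡ true → lookup σ u ≢ lookup σ v

proper? : ∀ {n} (G : Graph n) (σ : Colouring n) → Dec (Proper G σ)
proper? G σ = all? (λ u → all? (λ v →
  (adj G u v Data.Bool.≟ true) →-dec ¬? (lookup σ u ℕ.≟ lookup σ v)))
  where import Data.Bool

IsLColouring : ∀ {n} → Graph n → ListAssignment n → Colouring n → Set
IsLColouring G L σ = (∀ v → lookup σ v ∈ colours L v) × Proper G σ

choices : ∀ {n} → Vec (List ℕ) n → List (Colouring n)
choices []       = [] ∷ []
choices (l ∷ ls) = concatMap (λ c → map (c ∷_) (choices ls)) l

Ω : ∀ {n} → Graph n → ListAssignment n → List (Colouring n)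
Ω {n} G L = filter (proper? G) (choices (Vec.tabulate (colours L)))

sumℚ : List ℚ → ℚ
sumℚ = List.foldr _+_ 0ℚ

-- 1/k for k ≥ 1 (never applied to 0 under the hypotheses)
inv : ℕ → ℚ
inv zero    = 0ℚ
inv (suc k) = + 1 ℚ./ suc k

_≟ᶜ_ : ∀ {n} (σ τ : Colouring n) → Dec (σ ≡ τ)
_≟ᶜ_ = ≡-dec ℕ._≟_

[_≡ᶜ_] : ∀ {n} → Colouring n → Colouring n → ℚ
[ σ ≡ᶜ τ ] = if ⌊ σ ≟ᶜ τ ⌋ then 1ℚ else 0ℚ

update : ∀ {n} → Graph n → Colouring n → Fin n → ℕ → Colouring n
update G σ v c =
  if ⌊ any? (λ u → (adj G v u Data.Bool.≟ true) Relation.Nullary.×-dec (lookup σ u ℕ.≟ c)) ⌋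
  then σ else σ [ v ]≔ c
  where import Data.Bool; import Relation.Nullary

P : ∀ {n} → Graph n → ListAssignment n → Colouring n → Colouring n → ℚ
P {n} G L σ τ =
  sumℚ (map (λ v → sumℚ (map (λ c → inv (n ℕ.* length (colours L v)) * [ update G σ v c ≡ᶜ τ ])
                              (colours L v)))
            (allFin n))

ν : ∀ {n} → Graph n → ListAssignment n → ℕ → Colouring n → Colouring n → ℚ
ν G L zero    x y = [ x ≡ᶜ y ]
ν G L (suc t) x y = sumℚ (map (λ z → ν G L t x z * P G L z y) (Ω G L))

π : ∀ {n} → Graph n → ListAssignment n → Colouring n → ℚ
π G L _ = inv (length (Ω G L))

dTV : ∀ {n} → Graph n → ListAssignment n → ℕ → Colouring n → ℚ
dTV G L t x = ½ * sumℚ (map (λ y → ∣ ν G L t x y - π G L y ∣) (Ω G L))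

MixedAt : ∀ {n} → Graph n → ListAssignment n → ℕ → Set
MixedAt G L t = ∀ x → IsLColouring G L x → dTV G L t x ℚ.≤ (+ 1 ℚ./ 4)

MixingTimeAtMost : ∀ {n} → Graph n → ListAssignment n → ℕ → Set
MixingTimeAtMost G L B = ∃[ t ] (t ≤ B × MixedAt G L t)

data Walk {k : ℕ} (Adj : Fin k → Fin k → Set) (S : Fin k → Set) : Fin k → Fin k → Set where
  here  : ∀ {i} → S i → Walk Adj S i i
  there : ∀ {i j l} → S i → Adj i j → Walk Adj S j l → Walk Adj S i l

-- A tree on nodes Fin (suc m), given by parent pointers: every node i ≠ 0
-- is joined to parent i, which is a smaller node (every finite tree is of
-- this form after relabelling its nodes in BFS order).
record TreeDecomposition {n : ℕ} (G : Graph n) : Set where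
  field
    m      : ℕ
    parent : Fin (suc m) → Fin (suc m)
    parent< : ∀ i → i ≢ zero → parent i Fin.< i
    bag    : Fin (suc m) → Subset n

  TreeEdge : Fin (suc m) → Fin (suc m) → Set
  TreeEdge i j = (i ≢ zero × parent i ≡ j) ⊎ (j ≢ zero × parent j ≡ i)

  field
    covers    : ∀ v → ∃[ i ] (v Subset.∈ bag i)
    edges     : ∀ u v → adj G u v ≡ true → ∃[ i ] (u Subset.∈ bag i × v Subset.∈ bag i)
    connected : ∀ v i j → v Subset.∈ bag i → v Subset.∈ bag j →
                Walk TreeEdge (λ l → v Subset.∈ bag l) i j
open TreeDecomposition public

WidthAtMost : ∀ {n} → Graph n → ℕ → Set
WidthAtMost G k = Σ (TreeDecomposition G) λ T → ∀ i → Subset.∣ bag T i ∣ ≤ suc k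

Treewidth : ∀ {n} → Graph n → ℕ → Set
Treewidth G k = WidthAtMost G k × (∀ j → WidthAtMost G j → k ≤ j)

-- All estimates are for the uniform measure on the colourings; A W averages over recolourings of the region W,
-- and E W f = ⟨f , f - A W f⟩ is the expected conditional variance of f.  The core is a Poincaré inequality
-- E ⊤ f ≤ C ∑_v E {v} f with C = 2 ^ O(k ² log n), obtained along a tree-depth decomposition of depth
-- O(k log n), which the width gives through centroid bags.  Non-adjacent regions tensorise, so the point is
-- that adding one vertex s to W loses only a factor polynomial in k.  This follows if, for any two colours of
-- s, a constant fraction of the colours h in L(s) is available to s with probability bounded below from both.
-- For fixed h let U be the set of neighbours of s coloured h.  The list sizes force the mean of |U| to be
-- below 1 on average over h; and recolouring U away from h exhibits U as a hard-core configuration on a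
-- (k+1)-colourable graph with fugacities at most 1, whose partition function satisfies Z(t)² ≤ Z(1) for
-- t = 1 / 4(k+1).  With Cauchy-Schwarz, (E t^|U|)² ≤ P(U = ∅), which bounds P(U = ∅) below.
--
-- As the lists may be arbitrarily long, the decay of variance is started only after polynomially many steps,
-- when the law is, up to small mass, dominated by a product measure with bounded density.

module Submission where

open import Defs hiding (P; π; ν; dTV) renaming (sym to adj-sym)
import Defs
open import Algebra.Properties.CommutativeSemigroup using (interchange)
open import Data.Bool using (Bool; true; false; if_then_else_; _∨_; _∧_; not)
import Data.Bool.Properties as Bool
open import Data.Empty using (⊥; ⊥-elim)
open import Data.Fin as Fin using (Fin; zero; suc)
open import Data.Fin.Induction using () renaming (<-wellFounded to Fin-<-wf)
import Data.Fin.Properties as Fin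
import Data.Fin.Subset as Subset
import Data.Integer as ℤ
import Data.Integer.Properties as ℤ
open import Data.List as List using (List; []; _∷_; length; map; allFin; _++_)
open import Data.List.Membership.Propositional using (_∈_; lose; find)
open import Data.List.Membership.Propositional.Properties
  using (∈-allFin; ∈-filter⁺; ∈-filter⁻; ∈-lookup; ∈-concatMap⁺; ∈-concatMap⁻; ∈-map⁺; ∈-map⁻)
open import Data.List.Properties using (length-tabulate; tabulate-lookup)
open import Data.List.Relation.Unary.All as All using (All; []; _∷_)
import Data.List.Relation.Unary.All.Properties as All
open import Data.List.Relation.Unary.AllPairs as AllPairs using ([]; _∷_)
import Data.List.Relation.Unary.AllPairs.Properties as AllPairs
open import Data.List.Relation.Unary.Any as Any using (here; there)
open import Data.List.Relation.Unary.Any.Properties using (lookup-index)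
open import Data.List.Relation.Unary.Unique.Propositional using (Unique)
import Data.List.Relation.Unary.Unique.Propositional.Properties as Unique
open import Data.Maybe using (Maybe; just; nothing)
open import Data.Nat as ℕ using (ℕ; zero; suc)
open import Data.Nat.ListAction using (sum)
import Data.Nat.Properties as ℕ
open import Data.Nat.Tactic.RingSolver using () renaming (solve-∀ to solveℕ-∀)
open import Data.Product using (Σ; ∃; ∃-syntax; _×_; _,_; proj₁; proj₂)
open import Data.Rational as ℚ using (ℚ; 0ℚ; 1ℚ; ½; _+_; _*_; _-_; -_; ∣_∣; _≤_; _<_)
import Data.Rational.Properties as ℚ
open import Data.Rational.Unnormalised using (mkℚᵘ; *≡*) renaming (_≃_ to _≃ᵘ_)
import Data.Rational.Unnormalised.Properties as ℚᵘ
open import Data.Sum using (_⊎_; inj₁; inj₂)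
import Data.Vec as Vec
open import Data.Vec.Properties
  using ([]=⇒lookup; lookup⇒[]=; tabulate∘lookup; lookup∘tabulate; tabulate-cong;
         lookup∘update; lookup∘update′; ∷-injectiveˡ; ∷-injectiveʳ)
open import Function using (_∘_; id)
open import Induction.WellFounded using (Acc; acc)
open import Level using (0ℓ)
open import Relation.Binary.Definitions using (Tri; tri<; tri≈; tri>)
open import Relation.Binary.PropositionalEquality
  using (_≡_; _≢_; refl; sym; trans; cong; cong₂; subst; module ≡-Reasoning)
open import Relation.Nullary using (¬_; Dec; does; yes; no; contradiction; _→-dec_; _×-dec_; ¬?)
open import Relation.Nullary.Decidable using (dec-true; dec-false; from-yes)
open import Tactic.RingSolver using (solve-∀)
open import Tactic.RingSolver.Core.AlmostCommutativeRing using (AlmostCommutativeRing; fromCommutativeRing)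

-- Rational arithmetic and finite sums

-- The obstacle is that a list may be far longer than a degree, so no constant may depend on a list
-- length. Two states are therefore compared through all colours `h` at once: the sum over `h` of
-- the products of their two availabilities must be a fixed fraction of the palette. The lower bound
-- for a single `h` is kept affine in the expected number of neighbours coloured `h`; it can then be
-- summed over the list, and no set of good colours has to be chosen. The inequality between Z(t)²
-- and Z(1) is a comparison with independent sites. Dropping the exclusion bounds Z(t) by a product
-- over all vertices; within one class of the proper colouring nothing is excluded, so Z(1) is at
-- least the product over that class, and its (k+1)-th power at least the product over all vertices.
-- All numbers are rational: roots are replaced by comparing powers, exponentials by Bernoulli's
-- inequality, logarithms by powers of 2. The loss per vertex, polynomial in k, is rounded up to a
-- power of 2 with exponent linear in k, which a cubic exponent of n easily accommodates.

ℚ-ring : AlmostCommutativeRing 0ℓ 0ℓ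
ℚ-ring = fromCommutativeRing ℚ.+-*-commutativeRing isZero
  where
  isZero : ∀ q → Maybe (0ℚ ≡ q)
  isZero q with 0ℚ ℚ.≟ q
  ... | yes eq = just eq
  ... | no  _  = nothing

2ℚ : ℚ
2ℚ = 1ℚ + 1ℚ

module _ where
  private variable
    a b c d : ℚ
    A B : Set

  ≤-by : ∀ e → 0ℚ ≤ e → b ≡ a + e → a ≤ b
  ≤-by {a = a} e 0≤e refl = subst (_≤ a + e) (ℚ.+-identityʳ a) (ℚ.+-monoʳ-≤ a 0≤e)

  ≤⇒0≤- : a ≤ b → 0ℚ ≤ b - a
  ≤⇒0≤- {a} {b} a≤b = subst (_≤ b - a) (ℚ.+-inverseʳ a) (ℚ.+-monoˡ-≤ (- a) a≤b)

  0≤-⇒≤ : 0ℚ ≤ b - a → a ≤ b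
  0≤-⇒≤ {b} {a} h = ≤-by (b - a) h (eq a b)
    where
    eq : ∀ a b → b ≡ a + (b - a)
    eq = solve-∀ ℚ-ring

  0≤1 : 0ℚ ≤ 1ℚ
  0≤1 = ℚ.nonNegative⁻¹ 1ℚ

  0<1 : 0ℚ < 1ℚ
  0<1 = ℚ.positive⁻¹ 1ℚ

  0≤2 : 0ℚ ≤ 2ℚ
  0≤2 = ℚ.nonNegative⁻¹ 2ℚ

  0<2 : 0ℚ < 2ℚ
  0<2 = ℚ.+-mono-< 0<1 0<1

  0≤½ : 0ℚ ≤ ½
  0≤½ = ℚ.nonNegative⁻¹ ½

  0≤+ : 0ℚ ≤ a → 0ℚ ≤ b → 0ℚ ≤ a + b
  0≤+ p q = ℚ.+-mono-≤ p q

  0≤* : 0ℚ ≤ a → 0ℚ ≤ b → 0ℚ ≤ a * b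
  0≤* {a} {b} p q =
    ℚ.nonNegative⁻¹ (a * b) {{ℚ.nonNeg*nonNeg⇒nonNeg a {{ℚ.nonNegative p}} b {{ℚ.nonNegative q}}}}

  0<* : 0ℚ < a → 0ℚ < b → 0ℚ < a * b
  0<* {a} {b} p q = ℚ.positive⁻¹ (a * b) {{ℚ.pos*pos⇒pos a {{ℚ.positive p}} b {{ℚ.positive q}}}}

  0≤sq : ∀ a → 0ℚ ≤ a * a
  0≤sq a with ℚ.≤-total 0ℚ a
  ... | inj₁ p = 0≤* p p
  ... | inj₂ p = subst (0ℚ ≤_) (eq a) (0≤* (ℚ.neg-antimono-≤ p) (ℚ.neg-antimono-≤ p))
    where
    eq : ∀ a → (- a) * (- a) ≡ a * a
    eq = solve-∀ ℚ-ring

  *-monoˡ : 0ℚ ≤ c → a ≤ b → c * a ≤ c * b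
  *-monoˡ {c} 0≤c = ℚ.*-monoˡ-≤-nonNeg c {{ℚ.nonNegative 0≤c}}

  *-monoʳ : 0ℚ ≤ c → a ≤ b → a * c ≤ b * c
  *-monoʳ {c} 0≤c = ℚ.*-monoʳ-≤-nonNeg c {{ℚ.nonNegative 0≤c}}

  *-mono : 0ℚ ≤ a → a ≤ b → 0ℚ ≤ c → c ≤ d → a * c ≤ b * d
  *-mono 0≤a a≤b 0≤c c≤d = ℚ.≤-trans (*-monoʳ 0≤c a≤b) (*-monoˡ (ℚ.≤-trans 0≤a a≤b) c≤d)

  *-cancelˡ : 0ℚ < c → c * a ≤ c * b → a ≤ b
  *-cancelˡ {c} 0<c = ℚ.*-cancelˡ-≤-pos c {{ℚ.positive 0<c}}

  *-cancelˡ-≡ : 0ℚ < c → c * a ≡ c * b → a ≡ b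
  *-cancelˡ-≡ p eq = ℚ.≤-antisym (*-cancelˡ p (ℚ.≤-reflexive eq)) (*-cancelˡ p (ℚ.≤-reflexive (sym eq)))

  sq-mono⁻¹ : 0ℚ ≤ b → a * a ≤ b * b → a ≤ b
  sq-mono⁻¹ {b} {a} 0≤b h with a ℚ.≤? b
  ... | yes p = p
  ... | no ¬p = ⊥-elim (ℚ.<-irrefl refl (ℚ.<-≤-trans lt h))
    where
    b<a = ℚ.≰⇒> ¬p
    lt : b * b < a * a
    lt = ℚ.≤-<-trans (*-monoˡ 0≤b (ℚ.<⇒≤ b<a)) (ℚ.*-monoˡ-<-pos a {{ℚ.positive (ℚ.≤-<-trans 0≤b b<a)}} b<a)

  abstract
    -- Total, with value 0 at 0, so that no proof of nonzeroness travels with the terms. Being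
    -- abstract, it is known only through `*-recip`, `0<recip` and their consequences.
    recip : ℚ → ℚ
    recip q with q ℚ.≟ 0ℚ
    ... | yes _  = 0ℚ
    ... | no q≢0 = ℚ.1/_ q {{ℚ.≢-nonZero q≢0}}

    *-recip : 0ℚ < a → a * recip a ≡ 1ℚ
    *-recip {a} 0<a with a ℚ.≟ 0ℚ
    ... | yes refl = ⊥-elim (ℚ.<-irrefl refl 0<a)
    ... | no a≢0   = ℚ.*-inverseʳ a {{ℚ.≢-nonZero a≢0}}

    0<recip : 0ℚ < a → 0ℚ < recip a
    0<recip {a} 0<a with a ℚ.≟ 0ℚ
    ... | yes refl = ⊥-elim (ℚ.<-irrefl refl 0<a)
    ... | no a≢0   = ℚ.positive⁻¹ _ {{ℚ.1/pos⇒pos a {{ℚ.positive 0<a}}}}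

  0≤recip : 0ℚ < a → 0ℚ ≤ recip a
  0≤recip p = ℚ.<⇒≤ (0<recip p)

  recip-unique : 0ℚ < a → a * b ≡ 1ℚ → b ≡ recip a
  recip-unique p eq = *-cancelˡ-≡ p (trans eq (sym (*-recip p)))

  recip-anti : 0ℚ < a → a ≤ b → recip b ≤ recip a
  recip-anti {a} {b} 0<a a≤b = *-cancelˡ 0<a (*-cancelˡ 0<b
    (ℚ.≤-trans (ℚ.≤-reflexive (trans (eq₁ b a (recip b)) (trans (cong (a *_) (*-recip 0<b)) (ℚ.*-identityʳ a))))
    (ℚ.≤-trans a≤b (ℚ.≤-reflexive (sym (trans (cong (b *_) (*-recip 0<a)) (ℚ.*-identityʳ b)))))))
    where
    0<b = ℚ.<-≤-trans 0<a a≤b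
    eq₁ : ∀ b a r → b * (a * r) ≡ a * (b * r)
    eq₁ = solve-∀ ℚ-ring

  recip-* : 0ℚ < a → 0ℚ < b → recip (a * b) ≡ recip a * recip b
  recip-* {a} {b} p q = sym (recip-unique (0<* p q)
    (trans (eq a b (recip a) (recip b)) (trans (cong₂ _*_ (*-recip p) (*-recip q)) (ℚ.*-identityʳ 1ℚ))))
    where
    eq : ∀ a b r s → a * b * (r * s) ≡ (a * r) * (b * s)
    eq = solve-∀ ℚ-ring

  ι : ℕ → ℚ
  ι zero    = 0ℚ
  ι (suc n) = 1ℚ + ι n

  0≤ι : ∀ n → 0ℚ ≤ ι n
  0≤ι zero    = ℚ.≤-refl
  0≤ι (suc n) = 0≤+ 0≤1 (0≤ι n)

  0<ι : ∀ n → 0ℚ < ι (suc n)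
  0<ι n = ℚ.+-mono-<-≤ 0<1 (0≤ι n)

  ι-+ : ∀ m n → ι (m ℕ.+ n) ≡ ι m + ι n
  ι-+ zero n = sym (ℚ.+-identityˡ (ι n))
  ι-+ (suc m) n = trans (cong (λ q → 1ℚ + q) (ι-+ m n)) (sym (ℚ.+-assoc 1ℚ (ι m) (ι n)))

  ι-* : ∀ m n → ι (m ℕ.* n) ≡ ι m * ι n
  ι-* zero n = sym (ℚ.*-zeroˡ (ι n))
  ι-* (suc m) n = trans (ι-+ n (m ℕ.* n)) (trans (cong (λ q → ι n + q) (ι-* m n)) (eq (ι m) (ι n)))
    where
    eq : ∀ a b → b + a * b ≡ (1ℚ + a) * b
    eq = solve-∀ ℚ-ring

  ι-mono : ∀ {m n} → m ℕ.≤ n → ι m ≤ ι n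
  ι-mono {n = n} ℕ.z≤n = 0≤ι n
  ι-mono (ℕ.s≤s p) = ℚ.+-monoʳ-≤ 1ℚ (ι-mono p)

  infixr 8 _^^_
  _^^_ : ℚ → ℕ → ℚ
  q ^^ zero  = 1ℚ
  q ^^ suc n = q * q ^^ n

  ι-^ : ∀ m n → ι (m ℕ.^ n) ≡ ι m ^^ n
  ι-^ m zero = refl
  ι-^ m (suc n) = trans (ι-* m (m ℕ.^ n)) (cong (λ q → ι m * q) (ι-^ m n))

  0≤^^ : ∀ n → 0ℚ ≤ a → 0ℚ ≤ a ^^ n
  0≤^^ zero    p = 0≤1
  0≤^^ (suc n) p = 0≤* p (0≤^^ n p)

  0<^^ : ∀ n → 0ℚ < a → 0ℚ < a ^^ n
  0<^^ zero    p = 0<1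
  0<^^ (suc n) p = 0<* p (0<^^ n p)

  ^^-mono : ∀ n → 0ℚ ≤ a → a ≤ b → a ^^ n ≤ b ^^ n
  ^^-mono zero    p q = ℚ.≤-refl
  ^^-mono (suc n) p q = *-mono p q (0≤^^ n p) (^^-mono n p q)

  ^^-+ : ∀ a m n → a ^^ (m ℕ.+ n) ≡ a ^^ m * a ^^ n
  ^^-+ a zero n = sym (ℚ.*-identityˡ _)
  ^^-+ a (suc m) n = trans (cong (λ q → a * q) (^^-+ a m n)) (sym (ℚ.*-assoc a _ _))

  ^^-*-distrib : ∀ a b n → (a * b) ^^ n ≡ a ^^ n * b ^^ n
  ^^-*-distrib a b zero = refl
  ^^-*-distrib a b (suc n) = trans (cong (λ q → a * b * q) (^^-*-distrib a b n)) (eq a b (a ^^ n) (b ^^ n))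
    where
    eq : ∀ a b c d → a * b * (c * d) ≡ a * c * (b * d)
    eq = solve-∀ ℚ-ring

  1^^ : ∀ n → 1ℚ ^^ n ≡ 1ℚ
  1^^ zero = refl
  1^^ (suc n) = trans (ℚ.*-identityˡ _) (1^^ n)

  ^^-^^ : ∀ a m n → (a ^^ m) ^^ n ≡ a ^^ (m ℕ.* n)
  ^^-^^ a zero n = 1^^ n
  ^^-^^ a (suc m) n = trans (^^-*-distrib a (a ^^ m) n) (trans (cong (λ q → a ^^ n * q) (^^-^^ a m n)) (sym (^^-+ a n (m ℕ.* n))))

  ^^-≤1 : ∀ n → 0ℚ ≤ a → a ≤ 1ℚ → a ^^ n ≤ 1ℚ
  ^^-≤1 {a} n p q = subst (a ^^ n ≤_) (1^^ n) (^^-mono n p q)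

  1≤^^ : ∀ n → 1ℚ ≤ a → 1ℚ ≤ a ^^ n
  1≤^^ {a} n p = subst (_≤ a ^^ n) (1^^ n) (^^-mono n 0≤1 p)

  -- Stands in for taking roots, which need not be rational.
  ^^-cancel : ∀ n → 0ℚ ≤ b → a ^^ suc n ≤ b ^^ suc n → a ≤ b
  ^^-cancel {b} {a} n 0≤b h with a ℚ.≤? b
  ... | yes p = p
  ... | no ¬p = ⊥-elim (ℚ.<-irrefl refl (ℚ.<-≤-trans lt h))
    where
    b<a = ℚ.≰⇒> ¬p
    0<a = ℚ.≤-<-trans 0≤b b<a
    lt : b ^^ suc n < a ^^ suc n
    lt = ℚ.≤-<-trans (*-monoˡ 0≤b (^^-mono n 0≤b (ℚ.<⇒≤ b<a))) (ℚ.*-monoˡ-<-pos (a ^^ n) {{ℚ.positive (0<^^ n 0<a)}} b<a)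

  bernoulli : ∀ n → 0ℚ ≤ a → 1ℚ + ι n * a ≤ (1ℚ + a) ^^ n
  bernoulli {a} zero p = ℚ.≤-reflexive (trans (cong (λ q → 1ℚ + q) (ℚ.*-zeroˡ a)) refl)
  bernoulli {a} (suc n) p = ℚ.≤-trans
    (≤-by (ι n * (a * a)) (0≤* (0≤ι n) (0≤sq a)) (eq a (ι n)))
    (*-monoˡ (0≤+ 0≤1 p) (bernoulli n p))
    where
    eq : ∀ a n → (1ℚ + a) * (1ℚ + n * a) ≡ (1ℚ + (1ℚ + n) * a) + n * (a * a)
    eq = solve-∀ ℚ-ring


  𝟙 : {P : Set} → Dec P → ℚ
  𝟙 (yes _) = 1ℚ
  𝟙 (no _)  = 0ℚ

  module _ {P : Set} where
    𝟙-yes : (d : Dec P) → P → 𝟙 d ≡ 1ℚ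
    𝟙-yes (yes _) _ = refl
    𝟙-yes (no ¬p) p = contradiction p ¬p

    𝟙-no : (d : Dec P) → ¬ P → 𝟙 d ≡ 0ℚ
    𝟙-no (yes p) ¬p = contradiction p ¬p
    𝟙-no (no _)  _  = refl

    0≤𝟙 : (d : Dec P) → 0ℚ ≤ 𝟙 d
    0≤𝟙 (yes _) = 0≤1
    0≤𝟙 (no _)  = ℚ.≤-refl

    𝟙≤1 : (d : Dec P) → 𝟙 d ≤ 1ℚ
    𝟙≤1 (yes _) = ℚ.≤-refl
    𝟙≤1 (no _)  = 0≤1

    𝟙-cong : (d : Dec P) → (P → a ≡ b) → 𝟙 d * a ≡ 𝟙 d * b
    𝟙-cong (yes p) h = cong (1ℚ *_) (h p)
    𝟙-cong {a} {b} (no _) h = trans (ℚ.*-zeroˡ a) (sym (ℚ.*-zeroˡ b))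

  𝟙-⇔ : {P Q : Set} (d : Dec P) (e : Dec Q) → (P → Q) → (Q → P) → 𝟙 d ≡ 𝟙 e
  𝟙-⇔ (yes p) e f g = sym (𝟙-yes e (f p))
  𝟙-⇔ (no ¬p) e f g = sym (𝟙-no e (¬p ∘ g))

  ∑ : List A → (A → ℚ) → ℚ
  ∑ []       f = 0ℚ
  ∑ (x ∷ xs) f = f x + ∑ xs f

  sumℚ-map : (xs : List A) (f : A → ℚ) → sumℚ (map f xs) ≡ ∑ xs f
  sumℚ-map []       f = refl
  sumℚ-map (x ∷ xs) f = cong (λ q → f x + q) (sumℚ-map xs f)

  module _ {A : Set} where
    ∑-cong-∈ : (xs : List A) {f g : A → ℚ} → (∀ x → x ∈ xs → f x ≡ g x) → ∑ xs f ≡ ∑ xs g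
    ∑-cong-∈ []       h = refl
    ∑-cong-∈ (x ∷ xs) h = cong₂ _+_ (h x (here refl)) (∑-cong-∈ xs λ y y∈ → h y (there y∈))

    ∑-cong : (xs : List A) {f g : A → ℚ} → (∀ x → f x ≡ g x) → ∑ xs f ≡ ∑ xs g
    ∑-cong xs h = ∑-cong-∈ xs λ x _ → h x

    ∑-mono-∈ : (xs : List A) {f g : A → ℚ} → (∀ x → x ∈ xs → f x ≤ g x) → ∑ xs f ≤ ∑ xs g
    ∑-mono-∈ []       h = ℚ.≤-refl
    ∑-mono-∈ (x ∷ xs) h = ℚ.+-mono-≤ (h x (here refl)) (∑-mono-∈ xs λ y y∈ → h y (there y∈))

    ∑-mono : (xs : List A) {f g : A → ℚ} → (∀ x → f x ≤ g x) → ∑ xs f ≤ ∑ xs g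
    ∑-mono xs h = ∑-mono-∈ xs λ x _ → h x

    0≤∑ : (xs : List A) {f : A → ℚ} → (∀ x → 0ℚ ≤ f x) → 0ℚ ≤ ∑ xs f
    0≤∑ []       h = ℚ.≤-refl
    0≤∑ (x ∷ xs) h = 0≤+ (h x) (0≤∑ xs h)

    ∑-zero : (xs : List A) {f : A → ℚ} → (∀ x → x ∈ xs → f x ≡ 0ℚ) → ∑ xs f ≡ 0ℚ
    ∑-zero []       h = refl
    ∑-zero (x ∷ xs) h = trans (cong₂ _+_ (h x (here refl)) (∑-zero xs λ y y∈ → h y (there y∈))) refl

    ∑-+ : (xs : List A) (f g : A → ℚ) → ∑ xs (λ x → f x + g x) ≡ ∑ xs f + ∑ xs g
    ∑-+ []       f g = refl
    ∑-+ (x ∷ xs) f g = trans (cong (λ q → f x + g x + q) (∑-+ xs f g)) (eq (f x) (g x) (∑ xs f) (∑ xs g))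
      where
      eq : ∀ a b c d → a + b + (c + d) ≡ (a + c) + (b + d)
      eq = solve-∀ ℚ-ring

    ∑-- : (xs : List A) (f g : A → ℚ) → ∑ xs (λ x → f x - g x) ≡ ∑ xs f - ∑ xs g
    ∑-- []       f g = refl
    ∑-- (x ∷ xs) f g = trans (cong (λ q → f x - g x + q) (∑-- xs f g)) (eq (f x) (g x) (∑ xs f) (∑ xs g))
      where
      eq : ∀ a b c d → a - b + (c - d) ≡ (a + c) - (b + d)
      eq = solve-∀ ℚ-ring

    ∑-*ˡ : (xs : List A) (c : ℚ) (f : A → ℚ) → ∑ xs (λ x → c * f x) ≡ c * ∑ xs f
    ∑-*ˡ []       c f = sym (ℚ.*-zeroʳ c)
    ∑-*ˡ (x ∷ xs) c f = trans (cong (λ q → c * f x + q) (∑-*ˡ xs c f)) (sym (ℚ.*-distribˡ-+ c (f x) (∑ xs f)))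

    ∑-*ʳ : (xs : List A) (c : ℚ) (f : A → ℚ) → ∑ xs (λ x → f x * c) ≡ ∑ xs f * c
    ∑-*ʳ xs c f = trans (∑-cong xs λ x → ℚ.*-comm (f x) c) (trans (∑-*ˡ xs c f) (ℚ.*-comm c (∑ xs f)))

    ∑-const : (xs : List A) (c : ℚ) → ∑ xs (λ _ → c) ≡ ι (length xs) * c
    ∑-const []       c = sym (ℚ.*-zeroˡ c)
    ∑-const (x ∷ xs) c = trans (cong (λ q → c + q) (∑-const xs c)) (eq c (ι (length xs)))
      where
      eq : ∀ c n → c + n * c ≡ (1ℚ + n) * c
      eq = solve-∀ ℚ-ring

    ∑-single : {xs : List A} → Unique xs → ∀ {a} → a ∈ xs → (f : A → ℚ) →
               (∀ x → x ≢ a → f x ≡ 0ℚ) → ∑ xs f ≡ f a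
    ∑-single {x ∷ xs} (x∉ ∷ u) (here refl) f h =
      trans (cong (λ q → f x + q) (∑-zero xs λ y y∈ → h y λ { refl → All.lookup x∉ y∈ refl })) (ℚ.+-identityʳ (f x))
    ∑-single {x ∷ xs} (x∉ ∷ u) {a} (there a∈) f h =
      trans (cong₂ _+_ (h x λ { refl → All.lookup x∉ a∈ refl }) (∑-single u a∈ f h)) (ℚ.+-identityˡ (f a))

    ∑-≥ : (xs : List A) {f : A → ℚ} → (∀ x → 0ℚ ≤ f x) → ∀ {a} → a ∈ xs → f a ≤ ∑ xs f
    ∑-≥ (x ∷ xs) h (here refl) = ≤-by _ (0≤∑ xs h) refl
    ∑-≥ (x ∷ xs) {f} h (there a∈) = ℚ.≤-trans (∑-≥ xs h a∈) (≤-by (f x) (h x) (ℚ.+-comm (f x) _))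

  ∑-swap : (xs : List A) (ys : List B) (f : A → B → ℚ) →
           ∑ xs (λ x → ∑ ys (f x)) ≡ ∑ ys (λ y → ∑ xs (λ x → f x y))
  ∑-swap []       ys f = sym (∑-zero ys λ _ _ → refl)
  ∑-swap (x ∷ xs) ys f = trans (cong (λ q → ∑ ys (f x) + q) (∑-swap xs ys f))
    (sym (∑-+ ys (f x) (λ y → ∑ xs (λ x → f x y))))

  ∏ : List A → (A → ℚ) → ℚ
  ∏ []       f = 1ℚ
  ∏ (x ∷ xs) f = f x * ∏ xs f

  module _ {A : Set} where
    ∏-cong-∈ : (xs : List A) {f g : A → ℚ} → (∀ x → x ∈ xs → f x ≡ g x) → ∏ xs f ≡ ∏ xs g
    ∏-cong-∈ []       h = refl
    ∏-cong-∈ (x ∷ xs) h = cong₂ _*_ (h x (here refl)) (∏-cong-∈ xs λ y y∈ → h y (there y∈))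

    0≤∏ : (xs : List A) {f : A → ℚ} → (∀ x → 0ℚ ≤ f x) → 0ℚ ≤ ∏ xs f
    0≤∏ []       h = 0≤1
    0≤∏ (x ∷ xs) h = 0≤* (h x) (0≤∏ xs h)

    0<∏ : (xs : List A) {f : A → ℚ} → (∀ x → 0ℚ < f x) → 0ℚ < ∏ xs f
    0<∏ []       h = 0<1
    0<∏ (x ∷ xs) h = 0<* (h x) (0<∏ xs h)

    ∏-mono-∈ : (xs : List A) {f g : A → ℚ} → (∀ x → 0ℚ ≤ f x) → (∀ x → x ∈ xs → f x ≤ g x) → ∏ xs f ≤ ∏ xs g
    ∏-mono-∈ []       n h = ℚ.≤-refl
    ∏-mono-∈ (x ∷ xs) n h = *-mono (n x) (h x (here refl)) (0≤∏ xs n) (∏-mono-∈ xs n λ y y∈ → h y (there y∈))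

    1≤∏ : (xs : List A) {f : A → ℚ} → (∀ x → 1ℚ ≤ f x) → 1ℚ ≤ ∏ xs f
    1≤∏ []       h = ℚ.≤-refl
    1≤∏ (x ∷ xs) h = *-mono 0≤1 (h x) 0≤1 (1≤∏ xs h)

    ∏-* : (xs : List A) (f g : A → ℚ) → ∏ xs (λ x → f x * g x) ≡ ∏ xs f * ∏ xs g
    ∏-* []       f g = refl
    ∏-* (x ∷ xs) f g = trans (cong (λ q → f x * g x * q) (∏-* xs f g)) (eq (f x) (g x) (∏ xs f) (∏ xs g))
      where
      eq : ∀ a b c d → a * b * (c * d) ≡ a * c * (b * d)
      eq = solve-∀ ℚ-ring

    ∏-^^ : (xs : List A) (n : ℕ) (f : A → ℚ) → ∏ xs (λ x → f x ^^ n) ≡ ∏ xs f ^^ n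
    ∏-^^ []       n f = sym (1^^ n)
    ∏-^^ (x ∷ xs) n f = trans (cong (λ q → f x ^^ n * q) (∏-^^ xs n f)) (sym (^^-*-distrib (f x) (∏ xs f) n))

  ∏-const : (xs : List A) (c : ℚ) → ∏ xs (λ _ → c) ≡ c ^^ length xs
  ∏-const []       c = refl
  ∏-const (x ∷ xs) c = cong (c *_) (∏-const xs c)

  ∏-swap : (xs : List A) (ys : List B) (f : A → B → ℚ) →
           ∏ xs (λ x → ∏ ys (f x)) ≡ ∏ ys (λ y → ∏ xs (λ x → f x y))
  ∏-swap []       ys f = sym (trans (∏-const ys 1ℚ) (1^^ (length ys)))
  ∏-swap (x ∷ xs) ys f = trans (cong (λ q → ∏ ys (f x) * q) (∏-swap xs ys f))
    (sym (∏-* ys (f x) (λ y → ∏ xs (λ x → f x y))))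

-- Colourings, block averages and Dirichlet forms

-- The analysis sees colourings as functions indexed by `Fin size`. `complete` realises any
-- recolouring checked to be proper and `st-inj` makes it unique, which is what sums over states
-- need; `Ω` returns only when the chain of the statement is identified.
record Enumeration {n : ℕ} (G : Graph n) (L : ListAssignment n) : Set where
  field
    size     : ℕ
    st       : Fin size → Fin n → ℕ
    st-∈     : ∀ x v → st x v ∈ colours L v
    st-edge  : ∀ x u v → adj G u v ≡ true → st x u ≢ st x v
    complete : (σ : Fin n → ℕ) → (∀ v → σ v ∈ colours L v) →
               (∀ u v → adj G u v ≡ true → σ u ≢ σ v) → ∃[ x ] (∀ v → st x v ≡ σ v)
    st-inj   : ∀ x y → (∀ v → st x v ≡ st y v) → x ≡ y

Region : ℕ → Set
Region n = Fin n → Bool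

❴_❵ : ∀ {n} → Fin n → Region n
❴ s ❵ v = does (v Fin.≟ s)

module _ {n} {s v : Fin n} where
  ❴❵-true : ❴ s ❵ v ≡ true → v ≡ s
  ❴❵-true eq with v Fin.≟ s
  ... | yes p = p

  ❴❵-false : ❴ s ❵ v ≡ false → v ≢ s
  ❴❵-false eq p with v Fin.≟ s
  ... | no ¬p = ¬p p

  ≢⇒❴❵ : v ≢ s → ❴ s ❵ v ≡ false
  ≢⇒❴❵ p = dec-false (v Fin.≟ s) p

true≢false : ∀ {b} → b ≡ true → b ≡ false → ⊥
true≢false refl ()

module Averages {n : ℕ} (G : Graph n) (L : ListAssignment n) (S : Enumeration G L) where
  open Enumeration S

  State : Set
  State = Fin size

  X : List State
  X = allFin size

  X! : Unique X
  X! = Unique.allFin⁺ size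

  ∈X : ∀ x → x ∈ X
  ∈X = ∈-allFin

  ∑-unique : (f : State → ℚ) → ∀ x → (∀ y → y ≢ x → f y ≡ 0ℚ) → ∑ X f ≡ f x
  ∑-unique f x h = ∑-single X! (∈X x) f h

  infix 4 _~[_]_
  _~[_]_ : State → Region n → State → Set
  x ~[ W ] y = ∀ v → W v ≡ false → st x v ≡ st y v

  ~? : ∀ x W y → Dec (x ~[ W ] y)
  ~? x W y = Fin.all? λ v → (W v Bool.≟ false) →-dec (st x v ℕ.≟ st y v)

  ~-refl : ∀ {W x} → x ~[ W ] x
  ~-refl v _ = refl

  ~-sym : ∀ {W x y} → x ~[ W ] y → y ~[ W ] x
  ~-sym p v w = sym (p v w)

  ~-trans : ∀ {W x y z} → x ~[ W ] y → y ~[ W ] z → x ~[ W ] z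
  ~-trans p q v w = trans (p v w) (q v w)

  -- Inclusion in contrapositive form, since `_~[_]_` quantifies over the vertices outside the
  -- region.
  _⊑_ : Region n → Region n → Set
  W ⊑ W′ = ∀ v → W′ v ≡ false → W v ≡ false

  ~-weaken : ∀ {W W′ x y} → W ⊑ W′ → x ~[ W ] y → x ~[ W′ ] y
  ~-weaken i p v w = p v (i v w)

  r : Region n → State → State → ℚ
  r W x y = 𝟙 (~? x W y)

  r-sym : ∀ W x y → r W x y ≡ r W y x
  r-sym W x y = 𝟙-⇔ (~? x W y) (~? y W x) ~-sym ~-sym

  r-shift : ∀ W {x y} z → x ~[ W ] y → r W x z ≡ r W y z
  r-shift W {x} {y} z p = 𝟙-⇔ (~? x W z) (~? y W z) (~-trans (~-sym p)) (~-trans p)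

  0≤r : ∀ W x y → 0ℚ ≤ r W x y
  0≤r W x y = 0≤𝟙 (~? x W y)

  r-mult : ∀ W x y {a b} → (x ~[ W ] y → a ≡ b) → r W x y * a ≡ r W x y * b
  r-mult W x y = 𝟙-cong (~? x W y)

  N : Region n → State → ℚ
  N W x = ∑ X (r W x)

  1≤N : ∀ W x → 1ℚ ≤ N W x
  1≤N W x = subst (_≤ N W x) (𝟙-yes (~? x W x) ~-refl) (∑-≥ X (0≤r W x) (∈X x))

  0<N : ∀ W x → 0ℚ < N W x
  0<N W x = ℚ.<-≤-trans 0<1 (1≤N W x)

  N-inv : ∀ W {x y} → x ~[ W ] y → N W x ≡ N W y
  N-inv W p = ∑-cong X λ z → r-shift W z p

  -- The uniform law on the class of `x`. As `N W` is constant on classes the kernel is symmetric,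
  -- and `A W` is the conditional expectation given the colours outside `W`.
  k : Region n → State → State → ℚ
  k W x y = r W x y * recip (N W x)

  0≤k : ∀ W x y → 0ℚ ≤ k W x y
  0≤k W x y = 0≤* (0≤r W x y) (0≤recip (0<N W x))

  k-sym : ∀ W x y → k W x y ≡ k W y x
  k-sym W x y = trans (r-mult W x y λ p → cong recip (N-inv W p)) (cong (_* recip (N W y)) (r-sym W x y))

  k-row : ∀ W x → ∑ X (k W x) ≡ 1ℚ
  k-row W x = trans (∑-*ʳ X (recip (N W x)) (r W x)) (*-recip (0<N W x))

  k-mult : ∀ W x y {a b} → (x ~[ W ] y → a ≡ b) → k W x y * a ≡ k W x y * b
  k-mult W x y {a} {b} h = trans (eq (r W x y) _ a) (trans (cong (_* recip (N W x)) (r-mult W x y h)) (sym (eq (r W x y) _ b)))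
    where
    eq : ∀ r q a → r * q * a ≡ r * a * q
    eq = solve-∀ ℚ-ring

  k-mono : ∀ W x y {a b} → (x ~[ W ] y → a ≤ b) → k W x y * a ≤ k W x y * b
  k-mono W x y {a} {b} h with ~? x W y
  ... | yes p = *-monoˡ (0≤* 0≤1 (0≤recip (0<N W x))) (h p)
  ... | no  _ = ℚ.≤-reflexive (trans (eq (recip (N W x)) a) (sym (eq (recip (N W x)) b)))
    where
    eq : ∀ q a → 0ℚ * q * a ≡ 0ℚ
    eq = solve-∀ ℚ-ring

  A : Region n → (State → ℚ) → State → ℚ
  A W f x = ∑ X λ y → k W x y * f y

  Inv : Region n → (State → ℚ) → Set
  Inv W f = ∀ x y → x ~[ W ] y → f x ≡ f y

  A-cong : ∀ W {f g} x → (∀ y → x ~[ W ] y → f y ≡ g y) → A W f x ≡ A W g x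
  A-cong W x h = ∑-cong X λ y → k-mult W x y (h y)

  A-mono : ∀ W {f g} x → (∀ y → x ~[ W ] y → f y ≤ g y) → A W f x ≤ A W g x
  A-mono W x h = ∑-mono X λ y → k-mono W x y (h y)

  A-inv : ∀ W f → Inv W (A W f)
  A-inv W f x y p = ∑-cong X λ z → cong (_* f z) (cong₂ _*_ (r-shift W z p) (cong recip (N-inv W p)))

  A-+ : ∀ W f g x → A W (λ y → f y + g y) x ≡ A W f x + A W g x
  A-+ W f g x = trans (∑-cong X λ y → ℚ.*-distribˡ-+ (k W x y) (f y) (g y)) (∑-+ X _ _)

  A-- : ∀ W f g x → A W (λ y → f y - g y) x ≡ A W f x - A W g x
  A-- W f g x = trans (∑-cong X λ y → eq (k W x y) (f y) (g y)) (∑-- X _ _)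
    where
    eq : ∀ a b c → a * (b - c) ≡ a * b - a * c
    eq = solve-∀ ℚ-ring

  A-pull : ∀ W {g} → Inv W g → ∀ f x → A W (λ y → g y * f y) x ≡ g x * A W f x
  A-pull W {g} g-inv f x = trans
    (∑-cong X λ y → trans (k-mult W x y λ p → cong (_* f y) (sym (g-inv x y p))) (eq (k W x y) (g x) (f y)))
    (∑-*ˡ X (g x) _)
    where
    eq : ∀ a b c → a * (b * c) ≡ b * (a * c)
    eq = solve-∀ ℚ-ring

  A-*ˡ : ∀ W c f x → A W (λ y → c * f y) x ≡ c * A W f x
  A-*ˡ W c = A-pull W {λ _ → c} (λ _ _ _ → refl)

  A-const : ∀ W c x → A W (λ _ → c) x ≡ c
  A-const W c x = trans (∑-*ʳ X c (k W x)) (trans (cong (_* c) (k-row W x)) (ℚ.*-identityˡ c))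

  A-fix : ∀ W {g} → Inv W g → ∀ x → A W g x ≡ g x
  A-fix W {g} g-inv x = trans (∑-cong X λ y → k-mult W x y λ p → sym (g-inv x y p)) (A-const W (g x) x)

  0≤A : ∀ W {f} x → (∀ y → 0ℚ ≤ f y) → 0ℚ ≤ A W f x
  0≤A W x h = 0≤∑ X λ y → 0≤* (0≤k W x y) (h y)

  A-∑ : ∀ {B : Set} W (ys : List B) (f : B → State → ℚ) x →
        A W (λ y → ∑ ys λ b → f b y) x ≡ ∑ ys λ b → A W (f b) x
  A-∑ W ys f x = trans (∑-cong X λ y → sym (∑-*ˡ ys (k W x y) (λ b → f b y))) (∑-swap X ys _)

  -- A sum and not a mean over the states: the normalisation would cancel from both sides of a
  -- Poincaré inequality.
  ⟨_,_⟩ : (State → ℚ) → (State → ℚ) → ℚ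
  ⟨ f , g ⟩ = ∑ X λ x → f x * g x

  ⟨⟩-cong : ∀ {f f′ g g′} → (∀ x → f x ≡ f′ x) → (∀ x → g x ≡ g′ x) → ⟨ f , g ⟩ ≡ ⟨ f′ , g′ ⟩
  ⟨⟩-cong p q = ∑-cong X λ x → cong₂ _*_ (p x) (q x)

  ⟨⟩-comm : ∀ f g → ⟨ f , g ⟩ ≡ ⟨ g , f ⟩
  ⟨⟩-comm f g = ∑-cong X λ x → ℚ.*-comm (f x) (g x)

  ⟨⟩--ˡ : ∀ f g h → ⟨ (λ x → f x - g x) , h ⟩ ≡ ⟨ f , h ⟩ - ⟨ g , h ⟩
  ⟨⟩--ˡ f g h = trans (∑-cong X λ x → eq (f x) (g x) (h x)) (∑-- X _ _)
    where
    eq : ∀ a b c → (a - b) * c ≡ a * c - b * c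
    eq = solve-∀ ℚ-ring

  ⟨⟩--ʳ : ∀ h f g → ⟨ h , (λ x → f x - g x) ⟩ ≡ ⟨ h , f ⟩ - ⟨ h , g ⟩
  ⟨⟩--ʳ h f g = trans (⟨⟩-comm h _) (trans (⟨⟩--ˡ f g h) (cong₂ _-_ (⟨⟩-comm f h) (⟨⟩-comm g h)))

  0≤⟨f,f⟩ : ∀ f → 0ℚ ≤ ⟨ f , f ⟩
  0≤⟨f,f⟩ f = 0≤∑ X λ x → 0≤sq (f x)

  A-adjoint : ∀ W f g → ⟨ f , A W g ⟩ ≡ ⟨ A W f , g ⟩
  A-adjoint W f g = begin
    ∑ X (λ x → f x * ∑ X (λ y → k W x y * g y))   ≡⟨ ∑-cong X (λ x → sym (∑-*ˡ X (f x) _)) ⟩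
    ∑ X (λ x → ∑ X (λ y → f x * (k W x y * g y))) ≡⟨ ∑-swap X X _ ⟩
    ∑ X (λ y → ∑ X (λ x → f x * (k W x y * g y))) ≡⟨ ∑-cong X (λ y → ∑-cong X λ x → trans (eq (f x) (k W x y) (g y)) (cong (λ q → q * f x * g y) (k-sym W x y))) ⟩
    ∑ X (λ y → ∑ X (λ x → k W y x * f x * g y))   ≡⟨ ∑-cong X (λ y → ∑-*ʳ X (g y) _) ⟩
    ∑ X (λ y → A W f y * g y)                     ∎
    where
    open ≡-Reasoning
    eq : ∀ a b c → a * (b * c) ≡ b * a * c
    eq = solve-∀ ℚ-ring

  ∑-A : ∀ W f → ∑ X (A W f) ≡ ∑ X f
  ∑-A W f = trans (∑-cong X λ x → sym (ℚ.*-identityˡ _)) (trans (A-adjoint W (λ _ → 1ℚ) f)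
    (∑-cong X λ x → trans (cong (_* f x) (A-const W 1ℚ x)) (ℚ.*-identityˡ _)))

  -- By adjointness `A W` moves onto the row `k W′ x`, which is constant on the smaller classes of
  -- `W`.
  A-tower : ∀ {W W′} → W ⊑ W′ → ∀ f x → A W′ (A W f) x ≡ A W′ f x
  A-tower {W} {W′} i f x = trans (A-adjoint W (k W′ x) f) (∑-cong X λ y → cong (_* f y) (A-fix W k-inv y))
    where
    k-inv : Inv W (k W′ x)
    k-inv y z p = cong (_* recip (N W′ x))
      (trans (r-sym W′ x y) (trans (r-shift W′ x (~-weaken i p)) (r-sym W′ z x)))

  A-idem : ∀ W f x → A W (A W f) x ≡ A W f x
  A-idem W f = A-fix W (A-inv W f)

  E : Region n → (State → ℚ) → ℚ
  E W f = ⟨ f , f ⟩ - ⟨ f , A W f ⟩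

  ⟨f,Af⟩ : ∀ W f → ⟨ f , A W f ⟩ ≡ ⟨ A W f , A W f ⟩
  ⟨f,Af⟩ W f = trans (⟨⟩-cong {f} (λ _ → refl) λ x → sym (A-idem W f x)) (A-adjoint W f (A W f))

  E≤norm : ∀ W f → E W f ≤ ⟨ f , f ⟩
  E≤norm W f = ≤-by ⟨ f , A W f ⟩ (subst (0ℚ ≤_) (sym (⟨f,Af⟩ W f)) (0≤⟨f,f⟩ (A W f))) (eq ⟨ f , f ⟩ ⟨ f , A W f ⟩)
    where
    eq : ∀ a b → a ≡ (a - b) + b
    eq = solve-∀ ℚ-ring

  E-residual : ∀ W f → E W f ≡ ⟨ (λ x → f x - A W f x) , (λ x → f x - A W f x) ⟩
  E-residual W f = sym (begin
    ⟨ h , h ⟩                                     ≡⟨ ⟨⟩--ˡ f (A W f) h ⟩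
    ⟨ f , h ⟩ - ⟨ A W f , h ⟩                     ≡⟨ cong₂ _-_ (⟨⟩--ʳ f f (A W f)) (⟨⟩--ʳ (A W f) f (A W f)) ⟩
    E W f - (⟨ A W f , f ⟩ - ⟨ A W f , A W f ⟩)   ≡⟨ cong (λ q → E W f - (q - ⟨ A W f , A W f ⟩)) (trans (⟨⟩-comm (A W f) f) (⟨f,Af⟩ W f)) ⟩
    E W f - (⟨ A W f , A W f ⟩ - ⟨ A W f , A W f ⟩) ≡⟨ eq (E W f) ⟨ A W f , A W f ⟩ ⟩
    E W f                                         ∎)
    where
    open ≡-Reasoning
    h = λ x → f x - A W f x
    eq : ∀ a b → a - (b - b) ≡ a
    eq = solve-∀ ℚ-ring

  0≤E : ∀ W f → 0ℚ ≤ E W f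
  0≤E W f = subst (0ℚ ≤_) (sym (E-residual W f)) (0≤⟨f,f⟩ (λ x → f x - A W f x))

  sq : ℚ → ℚ
  sq a = a * a

  -- Variance as half a mean squared difference, for `x` uniform and `y` resampled from it. In this
  -- form a bound on `E` can be proved one pair of states at a time.
  E-pairs : ∀ W f → ∑ X (λ x → ∑ X λ y → k W x y * sq (f x - f y)) ≡ 2ℚ * E W f
  E-pairs W f = begin
    ∑ X (λ x → ∑ X λ y → k W x y * sq (f x - f y))
      ≡⟨ ∑-cong X (λ x → trans (∑-cong X λ y → eq (k W x y) (f x) (f y)) (trans (∑-+ X _ _) (cong₂ _+_ (trans (∑-+ X _ _) (cong₂ _+_ (∑-*ˡ X (sq (f x)) (k W x)) refl)) (∑-*ˡ X (- 2ℚ * f x) _)))) ⟩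
    ∑ X (λ x → sq (f x) * ∑ X (k W x) + ∑ X (λ y → k W x y * sq (f y)) + - 2ℚ * f x * A W f x)
      ≡⟨ trans (∑-+ X _ _) (cong₂ _+_ (∑-+ X _ _) refl) ⟩
    ∑ X (λ x → sq (f x) * ∑ X (k W x)) + ∑ X (A W (λ y → sq (f y))) + ∑ X (λ x → - 2ℚ * f x * A W f x)
      ≡⟨ cong₂ _+_ (cong₂ _+_ (∑-cong X λ x → trans (cong (sq (f x) *_) (k-row W x)) (ℚ.*-identityʳ _)) (∑-A W _))
           (trans (∑-cong X λ x → ℚ.*-assoc (- 2ℚ) (f x) (A W f x)) (∑-*ˡ X (- 2ℚ) _)) ⟩
    ⟨ f , f ⟩ + ⟨ f , f ⟩ + - 2ℚ * ⟨ f , A W f ⟩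
      ≡⟨ eq′ ⟨ f , f ⟩ ⟨ f , A W f ⟩ ⟩
    2ℚ * E W f ∎
    where
    open ≡-Reasoning
    eq : ∀ k a b → k * ((a - b) * (a - b)) ≡ a * a * k + k * (b * b) + - 2ℚ * a * (k * b)
    eq = solve-∀ ℚ-ring
    eq′ : ∀ a b → a + a + - 2ℚ * b ≡ 2ℚ * (a - b)
    eq′ = solve-∀ ℚ-ring

  -- The parallelogram law for the seminorm whose square is `E W`. It serves to replace `A W f` by
  -- `f` in a local term, at the price of a factor 2 and of the residual.
  E-subadd : ∀ W f g → E W g ≤ 2ℚ * E W f + 2ℚ * E W (λ x → f x - g x)
  E-subadd W f g = *-cancelˡ 0<2 (ℚ.≤-trans (ℚ.≤-reflexive (sym (E-pairs W g))) (ℚ.≤-trans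
    (∑-mono X λ x → ℚ.≤-trans (∑-mono X λ y → ℚ.≤-trans (*-monoˡ (0≤k W x y) (lem (f x) (f y) (g x) (g y)))
        (ℚ.≤-reflexive (eq (k W x y) _ _)))
      (ℚ.≤-reflexive (trans (∑-+ X _ _) (cong₂ _+_ (∑-*ˡ X 2ℚ _) (∑-*ˡ X 2ℚ _)))))
    (ℚ.≤-reflexive (trans (∑-+ X _ _) (trans (cong₂ _+_ (trans (∑-*ˡ X 2ℚ _) (cong (2ℚ *_) (E-pairs W f)))
      (trans (∑-*ˡ X 2ℚ _) (cong (2ℚ *_) (E-pairs W (λ x → f x - g x))))) (sym (ℚ.*-distribˡ-+ 2ℚ (2ℚ * E W f) (2ℚ * E W (λ x → f x - g x)))))))))
    where
    lem : ∀ a b c d → sq (c - d) ≤ 2ℚ * sq (a - b) + 2ℚ * sq ((a - c) - (b - d))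
    lem a b c d = ≤-by (sq (2ℚ * (a - b) - (c - d))) (0≤sq (2ℚ * (a - b) - (c - d))) (eq a b c d)
      where
      eq : ∀ a b c d → 2ℚ * ((a - b) * (a - b)) + 2ℚ * (((a - c) - (b - d)) * ((a - c) - (b - d))) ≡
           (c - d) * (c - d) + (2ℚ * (a - b) - (c - d)) * (2ℚ * (a - b) - (c - d))
      eq = solve-∀ ℚ-ring
    eq : ∀ k a b → k * (2ℚ * a + 2ℚ * b) ≡ 2ℚ * (k * a) + 2ℚ * (k * b)
    eq = solve-∀ ℚ-ring

  -- Tensorisation over non-adjacent regions.

  record Separated (W₁ W₂ : Region n) : Set where
    field
      disjoint : ∀ v → W₁ v ≡ true → W₂ v ≡ false
      no-edge  : ∀ u v → W₁ u ≡ true → W₂ v ≡ true → adj G u v ≡ false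

  Separated-sym : ∀ {W₁ W₂} → Separated W₁ W₂ → Separated W₂ W₁
  Separated-sym {W₁} {W₂} s = record
    { disjoint = λ v p → Bool.¬-not λ q → true≢false p (disjoint v q)
    ; no-edge  = λ u v p q → trans (adj-sym G u v) (no-edge v u q p)
    }
    where open Separated s

  module _ {W₁ W₂ : Region n} (sep : Separated W₁ W₂) where
    open Separated sep

    midpoint : ∀ x z → (∀ v → W₁ v ≡ false → W₂ v ≡ false → st x v ≡ st z v) →
               ∃[ y ] (x ~[ W₁ ] y × y ~[ W₂ ] z)
    midpoint x z h = y , (λ v w → sym (trans (st-y v) (out w))) , (λ v w → trans (st-y v) (inn w))
      where
      σ : Fin n → ℕ
      σ v = if W₁ v then st z v else st x v
      out : ∀ {v} → W₁ v ≡ false → σ v ≡ st x v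
      out {v} eq rewrite eq = refl
      into : ∀ {v} → W₁ v ≡ true → σ v ≡ st z v
      into {v} eq rewrite eq = refl
      inn : ∀ {v} → W₂ v ≡ false → σ v ≡ st z v
      inn {v} w₂ with W₁ v Bool.≟ false
      ... | yes w₁ = trans (out w₁) (h v w₁ w₂)
      ... | no ¬w₁ = into (Bool.¬-not ¬w₁)
      σ-∈ : ∀ v → σ v ∈ colours L v
      σ-∈ v with W₁ v
      ... | true  = st-∈ z v
      ... | false = st-∈ x v
      -- An edge meeting W₁ lies outside W₂, and one avoiding W₁ is coloured by x.
      σ-edge : ∀ u v → adj G u v ≡ true → σ u ≢ σ v
      σ-edge u v e with W₁ u Bool.≟ true | W₁ v Bool.≟ true
      ... | no p | no q rewrite out (Bool.¬-not p) | out (Bool.¬-not q) = st-edge x u v e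
      ... | yes p | _ rewrite into p | inn (Bool.¬-not λ q → true≢false e (no-edge u v p q)) = st-edge z u v e
      ... | _ | yes q rewrite into q | inn (Bool.¬-not λ p → true≢false e (trans (adj-sym G u v) (no-edge v u q p))) = st-edge z u v e
      y = proj₁ (complete σ σ-∈ σ-edge)
      st-y = proj₂ (complete σ σ-∈ σ-edge)

    -- The midpoint is unique: off `W₁` it is `x`, off `W₂` it is `z`, and by disjointness every
    -- vertex is off one of them. A class of the union is thus a product, and this sum, being 1, can
    -- be inserted wherever a bijection of classes is wanted.
    midpoint-sum : ∀ x z → (∀ v → W₁ v ≡ false → W₂ v ≡ false → st x v ≡ st z v) →
                   ∑ X (λ y → r W₁ x y * r W₂ y z) ≡ 1ℚ
    midpoint-sum x z h with midpoint x z h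
    ... | y , p , q = trans (∑-unique _ y uniq) (cong₂ _*_ (𝟙-yes (~? x W₁ y) p) (𝟙-yes (~? y W₂ z) q))
      where
      uniq : ∀ y′ → y′ ≢ y → r W₁ x y′ * r W₂ y′ z ≡ 0ℚ
      uniq y′ ne with ~? x W₁ y′ | ~? y′ W₂ z
      ... | no _   | d     = ℚ.*-zeroˡ (𝟙 d)
      ... | yes _  | no _  = refl
      ... | yes p′ | yes q′ = ⊥-elim (ne (st-inj y′ y agree))
        where
        agree : ∀ v → st y′ v ≡ st y v
        agree v with W₁ v Bool.≟ false
        ... | yes w = trans (sym (p′ v w)) (p v w)
        ... | no ¬w = trans (q′ v w₂) (sym (q v w₂))
          where w₂ = disjoint v (Bool.¬-not ¬w)

  module _ {W₁ W₂ : Region n} (sep : Separated W₁ W₂) where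
    open Separated sep

    private
      S₁ : (State → ℚ) → State → ℚ
      S₁ g x = ∑ X λ y → r W₁ x y * g y

      -- Moves in `W₂` match the `W₁`-class of `x` with that of `x′`. Inserting one midpoint sum,
      -- exchanging the sums and removing another carries the term at `y` to the `y′` with
      -- `y ~[ W₂ ] y′`, where `g` has the same value.
      S₁-inv : ∀ {g} → Inv W₂ g → Inv W₂ (S₁ g)
      S₁-inv {g} g-inv x x′ p = begin
        ∑ X (λ y → r W₁ x y * g y)
          ≡⟨ ∑-cong X (λ y → trans (r-mult W₁ x y λ q →
               trans (sym (ℚ.*-identityʳ (g y))) (cong (g y *_) (sym
                 (midpoint-sum (Separated-sym sep) y x′ λ v w₂ w₁ → trans (sym (q v w₁)) (p v w₂))))) (sym (ℚ.*-assoc (r W₁ x y) (g y) _))) ⟩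
        ∑ X (λ y → r W₁ x y * g y * ∑ X (λ y′ → r W₂ y y′ * r W₁ y′ x′))
          ≡⟨ ∑-cong X (λ y → sym (∑-*ˡ X (r W₁ x y * g y) (λ y′ → r W₂ y y′ * r W₁ y′ x′))) ⟩
        ∑ X (λ y → ∑ X (λ y′ → r W₁ x y * g y * (r W₂ y y′ * r W₁ y′ x′)))
          ≡⟨ ∑-swap X X _ ⟩
        ∑ X (λ y′ → ∑ X (λ y → r W₁ x y * g y * (r W₂ y y′ * r W₁ y′ x′)))
          ≡⟨ ∑-cong X (λ y′ → ∑-cong X λ y → trans (eq₁ (r W₁ x y) (g y) (r W₂ y y′) (r W₁ y′ x′))
               (trans (cong (λ q → r W₁ x y * r W₁ y′ x′ * q) (r-mult W₂ y y′ (g-inv y y′))) (eq₂ (r W₁ x y) (g y′) (r W₂ y y′) (r W₁ y′ x′)))) ⟩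
        ∑ X (λ y′ → ∑ X (λ y → r W₁ y′ x′ * g y′ * (r W₁ x y * r W₂ y y′)))
          ≡⟨ ∑-cong X (λ y′ → ∑-*ˡ X (r W₁ y′ x′ * g y′) (λ y → r W₁ x y * r W₂ y y′)) ⟩
        ∑ X (λ y′ → r W₁ y′ x′ * g y′ * ∑ X (λ y → r W₁ x y * r W₂ y y′))
          ≡⟨ ∑-cong X (λ y′ → trans (ℚ.*-assoc (r W₁ y′ x′) (g y′) _) (trans (r-mult W₁ y′ x′ λ q →
               trans (cong (g y′ *_) (midpoint-sum sep x y′ λ v w₁ w₂ → trans (p v w₂) (sym (q v w₁)))) (ℚ.*-identityʳ (g y′)))
               (cong (_* g y′) (r-sym W₁ y′ x′)))) ⟩
        ∑ X (λ y′ → r W₁ x′ y′ * g y′) ∎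
        where
        open ≡-Reasoning
        eq₁ : ∀ a g b c → a * g * (b * c) ≡ a * c * (b * g)
        eq₁ = solve-∀ ℚ-ring
        eq₂ : ∀ a g b c → a * c * (b * g) ≡ c * g * (a * b)
        eq₂ = solve-∀ ℚ-ring

      N₁-inv : Inv W₂ (N W₁)
      N₁-inv x x′ p = trans (one x) (trans (S₁-inv (λ _ _ _ → refl) x x′ p) (sym (one x′)))
        where
        one : ∀ x → N W₁ x ≡ S₁ (λ _ → 1ℚ) x
        one x = ∑-cong X λ y → sym (ℚ.*-identityʳ _)

    A-Inv : ∀ {g} → Inv W₂ g → Inv W₂ (A W₁ g)
    A-Inv {g} g-inv x x′ p = trans (pull x) (trans
      (cong₂ _*_ (cong recip (N₁-inv x x′ p)) (S₁-inv g-inv x x′ p)) (sym (pull x′)))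
      where
      eq : ∀ a b c → a * b * c ≡ b * (a * c)
      eq = solve-∀ ℚ-ring
      pull : ∀ x → A W₁ g x ≡ recip (N W₁ x) * S₁ g x
      pull x = trans (∑-cong X λ y → eq (r W₁ x y) (recip (N W₁ x)) (g y)) (∑-*ˡ X (recip (N W₁ x)) _)

  module _ {W₁ W₂ W : Region n} (sep : Separated W₁ W₂) (union : ∀ v → W v ≡ W₁ v ∨ W₂ v) where
    private
      ⊑₁ : W₁ ⊑ W
      ⊑₁ v p = Bool.∨-conicalˡ (W₁ v) (W₂ v) (trans (sym (union v)) p)
      ⊑₂ : W₂ ⊑ W
      ⊑₂ v p = Bool.∨-conicalʳ (W₁ v) (W₂ v) (trans (sym (union v)) p)

    -- The left-hand side is already constant on the classes of `W`, since a move in `W` passes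
    -- through a midpoint. Averaging it over `W` changes nothing, and the tower property then
    -- removes the inner averages.
    A-union : ∀ f x → A W₁ (A W₂ f) x ≡ A W f x
    A-union f x = trans (sym (A-fix W AA-inv x)) (trans (A-tower ⊑₁ (A W₂ f) x) (A-tower ⊑₂ f x))
      where
      AA-inv : Inv W (A W₁ (A W₂ f))
      AA-inv x z p with midpoint sep x z (λ v w₁ w₂ → p v (trans (union v) (cong₂ _∨_ w₁ w₂)))
      ... | y , q₁ , q₂ = trans (A-inv W₁ (A W₂ f) x y q₁) (A-Inv sep (A-inv W₂ f) y z q₂)

  -- E W₁ f + E W₂ f - E W f is the squared norm of (1 - A₁)(1 - A₂) f.
  E-union : ∀ {W₁ W₂ W} → Separated W₁ W₂ → (∀ v → W v ≡ W₁ v ∨ W₂ v) → ∀ f → E W f ≤ E W₁ f + E W₂ f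
  E-union {W₁} {W₂} {W} sep union f = ≤-by ⟨ g , g ⟩ (0≤⟨f,f⟩ g) (sym (begin
    E W f + ⟨ g , g ⟩
      ≡⟨ cong (λ q → E W f + q) (trans (⟨⟩-cong {g} g-eq (λ _ → refl)) (trans (⟨⟩--ˡ h (A W₁ h) g) (cong (λ q → ⟨ h , g ⟩ - q) kill₁))) ⟩
    E W f + (⟨ h , g ⟩ - 0ℚ)
      ≡⟨ cong (λ q → E W f + (q - 0ℚ)) (trans (⟨⟩--ˡ f (A W₂ f) g) (cong (λ q → ⟨ f , g ⟩ - q) kill₂)) ⟩
    E W f + (⟨ f , g ⟩ - 0ℚ - 0ℚ)
      ≡⟨ cong (λ q → E W f + (q - 0ℚ - 0ℚ)) (trans (⟨⟩-cong {f} (λ _ → refl) g-expand)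
           (trans (⟨⟩--ʳ f _ _) (cong₂ _-_ (⟨⟩--ʳ f f (A W₂ f)) (⟨⟩--ʳ f (A W₁ f) (A W f))))) ⟩
    E W f + ((⟨ f , f ⟩ - ⟨ f , A W₂ f ⟩) - (⟨ f , A W₁ f ⟩ - ⟨ f , A W f ⟩) - 0ℚ - 0ℚ)
      ≡⟨ eq ⟨ f , f ⟩ ⟨ f , A W₁ f ⟩ ⟨ f , A W₂ f ⟩ ⟨ f , A W f ⟩ ⟩
    E W₁ f + E W₂ f ∎))
    where
    open ≡-Reasoning
    h g : State → ℚ
    h x = f x - A W₂ f x
    g x = h x - A W₁ h x
    g-eq : ∀ x → g x ≡ h x - A W₁ h x
    g-eq _ = refl
    g-expand : ∀ x → g x ≡ (f x - A W₂ f x) - (A W₁ f x - A W f x)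
    g-expand x = cong (λ q → h x - q) (trans (A-- W₁ f (A W₂ f) x) (cong (λ q → A W₁ f x - q) (A-union sep union f x)))
    zero-sum : ∀ u → (∀ x → u x ≡ 0ℚ) → ∀ e → ⟨ e , u ⟩ ≡ 0ℚ
    zero-sum u p e = ∑-zero X λ x _ → trans (cong (e x *_) (p x)) (ℚ.*-zeroʳ (e x))
    sub-self : ∀ a → a - a ≡ 0ℚ
    sub-self = ℚ.+-inverseʳ
    A₁g : ∀ x → A W₁ g x ≡ 0ℚ
    A₁g x = trans (A-- W₁ h (A W₁ h) x) (trans (cong (λ q → A W₁ h x - q) (A-idem W₁ h x)) (sub-self (A W₁ h x)))
    swap-union : ∀ v → W v ≡ W₂ v ∨ W₁ v
    swap-union v = trans (union v) (Bool.∨-comm (W₁ v) (W₂ v))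
    A₂h : ∀ x → A W₂ h x ≡ 0ℚ
    A₂h x = trans (A-- W₂ f (A W₂ f) x) (trans (cong (λ q → A W₂ f x - q) (A-idem W₂ f x)) (sub-self (A W₂ f x)))
    A₂g : ∀ x → A W₂ g x ≡ 0ℚ
    A₂g x = trans (A-- W₂ h (A W₁ h) x) (trans (cong₂ _-_ (A₂h x)
      (trans (A-union (Separated-sym sep) swap-union h x) (trans (sym (A-union sep union h x))
        (trans (A-cong W₁ x λ y _ → A₂h y) (A-const W₁ 0ℚ x))))) refl)
    kill₁ : ⟨ A W₁ h , g ⟩ ≡ 0ℚ
    kill₁ = trans (sym (A-adjoint W₁ h g)) (zero-sum _ A₁g h)
    kill₂ : ⟨ A W₂ f , g ⟩ ≡ 0ℚ
    kill₂ = trans (sym (A-adjoint W₂ f g)) (zero-sum _ A₂g f)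
    eq : ∀ a b c d → (a - d) + ((a - c) - (b - d) - 0ℚ - 0ℚ) ≡ (a - b) + (a - c)
    eq = solve-∀ ℚ-ring

  ~-resp : ∀ {W W′ x y} → (∀ v → W v ≡ W′ v) → x ~[ W ] y → x ~[ W′ ] y
  ~-resp h p v w = p v (trans (h v) w)

  E-resp : ∀ {W W′} → (∀ v → W v ≡ W′ v) → ∀ f → E W f ≡ E W′ f
  E-resp {W} {W′} h f = cong (λ q → ⟨ f , f ⟩ - q) (⟨⟩-cong {f} (λ _ → refl) λ x → ∑-cong X λ y → cong (_* f y)
    (cong₂ _*_ (rr x y) (cong recip (∑-cong X (rr x)))))
    where
    rr : ∀ x y → r W x y ≡ r W′ x y
    rr x y = 𝟙-⇔ (~? x W y) (~? x W′ y) (~-resp h) (~-resp (λ v → sym (h v)))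

  E-empty : ∀ {W} → (∀ v → W v ≡ false) → ∀ f → E W f ≡ 0ℚ
  E-empty {W} h f = trans (cong (λ q → ⟨ f , f ⟩ - q) (⟨⟩-cong {f} (λ _ → refl) (A-fix W λ x y p → cong f (st-inj x y λ v → p v (h v)))))
    (ℚ.+-inverseʳ ⟨ f , f ⟩)

-- One vertex

⟦_⟧ : Bool → ℚ
⟦ true ⟧  = 1ℚ
⟦ false ⟧ = 0ℚ

0≤⟦⟧ : ∀ b → 0ℚ ≤ ⟦ b ⟧
0≤⟦⟧ true  = 0≤1
0≤⟦⟧ false = ℚ.≤-refl

∑-ι : ∀ {A : Set} (f : A → ℕ) xs → ι (sum (map f xs)) ≡ ∑ xs (λ x → ι (f x))
∑-ι f []       = refl
∑-ι f (x ∷ xs) = trans (ι-+ (f x) (sum (map f xs))) (cong (λ q → ι (f x) + q) (∑-ι f xs))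

∑-𝟙≤1 : ∀ {xs : List ℕ} → Unique xs → ∀ a → ∑ xs (λ c → 𝟙 (a ℕ.≟ c)) ≤ 1ℚ
∑-𝟙≤1 []       a = 0≤1
∑-𝟙≤1 {x ∷ xs} (x∉ ∷ u) a with a ℕ.≟ x
... | yes refl = ℚ.≤-reflexive (cong (1ℚ +_) (∑-zero xs λ y y∈ → 𝟙-no (a ℕ.≟ y) λ { refl → All.lookup x∉ y∈ refl }))
... | no _     = subst (_≤ 1ℚ) (sym (ℚ.+-identityˡ _)) (∑-𝟙≤1 u a)

∑-1 : ∀ {A : Set} (xs : List A) → ∑ xs (λ _ → 1ℚ) ≡ ι (length xs)
∑-1 xs = trans (∑-const xs 1ℚ) (ℚ.*-identityʳ _)

module Vertices {n : ℕ} (G : Graph n) (L : ListAssignment n) (S : Enumeration G L) where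
  open Enumeration S
  open Averages G L S

  V : List (Fin n)
  V = allFin n

  len : Fin n → ℚ
  len v = ι (length (colours L v))

  adj-≢ : ∀ {u v} → adj G v u ≡ true → u ≢ v
  adj-≢ {u} e refl = true≢false e (irrefl G u)

  Free : State → Fin n → ℕ → Set
  Free x v c = ∀ u → adj G v u ≡ true → st x u ≢ c

  Free? : ∀ x v c → Dec (Free x v c)
  Free? x v c = Fin.all? λ u → (adj G v u Bool.≟ true) →-dec ¬? (st x u ℕ.≟ c)

  free : State → Fin n → ℕ → ℚ
  free x v c = 𝟙 (Free? x v c)

  col : State → Fin n → ℕ → ℚ
  col x v c = 𝟙 (st x v ℕ.≟ c)

  0≤col : ∀ x v c → 0ℚ ≤ col x v c
  0≤col x v c = 0≤𝟙 (st x v ℕ.≟ c)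

  -- j v x y c is the indicator that y is x recoloured to c at v.
  j : Fin n → State → State → ℕ → ℚ
  j v x y c = r ❴ v ❵ x y * col y v c

  0≤j : ∀ v x y c → 0ℚ ≤ j v x y c
  0≤j v x y c = 0≤* (0≤r ❴ v ❵ x y) (0≤col y v c)

  j-mult : ∀ v x y c {a b} → (x ~[ ❴ v ❵ ] y → st y v ≡ c → a ≡ b) → j v x y c * a ≡ j v x y c * b
  j-mult v x y c {a} {b} h with ~? x ❴ v ❵ y | st y v ℕ.≟ c
  ... | yes p | yes q = cong (1ℚ *_) (h p q)
  ... | yes p | no _  = trans (ℚ.*-zeroˡ a) (sym (ℚ.*-zeroˡ b))
  ... | no _  | d     = trans (cong (_* a) (ℚ.*-zeroˡ (𝟙 d))) (trans (ℚ.*-zeroˡ a) (trans (sym (ℚ.*-zeroˡ b)) (cong (_* b) (sym (ℚ.*-zeroˡ (𝟙 d))))))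

  j-zero : ∀ v x y c → ¬ (x ~[ ❴ v ❵ ] y × st y v ≡ c) → j v x y c ≡ 0ℚ
  j-zero v x y c h = trans (sym (ℚ.*-identityʳ _)) (trans (j-mult v x y c {1ℚ} {0ℚ} λ p q → ⊥-elim (h (p , q))) (ℚ.*-zeroʳ (j v x y c)))

  ~-free : ∀ {v x y} → x ~[ ❴ v ❵ ] y → Free x v (st y v)
  ~-free {v} {x} {y} p u e eq = st-edge y v u e (trans (sym eq) (p u (≢⇒❴❵ (adj-≢ e))))

  j-sum : ∀ v x c → c ∈ colours L v → ∑ X (λ y → j v x y c) ≡ free x v c
  j-sum v x c c∈ with Free? x v c
  ... | no ¬f = ∑-zero X λ y _ → j-zero v x y c λ { (p , refl) → ¬f (~-free p) }
  ... | yes f = trans (∑-unique _ y uniq) (cong₂ _*_ (𝟙-yes (~? x ❴ v ❵ y) x~y) (𝟙-yes (st y v ℕ.≟ c) y-v))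
    where
    σ : Fin n → ℕ
    σ u = if ❴ v ❵ u then c else st x u
    at : σ v ≡ c
    at rewrite dec-true (v Fin.≟ v) refl = refl
    off : ∀ {u} → u ≢ v → σ u ≡ st x u
    off {u} p rewrite dec-false (u Fin.≟ v) p = refl
    σ-∈ : ∀ u → σ u ∈ colours L u
    σ-∈ u = go (u Fin.≟ v)
      where
      go : Dec (u ≡ v) → σ u ∈ colours L u
      go (yes refl) = subst (_∈ colours L v) (sym at) c∈
      go (no p)     = subst (_∈ colours L u) (sym (off p)) (st-∈ x u)
    σ-edge : ∀ u w → adj G u w ≡ true → σ u ≢ σ w
    σ-edge u w e eq = go (u Fin.≟ v) (w Fin.≟ v)
      where
      go : Dec (u ≡ v) → Dec (w ≡ v) → ⊥
      go (yes refl) (yes refl) = true≢false e (irrefl G v)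
      go (yes refl) (no q)     = f w e (trans (sym (off q)) (trans (sym eq) at))
      go (no p)     (yes refl) = f u (trans (adj-sym G v u) e) (trans (sym (off p)) (trans eq at))
      go (no p)     (no q)     = st-edge x u w e (trans (sym (off p)) (trans eq (off q)))
    y = proj₁ (complete σ σ-∈ σ-edge)
    st-y = proj₂ (complete σ σ-∈ σ-edge)
    x~y : x ~[ ❴ v ❵ ] y
    x~y u w = sym (trans (st-y u) (off (❴❵-false w)))
    y-v : st y v ≡ c
    y-v = trans (st-y v) at
    uniq : ∀ y′ → y′ ≢ y → j v x y′ c ≡ 0ℚ
    uniq y′ ne = j-zero v x y′ c λ { (p , q) → ne (st-inj y′ y λ u → agree p q u) }
      where
      agree : x ~[ ❴ v ❵ ] y′ → st y′ v ≡ c → ∀ u → st y′ u ≡ st y u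
      agree p q u with u Fin.≟ v
      ... | yes refl = trans q (sym y-v)
      ... | no u≢v   = trans (sym (p u (≢⇒❴❵ u≢v))) (x~y u (≢⇒❴❵ u≢v))

  col-sum : ∀ x v → ∑ (colours L v) (λ c → col x v c) ≡ 1ℚ
  col-sum x v = trans (∑-single (distinct L v) (st-∈ x v) _ λ c ne → 𝟙-no (st x v ℕ.≟ c) (ne ∘ sym))
    (𝟙-yes (st x v ℕ.≟ st x v) refl)

  vertex-sum : ∀ v x (f : State → ℚ) →
    ∑ (colours L v) (λ c → ∑ X λ y → j v x y c * f y) ≡ ∑ X (λ y → r ❴ v ❵ x y * f y)
  vertex-sum v x f = trans (∑-swap (colours L v) X _) (∑-cong X λ y →
    trans (∑-cong (colours L v) λ c → eq (r ❴ v ❵ x y) (col y v c) (f y))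
    (trans (∑-*ˡ (colours L v) (r ❴ v ❵ x y * f y) (col y v)) (trans (cong (r ❴ v ❵ x y * f y *_) (col-sum y v)) (ℚ.*-identityʳ _))))
    where
    eq : ∀ a b c → a * b * c ≡ a * c * b
    eq = solve-∀ ℚ-ring

  N-free : ∀ v x → N ❴ v ❵ x ≡ ∑ (colours L v) (free x v)
  N-free v x = sym (trans (∑-cong-∈ (colours L v) λ c c∈ → trans (sym (j-sum v x c c∈)) (∑-cong X λ y → sym (ℚ.*-identityʳ _)))
    (trans (vertex-sum v x (λ _ → 1ℚ)) (∑-cong X λ y → ℚ.*-identityʳ _)))

  # : Region n → ℚ
  # B = ∑ V λ u → ⟦ B u ⟧

  Avoids : Region n → State → ℕ → Set
  Avoids B x c = ∀ u → B u ≡ true → st x u ≢ c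

  Avoids? : ∀ B x c → Dec (Avoids B x c)
  Avoids? B x c = Fin.all? λ u → (B u Bool.≟ true) →-dec ¬? (st x u ℕ.≟ c)

  -- Each vertex of `B` excludes at most one entry of the list, the entries being distinct.
  palette-bound : ∀ B x v → len v - # B ≤ ∑ (colours L v) (λ c → 𝟙 (Avoids? B x c))
  palette-bound B x v = ≤-by _ (≤⇒0≤- key) (eq (len v) (# B) _)
    where
    eq : ∀ a b c → c ≡ a - b + (b + c - a)
    eq = solve-∀ ℚ-ring
    pointwise : ∀ c → 1ℚ ≤ ∑ V (λ u → ⟦ B u ⟧ * col x u c) + 𝟙 (Avoids? B x c)
    pointwise c with Avoids? B x c
    ... | yes _ = ≤-by _ (0≤∑ V λ u → 0≤* (0≤⟦⟧ (B u)) (0≤col x u c)) (ℚ.+-comm (∑ V (λ u → ⟦ B u ⟧ * col x u c)) 1ℚ)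
    ... | no ¬a with Fin.any? (λ u → (B u Bool.≟ true) ×-dec (st x u ℕ.≟ c))
    ...   | no ¬e = ⊥-elim (¬a λ u b eq → ¬e (u , b , eq))
    ...   | yes (u , b , eq) = subst (1ℚ ≤_) (sym (ℚ.+-identityʳ _)) (ℚ.≤-trans
              (ℚ.≤-reflexive (sym (cong₂ _*_ (cong ⟦_⟧ b) (𝟙-yes (st x u ℕ.≟ c) eq))))
              (∑-≥ V (λ u → 0≤* (0≤⟦⟧ (B u)) (0≤col x u c)) (∈-allFin u)))
    key : len v ≤ # B + ∑ (colours L v) (λ c → 𝟙 (Avoids? B x c))
    key = ℚ.≤-trans (ℚ.≤-reflexive (sym (∑-1 (colours L v)))) (ℚ.≤-trans (∑-mono (colours L v) pointwise)
      (ℚ.≤-trans (ℚ.≤-reflexive (trans (∑-+ (colours L v) _ _) (cong (_+ ∑ (colours L v) (λ c → 𝟙 (Avoids? B x c))) (∑-swap (colours L v) V _))))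
      (ℚ.+-monoˡ-≤ _ (∑-mono V λ u → ℚ.≤-trans (ℚ.≤-reflexive (∑-*ˡ (colours L v) ⟦ B u ⟧ (col x u)))
        (ℚ.≤-trans (*-monoˡ (0≤⟦⟧ (B u)) (∑-𝟙≤1 (distinct L v) (st x u))) (ℚ.≤-reflexive (ℚ.*-identityʳ _)))))))

  deg-# : ∀ v → ι (deg G v) ≡ # (adj G v)
  deg-# v = trans (∑-ι (λ u → if adj G v u then 1 else 0) V) (∑-cong V λ u → lem (adj G v u))
    where
    lem : ∀ b → ι (if b then 1 else 0) ≡ ⟦ b ⟧
    lem true  = refl
    lem false = refl

  N≤len : ∀ v x → N ❴ v ❵ x ≤ len v
  N≤len v x = ℚ.≤-trans (ℚ.≤-reflexive (N-free v x)) (ℚ.≤-trans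
    (∑-mono (colours L v) λ c → 𝟙≤1 (Free? x v c)) (ℚ.≤-reflexive (∑-1 (colours L v))))

  N≥len-deg : ∀ v x → len v - # (adj G v) ≤ N ❴ v ❵ x
  N≥len-deg v x = ℚ.≤-trans (palette-bound (adj G v) x v) (ℚ.≤-reflexive (sym (N-free v x)))

  0<len : ∀ v → State → 0ℚ < len v
  0<len v x = ℚ.<-≤-trans (0<N ❴ v ❵ x) (N≤len v x)

  #adj≤n-1 : ∀ v → # (adj G v) + 1ℚ ≤ ι n
  #adj≤n-1 v = ℚ.≤-trans (ℚ.≤-reflexive (cong (# (adj G v) +_) (sym (trans
      (∑-single (Unique.allFin⁺ n) (∈-allFin v) (λ u → ⟦ ❴ v ❵ u ⟧) λ u ne → cong ⟦_⟧ (≢⇒❴❵ ne))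
      (cong ⟦_⟧ (dec-true (v Fin.≟ v) refl))))))
    (ℚ.≤-trans (ℚ.≤-reflexive (sym (∑-+ V _ _))) (ℚ.≤-trans (∑-mono V pointwise)
    (ℚ.≤-reflexive (trans (∑-1 V) (cong ι (length-allFin n))))))
    where
    length-allFin : ∀ n → length (allFin n) ≡ n
    length-allFin n = length-tabulate {n = n} id
    pointwise : ∀ u → ⟦ adj G v u ⟧ + ⟦ ❴ v ❵ u ⟧ ≤ 1ℚ
    pointwise u with u Fin.≟ v
    ... | yes refl rewrite irrefl G v = ℚ.≤-refl
    ... | no _ with adj G v u
    ...   | true = ℚ.≤-refl
    ...   | false = 0≤1

  0≤# : ∀ B → 0ℚ ≤ # B
  0≤# B = 0≤∑ V λ u → 0≤⟦⟧ (B u)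

  module _ (deg+2 : IsDegPlus2 G L) where
    deg+2≤len : ∀ v → # (adj G v) + 2ℚ ≤ len v
    deg+2≤len v = subst (_≤ len v) (trans (ι-+ (deg G v) 2) (cong (_+ 2ℚ) (deg-# v))) (ι-mono (deg+2 v))

    -- Besides any given colour another one stays free. This makes `misses` at least 1 and hence all
    -- odds at most 1.
    2≤N : ∀ v x → 2ℚ ≤ N ❴ v ❵ x
    2≤N v x = ℚ.≤-trans (≤-by _ (≤⇒0≤- (deg+2≤len v)) (eq (len v) (# (adj G v)))) (N≥len-deg v x)
      where
      eq : ∀ l d → l - d ≡ 2ℚ + (l - (d + 2ℚ))
      eq = solve-∀ ℚ-ring

    -- With d the degree, the fraction of free colours is at least (len - d) / len. This increases
    -- with len, so it is at least its value 2 / (d + 2) at len = d + 2, and d + 2 is at most n + 1.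
    -- The bound holds for lists of any length.
    2len≤ : ∀ v x → 2ℚ * len v ≤ (ι n + 1ℚ) * N ❴ v ❵ x
    2len≤ v x = ℚ.≤-trans
      (≤-by _ (0≤* (0≤# (adj G v)) (≤⇒0≤- (deg+2≤len v))) (eq (len v) (# (adj G v))))
      (*-mono (0≤+ (0≤# (adj G v)) 0≤2) (≤-by _ (≤⇒0≤- (#adj≤n-1 v)) (eq′ (ι n) (# (adj G v))))
        (ℚ.≤-trans 0≤2 (≤-by _ (≤⇒0≤- (deg+2≤len v)) (eq″ (len v) (# (adj G v))))) (N≥len-deg v x))
      where
      eq : ∀ l d → (d + 2ℚ) * (l - d) ≡ 2ℚ * l + d * (l - (d + 2ℚ))
      eq = solve-∀ ℚ-ring
      eq′ : ∀ n d → n + 1ℚ ≡ d + 2ℚ + (n - (d + 1ℚ))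
      eq′ = solve-∀ ℚ-ring
      eq″ : ∀ l d → l - d ≡ 2ℚ + (l - (d + 2ℚ))
      eq″ = solve-∀ ℚ-ring

  ⊆-∪ : ∀ {W : Region n} {s} → W ⊑ (λ v → W v ∨ ❴ s ❵ v)
  ⊆-∪ {W} {s} v p = Bool.∨-conicalˡ (W v) (❴ s ❵ v) p

  -- States in one class of W⁺ are joined through the states that give s a colour h available from both;
  -- avail h x is the probability that s may take the colour h after W is resampled.
  module Hub (W : Region n) (s : Fin n) (W-s : W s ≡ false) where
    W⁺ : Region n
    W⁺ v = W v ∨ ❴ s ❵ v

    Outer : Region n
    Outer v = adj G s v ∧ not (W v)

    outer : State → ℕ → ℚ
    outer x h = 𝟙 (Avoids? Outer x h)

    outer-inv : ∀ h → Inv W⁺ (λ x → outer x h)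
    outer-inv h x y p = 𝟙-⇔ (Avoids? Outer x h) (Avoids? Outer y h)
      (λ a u b eq → a u b (trans (p u (off u b)) eq)) (λ a u b eq → a u b (trans (sym (p u (off u b))) eq))
      where
      off : ∀ u → Outer u ≡ true → W⁺ u ≡ false
      off u b with adj G s u in e | W u
      ... | true | false = ≢⇒❴❵ (adj-≢ e)

    -- Counts the colours not blocked by `Outer`, the neighbours of `s` that are frozen on a class
    -- of `W⁺`. Being constant on classes, it normalises both ends of a pair of states alike.
    palette : State → ℚ
    palette x = ∑ (colours L s) (outer x)

    palette-inv : Inv W⁺ palette
    palette-inv x y p = ∑-cong (colours L s) λ h → outer-inv h x y p

    N≤palette : ∀ x → N ❴ s ❵ x ≤ palette x
    N≤palette x = ℚ.≤-trans (ℚ.≤-reflexive (N-free s x)) (∑-mono (colours L s) pointwise)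
      where
      pointwise : ∀ h → free x s h ≤ outer x h
      pointwise h with Free? x s h
      ... | no _  = 0≤𝟙 (Avoids? Outer x h)
      ... | yes f = ℚ.≤-reflexive (sym (𝟙-yes (Avoids? Outer x h) λ u b → f u (Bool.∧-conicalˡ (adj G s u) (not (W u)) b)))

    0<palette : ∀ x → 0ℚ < palette x
    0<palette x = ℚ.<-≤-trans (0<N ❴ s ❵ x) (N≤palette x)

    avail : ℕ → State → ℚ
    avail h = A W (λ x → free x s h)

    0≤avail : ∀ h x → 0ℚ ≤ avail h x
    0≤avail h x = 0≤A W x λ y → 0≤𝟙 (Free? y s h)

    avail≤1 : ∀ h x → avail h x ≤ 1ℚ
    avail≤1 h x = subst (avail h x ≤_) (A-const W 1ℚ x) (A-mono W x λ y _ → 𝟙≤1 (Free? y s h))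

    module _ {g : State → ℚ} (g-inv : Inv W g) where
      private
        jump : ℕ → State → ℚ
        jump h x = ∑ X λ y → j s x y h * sq (g x - g y)

        0≤jump : ∀ h x → 0ℚ ≤ jump h x
        0≤jump h x = 0≤∑ X λ y → 0≤* (0≤j s x y h) (0≤sq (g x - g y))

        -- `g` ignores the colours in `W`, so inside a class of `W⁺` it is a function of the colour
        -- of `s`: every jump to `h` ends at the value `g y₀`, and only the probability of being
        -- able to jump remains.
        jump-via : ∀ {h} → h ∈ colours L s → ∀ x y₀ → y₀ ~[ W⁺ ] x → st y₀ s ≡ h →
                   A W (jump h) x ≡ avail h x * sq (g x - g y₀)
        jump-via {h} h∈ x y₀ p q = trans
          (A-cong W x λ z x~z → trans (∑-cong X λ z′ → j-mult s z z′ h λ a b →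
              cong₂ (λ α β → sq (α - β)) (sym (g-inv x z x~z)) (g-inv z′ y₀ (agree x~z a b)))
            (trans (∑-*ʳ X (sq (g x - g y₀)) _) (trans (cong (_* sq (g x - g y₀)) (j-sum s z h h∈)) (ℚ.*-comm (free z s h) (sq (g x - g y₀))))))
          (trans (A-*ˡ W (sq (g x - g y₀)) _ x) (ℚ.*-comm (sq (g x - g y₀)) (avail h x)))
          where
          agree : ∀ {z z′} → x ~[ W ] z → z ~[ ❴ s ❵ ] z′ → st z′ s ≡ h → z′ ~[ W ] y₀
          agree a b c v w with v Fin.≟ s
          ... | yes refl = trans c (sym q)
          ... | no v≢s = trans (sym (b v (≢⇒❴❵ v≢s))) (trans (sym (a v w))
                (sym (p v (cong₂ _∨_ w (≢⇒❴❵ v≢s)))))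

        route : ∀ {h} → h ∈ colours L s → ∀ x y → x ~[ W⁺ ] y →
                avail h x * avail h y * sq (g x - g y) ≤ 2ℚ * A W (jump h) x + 2ℚ * A W (jump h) y
        route {h} h∈ x y x~y with Fin.any? (λ z → ~? z W⁺ x ×-dec (st z s ℕ.≟ h))
        ... | yes (z , p , q) = ℚ.≤-trans
              (lem (0≤avail h x) (avail≤1 h x) (0≤avail h y) (avail≤1 h y) (g x) (g y) (g z))
              (ℚ.≤-reflexive (sym (cong₂ (λ α β → 2ℚ * α + 2ℚ * β) (jump-via h∈ x z p q) (jump-via h∈ y z (~-trans p x~y) q))))
          where
          lem : ∀ {a b} → 0ℚ ≤ a → a ≤ 1ℚ → 0ℚ ≤ b → b ≤ 1ℚ → ∀ u v w →
                a * b * sq (u - v) ≤ 2ℚ * (a * sq (u - w)) + 2ℚ * (b * sq (v - w))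
          lem {a} {b} 0≤a a≤1 0≤b b≤1 u v w = ≤-by _
            (0≤+ (0≤+ (0≤* (0≤* 0≤a 0≤b) (0≤sq (u + v - 2ℚ * w)))
              (0≤* (0≤* 0≤2 (0≤* 0≤a (≤⇒0≤- b≤1))) (0≤sq (u - w)))) (0≤* (0≤* 0≤2 (0≤* 0≤b (≤⇒0≤- a≤1))) (0≤sq (v - w))))
            (eq a b u v w)
            where
            eq : ∀ a b u v w → 2ℚ * (a * ((u - w) * (u - w))) + 2ℚ * (b * ((v - w) * (v - w))) ≡
              a * b * ((u - v) * (u - v)) + (a * b * ((u + v - 2ℚ * w) * (u + v - 2ℚ * w))
                + 2ℚ * (a * (1ℚ - b)) * ((u - w) * (u - w)) + 2ℚ * (b * (1ℚ - a)) * ((v - w) * (v - w)))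
            eq = solve-∀ ℚ-ring
        -- No state of the class gives `s` the colour `h`, so the availability is 0.
        ... | no ¬e = ℚ.≤-trans (ℚ.≤-reflexive (trans (cong (λ q → q * avail h y * sq (g x - g y)) vanish) (eq (avail h y) (sq (g x - g y)))))
              (0≤+ (0≤* 0≤2 (0≤A W x (0≤jump h))) (0≤* 0≤2 (0≤A W y (0≤jump h))))
          where
          eq : ∀ a b → 0ℚ * a * b ≡ 0ℚ
          eq = solve-∀ ℚ-ring
          vanish : avail h x ≡ 0ℚ
          vanish = trans (A-cong W x λ z x~z → trans (sym (j-sum s z h h∈)) (∑-zero X λ z′ _ → j-zero s z z′ h λ { (p , q) →
            ¬e (z′ , (λ v w → sym (trans (x~z v (Bool.∨-conicalˡ (W v) (❴ s ❵ v) w)) (p v (Bool.∨-conicalʳ (W v) (❴ s ❵ v) w)))) , q) })) (A-const W 0ℚ x)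

        local : State → ℚ
        local x = ∑ X λ y → r ❴ s ❵ x y * sq (g x - g y)

        ∑-jump : ∀ x → ∑ (colours L s) (λ h → A W (jump h) x) ≡ A W local x
        ∑-jump x = trans (sym (A-∑ W (colours L s) jump x)) (A-cong W x λ z _ → vertex-sum s z (λ y → sq (g z - g y)))

      module _ {δ : ℚ} (0<δ : 0ℚ < δ)
               (common : ∀ x y → x ~[ W⁺ ] y → δ * palette x ≤ ∑ (colours L s) (λ h → avail h x * avail h y)) where
        private
          w : State → ℚ
          w x = recip (δ * palette x)

          0<δp : ∀ x → 0ℚ < δ * palette x
          0<δp x = 0<* 0<δ (0<palette x)

          w-inv : Inv W⁺ w
          w-inv x y p = cong (λ q → recip (δ * q)) (palette-inv x y p)

          Q : State → ℚ
          Q = A W local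

          pair : ∀ x y → x ~[ W⁺ ] y → sq (g x - g y) ≤ w x * (2ℚ * Q x + 2ℚ * Q y)
          pair x y p = *-cancelˡ (0<δp x) (ℚ.≤-trans bound (ℚ.≤-reflexive (sym
            (trans (sym (ℚ.*-assoc (δ * palette x) (w x) _)) (trans (cong (_* (2ℚ * Q x + 2ℚ * Q y)) (*-recip (0<δp x))) (ℚ.*-identityˡ (2ℚ * Q x + 2ℚ * Q y)))))))
            where
            bound : δ * palette x * sq (g x - g y) ≤ 2ℚ * Q x + 2ℚ * Q y
            bound = ℚ.≤-trans (*-monoʳ (0≤sq (g x - g y)) (common x y p)) (ℚ.≤-trans (ℚ.≤-reflexive (sym (∑-*ʳ (colours L s) (sq (g x - g y)) _)))
              (ℚ.≤-trans (∑-mono-∈ (colours L s) λ h h∈ → route h∈ x y p) (ℚ.≤-reflexive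
              (trans (∑-+ (colours L s) _ _) (cong₂ _+_ (trans (∑-*ˡ (colours L s) 2ℚ _) (cong (2ℚ *_) (∑-jump x)))
                (trans (∑-*ˡ (colours L s) 2ℚ _) (cong (2ℚ *_) (∑-jump y))))))))

        -- The bound `pair` is averaged over `y`. As `w` is constant on classes, the two ends
        -- contribute equally and `w` commutes with `A W`. Since `palette` is at least the number of
        -- free colours, dividing by it turns the count `local` into at most a kernel average, and
        -- no list length is left.
        hub-inequality : E W⁺ g ≤ 2ℚ * 2ℚ * recip δ * E ❴ s ❵ g
        hub-inequality = *-cancelˡ 0<2 (begin
          2ℚ * E W⁺ g
            ≡⟨ E-pairs W⁺ g ⟨
          ∑ X (λ x → ∑ X λ y → k W⁺ x y * sq (g x - g y))
            ≤⟨ ∑-mono X (λ x → A-mono W⁺ x λ y p → pair x y p) ⟩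
          ∑ X (λ x → A W⁺ (λ y → w x * (2ℚ * Q x + 2ℚ * Q y)) x)
            ≡⟨ ∑-cong X (λ x → trans (A-cong W⁺ x λ y p → trans (eq₁ (w x) (Q x) (Q y)) (cong (λ q → w x * (2ℚ * Q x) + q * (2ℚ * Q y)) (w-inv x y p)))
                 (trans (A-+ W⁺ _ _ x) (cong (_+ A W⁺ (λ y → w y * (2ℚ * Q y)) x) (A-const W⁺ (w x * (2ℚ * Q x)) x)))) ⟩
          ∑ X (λ x → w x * (2ℚ * Q x) + A W⁺ (λ y → w y * (2ℚ * Q y)) x)
            ≡⟨ trans (∑-+ X _ _) (cong (∑ X (λ x → w x * (2ℚ * Q x)) +_) (∑-A W⁺ (λ y → w y * (2ℚ * Q y)))) ⟩
          ∑ X (λ x → w x * (2ℚ * Q x)) + ∑ X (λ x → w x * (2ℚ * Q x))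
            ≡⟨ cong (λ q → q + q) (trans (∑-cong X λ x → eq₂ (w x) (Q x)) (∑-*ˡ X 2ℚ _)) ⟩
          2ℚ * ⟨ w , Q ⟩ + 2ℚ * ⟨ w , Q ⟩
            ≡⟨ cong (λ q → 2ℚ * q + 2ℚ * q) (trans (A-adjoint W w local) (⟨⟩-cong {g = local} (A-fix W λ x y p → w-inv x y (~-weaken (⊆-∪ {W} {s}) p)) (λ _ → refl))) ⟩
          2ℚ * ⟨ w , local ⟩ + 2ℚ * ⟨ w , local ⟩
            ≤⟨ (let h = *-monoˡ 0≤2 weaken in ℚ.+-mono-≤ h h) ⟩
          2ℚ * (recip δ * (2ℚ * E ❴ s ❵ g)) + 2ℚ * (recip δ * (2ℚ * E ❴ s ❵ g))
            ≡⟨ eq₃ (recip δ) (E ❴ s ❵ g) ⟩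
          2ℚ * (2ℚ * 2ℚ * recip δ * E ❴ s ❵ g) ∎)
          where
          open ℚ.≤-Reasoning
          eq₁ : ∀ w a b → w * (2ℚ * a + 2ℚ * b) ≡ w * (2ℚ * a) + w * (2ℚ * b)
          eq₁ = solve-∀ ℚ-ring
          eq₂ : ∀ w a → w * (2ℚ * a) ≡ 2ℚ * (w * a)
          eq₂ = solve-∀ ℚ-ring
          eq₃ : ∀ d e → 2ℚ * (d * (2ℚ * e)) + 2ℚ * (d * (2ℚ * e)) ≡ 2ℚ * (2ℚ * 2ℚ * d * e)
          eq₃ = solve-∀ ℚ-ring
          eq₄ : ∀ a b c d → a * b * (c * d) ≡ a * (c * b * d)
          eq₄ = solve-∀ ℚ-ring
          weaken : ⟨ w , local ⟩ ≤ recip δ * (2ℚ * E ❴ s ❵ g)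
          weaken = ℚ.≤-trans (∑-mono X λ x → ℚ.≤-trans
              (*-monoʳ (0≤∑ X λ y → 0≤* (0≤r ❴ s ❵ x y) (0≤sq (g x - g y)))
                (ℚ.≤-trans (ℚ.≤-reflexive (recip-* 0<δ (0<palette x))) (*-monoˡ (0≤recip 0<δ) (recip-anti (0<N ❴ s ❵ x) (N≤palette x)))))
              (ℚ.≤-reflexive (trans (sym (∑-*ˡ X (recip δ * recip (N ❴ s ❵ x)) _)) (trans (∑-cong X λ y → eq₄ (recip δ) (recip (N ❴ s ❵ x)) (r ❴ s ❵ x y) (sq (g x - g y))) (∑-*ˡ X (recip δ) _)))))
            (ℚ.≤-reflexive (trans (∑-*ˡ X (recip δ) _) (cong (recip δ *_) (E-pairs ❴ s ❵ g))))

    -- Condition on the colour of s last: E W⁺ f = E W f + E W⁺ (A W f).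
    E-add : ∀ {K} → 0ℚ ≤ K → (∀ g → Inv W g → E W⁺ g ≤ K * E ❴ s ❵ g) →
            ∀ f → E W⁺ f ≤ (2ℚ * K + 1ℚ) * E W f + 2ℚ * K * E ❴ s ❵ f
    E-add {K} 0≤K hub f = begin
      E W⁺ f                                       ≡⟨ split ⟩
      E W f + E W⁺ g                               ≤⟨ ℚ.+-monoʳ-≤ (E W f) (hub g (A-inv W f)) ⟩
      E W f + K * E ❴ s ❵ g                         ≤⟨ ℚ.+-monoʳ-≤ (E W f) (*-monoˡ 0≤K (ℚ.≤-trans (E-subadd ❴ s ❵ f g) (ℚ.+-monoʳ-≤ (2ℚ * E ❴ s ❵ f) (*-monoˡ 0≤2 residual)))) ⟩
      E W f + K * (2ℚ * E ❴ s ❵ f + 2ℚ * E W f)     ≡⟨ eq K (E W f) (E ❴ s ❵ f) ⟩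
      (2ℚ * K + 1ℚ) * E W f + 2ℚ * K * E ❴ s ❵ f    ∎
      where
      open ℚ.≤-Reasoning
      g = A W f
      residual : E ❴ s ❵ (λ x → f x - g x) ≤ E W f
      residual = ℚ.≤-trans (E≤norm ❴ s ❵ (λ x → f x - g x)) (ℚ.≤-reflexive (sym (E-residual W f)))
      split : E W⁺ f ≡ E W f + E W⁺ g
      split = trans (eq′ ⟨ f , f ⟩ ⟨ f , A W⁺ f ⟩ ⟨ f , A W f ⟩) (cong (λ q → E W f + q) (cong₂ _-_ (⟨f,Af⟩ W f) (sym
        (trans (⟨⟩-cong {g} (λ _ → refl) (A-tower ⊆-∪ f)) (trans (sym (A-adjoint W f (A W⁺ f)))
          (⟨⟩-cong {f} (λ _ → refl) (A-fix W λ x y p → A-inv W⁺ f x y (~-weaken (⊆-∪ {W} {s}) p))))))))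
        where
        eq′ : ∀ a b c → a - b ≡ (a - c) + (c - b)
        eq′ = solve-∀ ℚ-ring
      eq : ∀ k e d → e + k * (2ℚ * d + 2ℚ * e) ≡ (2ℚ * k + 1ℚ) * e + 2ℚ * k * d
      eq = solve-∀ ℚ-ring

-- Hard-core expansion of a colour class

-- Lagrange's identity, one term at a time: adding `x` increases the gap by `w x` times the sum of
-- `w y` times the square of `a x - a y`.
cauchy-schwarz : ∀ {A : Set} (xs : List A) (w a : A → ℚ) → (∀ x → 0ℚ ≤ w x) →
  ∑ xs (λ x → w x * a x) * ∑ xs (λ x → w x * a x) ≤ ∑ xs w * ∑ xs (λ x → w x * (a x * a x))
cauchy-schwarz []       w a 0≤w = ℚ.≤-refl
cauchy-schwarz (x ∷ xs) w a 0≤w = ≤-by _ (0≤+ (≤⇒0≤- (cauchy-schwarz xs w a 0≤w)) cross)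
  (eq (w x) (a x) (∑ xs w) (∑ xs (λ y → w y * a y)) (∑ xs (λ y → w y * (a y * a y))))
  where
  W = ∑ xs w
  T = ∑ xs (λ y → w y * a y)
  Q = ∑ xs (λ y → w y * (a y * a y))
  spread : ∑ xs (λ y → w y * ((a x - a y) * (a x - a y))) ≡ W * (a x * a x) - 2ℚ * a x * T + Q
  spread = trans (∑-cong xs λ y → eq₁ (w y) (a x) (a y)) (trans (∑-+ xs _ _) (cong (_+ Q)
    (trans (∑-- xs _ _) (cong₂ _-_ (∑-*ʳ xs (a x * a x) w) (∑-*ˡ xs (2ℚ * a x) _)))))
    where
    eq₁ : ∀ w a b → w * ((a - b) * (a - b)) ≡ w * (a * a) - 2ℚ * a * (w * b) + w * (b * b)
    eq₁ = solve-∀ ℚ-ring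
  cross : 0ℚ ≤ w x * (W * (a x * a x) - 2ℚ * a x * T + Q)
  cross = 0≤* (0≤w x) (subst (0ℚ ≤_) spread (0≤∑ xs λ y → 0≤* (0≤w y) (0≤sq (a x - a y))))
  eq : ∀ w a W T Q → (w + W) * (w * (a * a) + Q) ≡
       (w * a + T) * (w * a + T) + ((W * Q - T * T) + w * (W * (a * a) - 2ℚ * a * T + Q))
  eq = solve-∀ ℚ-ring

∏-single : ∀ {A : Set} {xs : List A} → Unique xs → ∀ {a} → a ∈ xs → (f : A → ℚ) →
           (∀ x → x ≢ a → f x ≡ 1ℚ) → ∏ xs f ≡ f a
∏-single {xs = x ∷ xs} (x∉ ∷ u) (here refl) f h =
  trans (cong (f x *_) (trans (∏-cong-∈ xs λ y y∈ → h y λ { refl → All.lookup x∉ y∈ refl }) (trans (∏-const xs 1ℚ) (1^^ (length xs)))))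
    (ℚ.*-identityʳ (f x))
∏-single {xs = x ∷ xs} (x∉ ∷ u) {a} (there a∈) f h =
  trans (cong₂ _*_ (h x λ { refl → All.lookup x∉ a∈ refl }) (∏-single u a∈ f h)) (ℚ.*-identityˡ (f a))

-- A converse of Bernoulli's inequality. In each step the quadratic term is `x` times a quantity at
-- most 1, and the doubled slope pays for it.
power-linear : ∀ {x} N → 0ℚ ≤ x → 2ℚ * ι N * x ≤ 1ℚ → (1ℚ + x) ^^ N ≤ 1ℚ + 2ℚ * ι N * x
power-linear {x} zero p q = ℚ.≤-reflexive (sym (eq x))
  where
  eq : ∀ x → 1ℚ + 2ℚ * 0ℚ * x ≡ 1ℚ
  eq = solve-∀ ℚ-ring
power-linear {x} (suc N) p q = ℚ.≤-trans (*-monoˡ (0≤+ 0≤1 p) (power-linear N p q′))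
  (≤-by _ (0≤* p (≤⇒0≤- q′)) (eq x (ι N)))
  where
  q′ : 2ℚ * ι N * x ≤ 1ℚ
  q′ = ℚ.≤-trans (≤-by _ (0≤* 0≤2 p) (eq′ x (ι N))) q
    where
    eq′ : ∀ x n → 2ℚ * (1ℚ + n) * x ≡ 2ℚ * n * x + 2ℚ * x
    eq′ = solve-∀ ℚ-ring
  eq : ∀ x n → 1ℚ + 2ℚ * (1ℚ + n) * x ≡ (1ℚ + x) * (1ℚ + 2ℚ * n * x) + x * (1ℚ - 2ℚ * n * x)
  eq = solve-∀ ℚ-ring

module Resampling {n : ℕ} (G : Graph n) (L : ListAssignment n) (S : Enumeration G L) (deg+2 : IsDegPlus2 G L) (h : ℕ) where
  open Enumeration S
  open Averages G L S
  open Vertices G L S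

  hit miss : State → Fin n → ℚ
  hit x v = col x v h
  miss x v = 1ℚ - col x v h

  0≤miss : ∀ x v → 0ℚ ≤ miss x v
  0≤miss x v = ≤⇒0≤- (𝟙≤1 (st x v ℕ.≟ h))

  local-sum : ∀ v x (φ : ℕ → ℚ) → ∑ X (λ y → r ❴ v ❵ x y * φ (st y v)) ≡ ∑ (colours L v) (λ c → free x v c * φ c)
  local-sum v x φ = trans (sym (vertex-sum v x (λ y → φ (st y v)))) (∑-cong-∈ (colours L v) λ c c∈ →
    trans (∑-cong X λ y → j-mult v x y c λ _ q → cong φ q) (trans (∑-*ʳ X (φ c) _) (cong (_* φ c) (j-sum v x c c∈))))

  hits misses : Fin n → State → ℚ
  hits v x = ∑ X λ y → j v x y h
  misses v x = ∑ X λ y → r ❴ v ❵ x y * miss y v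

  hits-local : ∀ v x → hits v x ≡ ∑ (colours L v) (λ c → free x v c * 𝟙 (c ℕ.≟ h))
  hits-local v x = local-sum v x (λ c → 𝟙 (c ℕ.≟ h))

  misses-local : ∀ v x → misses v x ≡ ∑ (colours L v) (λ c → free x v c * (1ℚ - 𝟙 (c ℕ.≟ h)))
  misses-local v x = local-sum v x (λ c → 1ℚ - 𝟙 (c ℕ.≟ h))

  0≤hits : ∀ v x → 0ℚ ≤ hits v x
  0≤hits v x = 0≤∑ X λ y → 0≤j v x y h

  hits≤1 : ∀ v x → hits v x ≤ 1ℚ
  hits≤1 v x = ℚ.≤-trans (ℚ.≤-reflexive (hits-local v x)) (ℚ.≤-trans
    (∑-mono (colours L v) λ c → ℚ.≤-trans (*-monoʳ (0≤𝟙 (c ℕ.≟ h)) (𝟙≤1 (Free? x v c)))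
      (ℚ.≤-reflexive (trans (ℚ.*-identityˡ _) (𝟙-⇔ (c ℕ.≟ h) (h ℕ.≟ c) sym sym)))) (∑-𝟙≤1 (distinct L v) h))

  misses-eq : ∀ v x → misses v x ≡ N ❴ v ❵ x - hits v x
  misses-eq v x = trans (∑-cong X λ y → eq (r ❴ v ❵ x y) (col y v h)) (∑-- X _ _)
    where
    eq : ∀ a b → a * (1ℚ - b) ≡ a - a * b
    eq = solve-∀ ℚ-ring

  1≤misses : ∀ v x → 1ℚ ≤ misses v x
  1≤misses v x = subst (1ℚ ≤_) (sym (misses-eq v x)) (≤-by _ (0≤+ (≤⇒0≤- (2≤N deg+2 v x)) (≤⇒0≤- (hits≤1 v x))) (eq (N ❴ v ❵ x) (hits v x)))
    where
    eq : ∀ a b → a - b ≡ 1ℚ + ((a - 2ℚ) + (1ℚ - b))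
    eq = solve-∀ ℚ-ring

  0<misses : ∀ v x → 0ℚ < misses v x
  0<misses v x = ℚ.<-≤-trans 0<1 (1≤misses v x)

  misses-inv : ∀ v → Inv ❴ v ❵ (misses v)
  misses-inv v x y p = ∑-cong X λ z → cong (_* miss z v) (r-shift ❴ v ❵ z p)

  -- The odds of `h` against the other colours in the law of `v` given all other vertices: the
  -- fugacity of `v` in the hard-core model.
  odds : Fin n → State → ℚ
  odds v x = recip (misses v x) * hits v x

  0≤odds : ∀ v x → 0ℚ ≤ odds v x
  0≤odds v x = 0≤* (0≤recip (0<misses v x)) (0≤hits v x)

  odds≤1 : ∀ v x → odds v x ≤ 1ℚ
  odds≤1 v x = ℚ.≤-trans (*-monoˡ (0≤recip (0<misses v x)) (ℚ.≤-trans (hits≤1 v x) (1≤misses v x)))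
    (ℚ.≤-reflexive (trans (ℚ.*-comm (recip (misses v x)) (misses v x)) (*-recip (0<misses v x))))

  odds-local : ∀ {u v x y} → v ≢ u → adj G v u ≡ false → x ~[ ❴ u ❵ ] y → odds v x ≡ odds v y
  odds-local {u} {v} {x} {y} v≢u na p = cong₂ (λ a b → recip a * b)
    (trans (misses-local v x) (trans (∑-cong (colours L v) λ c → cong (_* (1ℚ - 𝟙 (c ℕ.≟ h))) (ff c)) (sym (misses-local v y))))
    (trans (hits-local v x) (trans (∑-cong (colours L v) λ c → cong (_* 𝟙 (c ℕ.≟ h)) (ff c)) (sym (hits-local v y))))
    where
    off : ∀ w → adj G v w ≡ true → st x w ≡ st y w
    off w e = p w (≢⇒❴❵ {s = u} {w} λ { refl → true≢false e na })
    ff : ∀ c → free x v c ≡ free y v c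
    ff c = 𝟙-⇔ (Free? x v c) (Free? y v c) (λ f w e eq → f w e (trans (off w e) eq)) (λ f w e eq → f w e (trans (sym (off w e)) eq))

  odds-blocked : ∀ {u v y} → adj G v u ≡ true → st y u ≡ h → odds v y ≡ 0ℚ
  odds-blocked {u} {v} {y} e eq = trans (cong (recip (misses v y) *_) (trans (hits-local v y) (∑-zero (colours L v) λ c _ → vanish c))) (ℚ.*-zeroʳ (recip (misses v y)))
    where
    vanish : ∀ c → free y v c * 𝟙 (c ℕ.≟ h) ≡ 0ℚ
    vanish c with c ℕ.≟ h
    ... | no _ = ℚ.*-zeroʳ (free y v c)
    ... | yes refl = trans (ℚ.*-identityʳ (free y v c)) (𝟙-no (Free? y v c) λ f → f u e eq)

  j-mono : ∀ v x y {a b} → (x ~[ ❴ v ❵ ] y → st y v ≡ h → a ≤ b) → j v x y h * a ≤ j v x y h * b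
  j-mono v x y {a} {b} f with ~? x ❴ v ❵ y | st y v ℕ.≟ h
  ... | yes p | yes q = *-monoˡ 0≤1 (f p q)
  ... | yes p | no _  = ℚ.≤-reflexive (trans (ℚ.*-zeroˡ a) (sym (ℚ.*-zeroˡ b)))
  ... | no _  | d     = ℚ.≤-reflexive (trans (cong (_* a) (ℚ.*-zeroˡ (𝟙 d))) (trans (ℚ.*-zeroˡ a) (trans (sym (ℚ.*-zeroˡ b)) (cong (_* b) (sym (ℚ.*-zeroˡ (𝟙 d)))))))

  -- Amounts to `odds v x` times `f` at the state with `v` recoloured to `h`, and to 0 if there is
  -- no such state.
  shift : Fin n → (State → ℚ) → State → ℚ
  shift v f x = recip (misses v x) * ∑ X (λ y → j v x y h * f y)

  0≤shift : ∀ v {f} x → (∀ y → 0ℚ ≤ f y) → 0ℚ ≤ shift v f x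
  0≤shift v x p = 0≤* (0≤recip (0<misses v x)) (0≤∑ X λ y → 0≤* (0≤j v x y h) (p y))

  shift-≤ : ∀ v f x a → (∀ y → x ~[ ❴ v ❵ ] y → st y v ≡ h → f y ≤ a) → shift v f x ≤ odds v x * a
  shift-≤ v f x a p = ℚ.≤-trans (*-monoˡ (0≤recip (0<misses v x)) (ℚ.≤-trans (∑-mono X λ y → j-mono v x y (p y))
    (ℚ.≤-reflexive (∑-*ʳ X a _)))) (ℚ.≤-reflexive (sym (ℚ.*-assoc (recip (misses v x)) (hits v x) a)))

  shift-≥ : ∀ v f x a → (∀ y → x ~[ ❴ v ❵ ] y → st y v ≡ h → a ≤ f y) → odds v x * a ≤ shift v f x
  shift-≥ v f x a p = ℚ.≤-trans (ℚ.≤-reflexive (ℚ.*-assoc (recip (misses v x)) (hits v x) a))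
    (*-monoˡ (0≤recip (0<misses v x)) (ℚ.≤-trans (ℚ.≤-reflexive (sym (∑-*ʳ X a _))) (∑-mono X λ y → j-mono v x y (p y))))

  -- Double counting: a state `y` with `v` coloured `h` spreads its weight evenly over its
  -- `misses v y` recolourings away from `h`. Both `κ` and `misses v` are constant on the class, so
  -- they can be read at either end.
  shift-sum : ∀ v {κ} → Inv ❴ v ❵ κ → ∀ f →
    ∑ X (λ x → κ x * (miss x v * shift v f x)) ≡ ∑ X (λ x → κ x * (hit x v * f x))
  shift-sum v {κ} κ-inv f = begin
    ∑ X (λ x → κ x * (miss x v * (recip (misses v x) * ∑ X (λ y → j v x y h * f y))))
      ≡⟨ ∑-cong X (λ x → trans (eq₁ (κ x) (miss x v) (recip (misses v x)) _) (sym (∑-*ˡ X (κ x * miss x v * recip (misses v x)) _))) ⟩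
    ∑ X (λ x → ∑ X (λ y → κ x * miss x v * recip (misses v x) * (j v x y h * f y)))
      ≡⟨ ∑-swap X X _ ⟩
    ∑ X (λ y → ∑ X (λ x → κ x * miss x v * recip (misses v x) * (j v x y h * f y)))
      ≡⟨ ∑-cong X (λ y → trans (∑-cong X λ x → step x y) (∑-*ˡ X (κ y * recip (misses v y) * (hit y v * f y)) _)) ⟩
    ∑ X (λ y → κ y * recip (misses v y) * (hit y v * f y) * misses v y)
      ≡⟨ ∑-cong X (λ y → trans (eq₂ (κ y) (recip (misses v y)) (hit y v * f y) (misses v y))
           (trans (cong (_* (κ y * (hit y v * f y))) (*-recip (0<misses v y))) (ℚ.*-identityˡ (κ y * (hit y v * f y))))) ⟩
    ∑ X (λ y → κ y * (hit y v * f y)) ∎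
    where
    open ≡-Reasoning
    eq₁ : ∀ a b c d → a * (b * (c * d)) ≡ a * b * c * d
    eq₁ = solve-∀ ℚ-ring
    eq₂ : ∀ k a b c → k * a * b * c ≡ c * a * (k * b)
    eq₂ = solve-∀ ℚ-ring
    eq₃ : ∀ k m a r c f → k * m * a * (r * c * f) ≡ r * (k * a) * (m * (c * f))
    eq₃ = solve-∀ ℚ-ring
    eq₄ : ∀ k m a r c f → r * (k * a) * (m * (c * f)) ≡ k * a * (c * f) * (r * m)
    eq₄ = solve-∀ ℚ-ring
    step : ∀ x y → κ x * miss x v * recip (misses v x) * (j v x y h * f y) ≡
                   κ y * recip (misses v y) * (hit y v * f y) * (r ❴ v ❵ y x * miss x v)
    step x y = trans (eq₃ (κ x) (miss x v) (recip (misses v x)) (r ❴ v ❵ x y) (hit y v) (f y))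
      (trans (cong (_* (miss x v * (hit y v * f y))) (trans (r-mult ❴ v ❵ x y λ p → cong₂ _*_ (κ-inv x y p) (cong recip (misses-inv v x y p)))
        (cong (_* (κ y * recip (misses v y))) (r-sym ❴ v ❵ x y))))
      (eq₄ (κ y) (miss x v) (recip (misses v y)) (r ❴ v ❵ y x) (hit y v) (f y)))

  none : List (Fin n) → State → ℚ
  none us x = ∏ us (miss x)

  weight : ℚ → List (Fin n) → State → ℚ
  weight t us x = ∏ us λ v → miss x v + t * hit x v

  -- The partition function, at fugacity t times the odds, of the hard-core model on the vertices of us
  -- that may be recoloured to h: recolouring u blocks its neighbours.
  Z : ℚ → List (Fin n) → State → ℚ
  Z t []       x = 1ℚ
  Z t (u ∷ us) x = Z t us x + t * shift u (Z t us) x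

  0≤Z : ∀ {t} → 0ℚ ≤ t → ∀ us x → 0ℚ ≤ Z t us x
  0≤Z p []       x = 0≤1
  0≤Z p (u ∷ us) x = 0≤+ (0≤Z p us x) (0≤* p (0≤shift u x (0≤Z p us)))

  col-inv : ∀ {u v} → v ≢ u → Inv ❴ u ❵ (λ x → col x v h)
  col-inv v≢u x y p = cong (λ c → 𝟙 (c ℕ.≟ h)) (p _ (≢⇒❴❵ v≢u))

  none-inv : ∀ {u us} → All (u ≢_) us → Inv ❴ u ❵ (none us)
  none-inv {u} {us} u∉ x y p = ∏-cong-∈ us λ v v∈ → cong (λ q → 1ℚ - q) (col-inv (λ { refl → All.lookup u∉ v∈ refl }) x y p)

  -- Recolouring the hit vertices of `us` away from `h` gathers the weight of all states on those
  -- where no vertex of `us` is hit, and `Z t us` is the factor gathered there. The induction moves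
  -- one vertex at a time.
  Z-sum : ∀ t {us} → Unique us → ∀ {κ} → (∀ u → u ∈ us → Inv ❴ u ❵ κ) →
          ∑ X (λ x → κ x * (none us x * Z t us x)) ≡ ∑ X (λ x → κ x * weight t us x)
  Z-sum t {[]}     []       κ-inv = refl
  Z-sum t {u ∷ us} (u∉ ∷ un) {κ} κ-inv = begin
    ∑ X (λ x → κ x * (miss x u * none us x * (Z t us x + t * shift u (Z t us) x)))
      ≡⟨ ∑-cong X (λ x → eq₁ (κ x) (miss x u) (none us x) (Z t us x) t (shift u (Z t us) x)) ⟩
    ∑ X (λ x → κ x * miss x u * (none us x * Z t us x) + t * (κ x * none us x * (miss x u * shift u (Z t us) x)))
      ≡⟨ trans (∑-+ X _ _) (cong (∑ X (λ x → κ x * miss x u * (none us x * Z t us x)) +_) (trans (∑-*ˡ X t _) (cong (t *_)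
           (shift-sum u (λ x y p → cong₂ _*_ (κ-inv u (here refl) x y p) (none-inv u∉ x y p)) (Z t us))))) ⟩
    ∑ X (λ x → κ x * miss x u * (none us x * Z t us x)) + t * ∑ X (λ x → κ x * none us x * (hit x u * Z t us x))
      ≡⟨ trans (cong (∑ X (λ x → κ x * miss x u * (none us x * Z t us x)) +_) (sym (∑-*ˡ X t _))) (sym (∑-+ X _ _)) ⟩
    ∑ X (λ x → κ x * miss x u * (none us x * Z t us x) + t * (κ x * none us x * (hit x u * Z t us x)))
      ≡⟨ ∑-cong X (λ x → eq₂ (κ x) (miss x u) (none us x) (Z t us x) t (hit x u)) ⟩
    ∑ X (λ x → κ x * (miss x u + t * hit x u) * (none us x * Z t us x))
      -- The factor of `u` joins `κ`: recolouring the remaining vertices does not affect it.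
      ≡⟨ Z-sum t un {λ x → κ x * (miss x u + t * hit x u)} (λ v v∈ x y p → cong₂ _*_ (κ-inv v (there v∈) x y p)
           (cong (λ q → (1ℚ - q) + t * q) (col-inv (λ { refl → All.lookup u∉ v∈ refl }) x y p))) ⟩
    ∑ X (λ x → κ x * (miss x u + t * hit x u) * weight t us x)
      ≡⟨ ∑-cong X (λ x → ℚ.*-assoc (κ x) (miss x u + t * hit x u) (weight t us x)) ⟩
    ∑ X (λ x → κ x * ((miss x u + t * hit x u) * weight t us x)) ∎
    where
    open ≡-Reasoning
    eq₁ : ∀ k m e z t s → k * (m * e * (z + t * s)) ≡ k * m * (e * z) + t * (k * e * (m * s))
    eq₁ = solve-∀ ℚ-ring
    eq₂ : ∀ k m e z t c → k * m * (e * z) + t * (k * e * (c * z)) ≡ k * (m + t * c) * (e * z)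
    eq₂ = solve-∀ ℚ-ring

  0≤1+ : ∀ {a} → 0ℚ ≤ a → 0ℚ ≤ 1ℚ + a
  0≤1+ = 0≤+ 0≤1

  -- Recolouring `u` to `h` makes the odds of its neighbours 0 and leaves the others as they are, so
  -- no factor increases.
  Z-upper : ∀ {t} → 0ℚ ≤ t → ∀ {us} → Unique us → ∀ x → Z t us x ≤ ∏ us (λ v → 1ℚ + t * odds v x)
  Z-upper {t} 0≤t {[]} [] x = ℚ.≤-refl
  Z-upper {t} 0≤t {u ∷ us} (u∉ ∷ un) x = ℚ.≤-trans
    (ℚ.+-mono-≤ (Z-upper 0≤t un x) (*-monoˡ 0≤t (shift-≤ u (Z t us) x _ λ y p q → ℚ.≤-trans (Z-upper 0≤t un y)
      (∏-mono-∈ us (λ v → 0≤1+ (0≤* 0≤t (0≤odds v y))) λ v v∈ → ℚ.+-monoʳ-≤ 1ℚ (*-monoˡ 0≤t (shrink y p q v v∈))))))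
    (ℚ.≤-reflexive (eq (∏ us (λ v → 1ℚ + t * odds v x)) t (odds u x)))
    where
    eq : ∀ P t o → P + t * (o * P) ≡ (1ℚ + t * o) * P
    eq = solve-∀ ℚ-ring
    shrink : ∀ y → x ~[ ❴ u ❵ ] y → st y u ≡ h → ∀ v → v ∈ us → odds v y ≤ odds v x
    shrink y p q v v∈ with adj G v u in e
    ... | true  = subst (_≤ odds v x) (sym (odds-blocked e q)) (0≤odds v x)
    ... | false = ℚ.≤-reflexive (odds-local (λ { refl → All.lookup u∉ v∈ refl }) e (~-sym p))

  module Classes {m : ℕ} (cls : Fin n → Fin m) (cls-proper : ∀ u v → adj G u v ≡ true → cls u ≢ cls v) where

    marked : Fin m → State → Fin n → ℚ
    marked i x v = 1ℚ + 𝟙 (cls v Fin.≟ i) * odds v x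

    1≤marked : ∀ i x v → 1ℚ ≤ marked i x v
    1≤marked i x v = ≤-by _ (0≤* (0≤𝟙 (cls v Fin.≟ i)) (0≤odds v x)) refl

    -- A class is an independent set: recolouring one of its vertices does not touch the odds of the
    -- others. The nonnegative terms of all other vertices are discarded.
    Z-lower : ∀ i {us} → Unique us → ∀ x → ∏ us (marked i x) ≤ Z 1ℚ us x
    Z-lower i {[]} [] x = ℚ.≤-refl
    Z-lower i {u ∷ us} (u∉ ∷ un) x = go (cls u Fin.≟ i)
      where
      P = ∏ us (marked i x)
      eq₁ : ∀ P o → (1ℚ + 1ℚ * o) * P ≡ P + 1ℚ * (o * P)
      eq₁ = solve-∀ ℚ-ring
      eq₀ : ∀ P o → (1ℚ + 0ℚ * o) * P ≡ P
      eq₀ = solve-∀ ℚ-ring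
      go : Dec (cls u ≡ i) → marked i x u * P ≤ Z 1ℚ us x + 1ℚ * shift u (Z 1ℚ us) x
      go (no ¬p) = ℚ.≤-trans (ℚ.≤-reflexive (trans (cong (λ q → (1ℚ + q * odds u x) * P) (𝟙-no (cls u Fin.≟ i) ¬p)) (eq₀ P (odds u x))))
        (ℚ.≤-trans (Z-lower i un x) (≤-by _ (0≤* 0≤1 (0≤shift u x (0≤Z 0≤1 us))) refl))
      go (yes p) = ℚ.≤-trans (ℚ.≤-reflexive (trans (cong (λ q → (1ℚ + q * odds u x) * P) (𝟙-yes (cls u Fin.≟ i) p)) (eq₁ P (odds u x))))
        (ℚ.+-mono-≤ (Z-lower i un x) (*-monoˡ 0≤1 (shift-≥ u (Z 1ℚ us) x P λ y a _ → ℚ.≤-trans (ℚ.≤-reflexive (∏-cong-∈ us λ v v∈ → same y a v v∈)) (Z-lower i un y))))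
        where
        same : ∀ y → x ~[ ❴ u ❵ ] y → ∀ v → v ∈ us → marked i x v ≡ marked i y v
        same y a v v∈ with cls v Fin.≟ i
        ... | no _  = cong (1ℚ +_) (trans (ℚ.*-zeroˡ (odds v x)) (sym (ℚ.*-zeroˡ (odds v y))))
        ... | yes q = cong (λ o → 1ℚ + 1ℚ * o) (odds-local (λ { refl → All.lookup u∉ v∈ refl })
                (Bool.¬-not λ e → cls-proper v u e (trans q (sym p))) a)

    odds-product : ∀ {us} → Unique us → ∀ x → ∏ us (λ v → 1ℚ + odds v x) ≤ Z 1ℚ us x ^^ m
    odds-product {us} un x = begin
      ∏ us (λ v → 1ℚ + odds v x)                ≡⟨ ∏-cong-∈ us (λ v _ → sym (split v)) ⟩
      ∏ us (λ v → ∏ (allFin m) λ i → marked i x v) ≡⟨ ∏-swap us (allFin m) _ ⟩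
      ∏ (allFin m) (λ i → ∏ us (marked i x))     ≤⟨ ∏-mono-∈ (allFin m) (λ i → 0≤∏ us λ v → ℚ.≤-trans 0≤1 (1≤marked i x v)) (λ i _ → Z-lower i un x) ⟩
      ∏ (allFin m) (λ _ → Z 1ℚ us x)             ≡⟨ trans (∏-const (allFin m) _) (cong (Z 1ℚ us x ^^_) (length-tabulate {n = m} id)) ⟩
      Z 1ℚ us x ^^ m                             ∎
      where
      open ℚ.≤-Reasoning
      split : ∀ v → ∏ (allFin m) (λ i → marked i x v) ≡ 1ℚ + odds v x
      split v = trans (∏-single (Unique.allFin⁺ m) (∈-allFin (cls v)) (λ i → marked i x v) (λ i ne →
          trans (cong (λ q → 1ℚ + q * odds v x) (𝟙-no (cls v Fin.≟ i) (ne ∘ sym))) (trans (cong (1ℚ +_) (ℚ.*-zeroˡ (odds v x))) (ℚ.+-identityʳ 1ℚ))))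
        (trans (cong (λ q → 1ℚ + q * odds v x) (𝟙-yes (cls v Fin.≟ cls v) refl)) (cong (1ℚ +_) (ℚ.*-identityˡ (odds v x))))

  module Thinning {m : ℕ} (cls : Fin n → Fin (suc m)) (cls-proper : ∀ u v → adj G u v ≡ true → cls u ≢ cls v)
                  {t : ℚ} (0≤t : 0ℚ ≤ t) (t-small : 2ℚ * ι (suc m ℕ.+ suc m) * t ≤ 1ℚ) where
    open Classes cls cls-proper

    -- Compare the powers with exponent `suc m`. On the left every vertex gets the exponent
    -- `suc m + suc m`, two copies because of the square, and `t` is small enough for `power-linear`
    -- to bound that power by `1ℚ + odds v x`. On the right there is one copy of `Z-lower` for each
    -- class.
    Z²≤Z : ∀ {us} → Unique us → ∀ x → Z t us x * Z t us x ≤ Z 1ℚ us x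
    Z²≤Z {us} un x = ℚ.≤-trans (*-mono (0≤Z 0≤t us x) (Z-upper 0≤t un x) (0≤Z 0≤t us x) (Z-upper 0≤t un x))
      (^^-cancel m (0≤Z 0≤1 us x) (begin
        (P * P) ^^ suc m              ≡⟨ trans (^^-*-distrib P P (suc m)) (sym (^^-+ P (suc m) (suc m))) ⟩
        P ^^ (suc m ℕ.+ suc m)        ≡⟨ ∏-^^ us (suc m ℕ.+ suc m) (λ v → 1ℚ + t * odds v x) ⟨
        ∏ us (λ v → (1ℚ + t * odds v x) ^^ (suc m ℕ.+ suc m))
          ≤⟨ ∏-mono-∈ us (λ v → 0≤^^ (suc m ℕ.+ suc m) (0≤1+ (0≤* 0≤t (0≤odds v x)))) (λ v _ → factor v) ⟩
        ∏ us (λ v → 1ℚ + odds v x)    ≤⟨ odds-product un x ⟩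
        Z 1ℚ us x ^^ suc m            ∎))
      where
      open ℚ.≤-Reasoning
      P = ∏ us (λ v → 1ℚ + t * odds v x)
      M = ι (suc m ℕ.+ suc m)
      factor : ∀ v → (1ℚ + t * odds v x) ^^ (suc m ℕ.+ suc m) ≤ 1ℚ + odds v x
      factor v = ℚ.≤-trans (power-linear (suc m ℕ.+ suc m) (0≤* 0≤t (0≤odds v x)) (ℚ.≤-trans small (odds≤1 v x))) (ℚ.+-monoʳ-≤ 1ℚ small)
        where
        small : 2ℚ * M * (t * odds v x) ≤ odds v x
        small = ℚ.≤-trans (ℚ.≤-reflexive (sym (ℚ.*-assoc (2ℚ * M) t (odds v x))))
          (ℚ.≤-trans (*-monoʳ (0≤odds v x) t-small) (ℚ.≤-reflexive (ℚ.*-identityˡ (odds v x))))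

    weight-1 : ∀ us x → weight 1ℚ us x ≡ 1ℚ
    weight-1 us x = trans (∏-cong-∈ us λ v _ → eq (col x v h)) (trans (∏-const us 1ℚ) (1^^ (length us)))
      where
      eq : ∀ c → (1ℚ - c) + 1ℚ * c ≡ 1ℚ
      eq = solve-∀ ℚ-ring

    -- Log-convexity of the generating function of the number of vertices of us coloured h.
    thinning : ∀ W {us} → Unique us → (∀ u → u ∈ us → W u ≡ true) → ∀ x →
               A W (weight t us) x * A W (weight t us) x ≤ A W (none us) x
    thinning W {us} un us⊆W x = begin
      A W (weight t us) x * A W (weight t us) x ≡⟨ cong (λ q → q * q) (trans (sym (Z-sum t un k-inv)) (∑-cong X λ y → sym (ℚ.*-assoc (k W x y) (none us y) (Z t us y)))) ⟩
      -- The measure `w` has total mass `A W (none us) x`. The second factor of Cauchy-Schwarz is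
      -- bounded through `Z²≤Z`, and `Z-sum` at fugacity 1 evaluates that bound to 1.
      ∑ X (λ y → w y * Z t us y) * ∑ X (λ y → w y * Z t us y) ≤⟨ cauchy-schwarz X w (Z t us) 0≤w ⟩
      ∑ X w * ∑ X (λ y → w y * (Z t us y * Z t us y)) ≤⟨ *-monoˡ (0≤∑ X 0≤w) (∑-mono X λ y → *-monoˡ (0≤w y) (Z²≤Z un y)) ⟩
      ∑ X w * ∑ X (λ y → w y * Z 1ℚ us y)       ≡⟨ cong (∑ X w *_) (trans (∑-cong X λ y → ℚ.*-assoc (k W x y) (none us y) (Z 1ℚ us y)) (Z-sum 1ℚ un k-inv)) ⟩
      ∑ X w * A W (weight 1ℚ us) x               ≡⟨ cong (∑ X w *_) (trans (A-cong W x λ y _ → weight-1 us y) (A-const W 1ℚ x)) ⟩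
      ∑ X w * 1ℚ                                 ≡⟨ ℚ.*-identityʳ _ ⟩
      A W (none us) x                            ∎
      where
      open ℚ.≤-Reasoning
      w : State → ℚ
      w y = k W x y * none us y
      0≤w : ∀ y → 0ℚ ≤ w y
      0≤w y = 0≤* (0≤k W x y) (0≤∏ us (0≤miss y))
      k-inv : ∀ u → u ∈ us → Inv ❴ u ❵ (k W x)
      k-inv u u∈ y z p = cong (_* recip (N W x)) (trans (r-sym W x y) (trans
        (r-shift W x (λ v w → p v (≢⇒❴❵ {s = u} {v} λ { refl → true≢false (us⊆W u u∈) w }))) (r-sym W z x)))

-- The Poincaré inequality

-- Regions are functions, so constructors carry pointwise equations instead of fixing the index. A
-- union keeps the bound `d`; only `root` raises it.
data TreeDepth {n : ℕ} (G : Graph n) : Region n → ℕ → Set where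
  empty : ∀ {W d} → (∀ v → W v ≡ false) → TreeDepth G W d
  union : ∀ {W₁ W₂ W d} → TreeDepth G W₁ d → TreeDepth G W₂ d →
          (∀ v → W₁ v ≡ true → W₂ v ≡ false) → (∀ u v → W₁ u ≡ true → W₂ v ≡ true → adj G u v ≡ false) →
          (∀ v → W v ≡ W₁ v ∨ W₂ v) → TreeDepth G W d
  root  : ∀ {W W⁺ d} s → TreeDepth G W d → W s ≡ false → (∀ v → W⁺ v ≡ W v ∨ ❴ s ❵ v) → TreeDepth G W⁺ (suc d)

∏-zero : ∀ {A : Set} {xs : List A} {a} → a ∈ xs → (f : A → ℚ) → f a ≡ 0ℚ → ∏ xs f ≡ 0ℚ
∏-zero {xs = x ∷ xs} (here refl) f p = trans (cong (_* ∏ xs f) p) (ℚ.*-zeroˡ (∏ xs f))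
∏-zero {xs = x ∷ xs} (there a∈) f p = trans (cong (f x *_) (∏-zero a∈ f p)) (ℚ.*-zeroʳ (f x))

∏≤1 : ∀ {A : Set} (xs : List A) {f : A → ℚ} → (∀ x → 0ℚ ≤ f x) → (∀ x → f x ≤ 1ℚ) → ∏ xs f ≤ 1ℚ
∏≤1 []       p q = ℚ.≤-refl
∏≤1 (x ∷ xs) p q = *-mono (p x) (q x) (0≤∏ xs p) (∏≤1 xs p q)

^^-anti : ∀ {t} m {n} → 0ℚ ≤ t → t ≤ 1ℚ → m ℕ.≤ n → t ^^ n ≤ t ^^ m
^^-anti {t} zero {n} p q m≤n = ^^-≤1 n p q
^^-anti {t} (suc m) {suc n} p q (ℕ.s≤s m≤n) = *-monoˡ p (^^-anti m p q m≤n)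

⅛ : ℚ
⅛ = ½ * (½ * ½)

0≤⅛ : 0ℚ ≤ ⅛
0≤⅛ = 0≤* 0≤½ (0≤* 0≤½ 0≤½)

-- For j ≤ 8 the left-hand side is at most t ^^ 8, and for j > 8 it is negative.
power-chord : ∀ {t} → 0ℚ ≤ t → t ≤ 1ℚ → ∀ j → t ^^ 8 * (1ℚ - ⅛ * ι j) ≤ t ^^ j
power-chord {t} p q j with ℕ.≤-total j 8
... | inj₁ j≤8 = ℚ.≤-trans (≤-by _ (0≤* (0≤^^ 8 p) (0≤* 0≤⅛ (0≤ι j))) (eq (t ^^ 8) (⅛ * ι j))) (^^-anti j p q j≤8)
  where
  eq : ∀ a b → a ≡ a * (1ℚ - b) + a * b
  eq = solve-∀ ℚ-ring
... | inj₂ 8≤j = ℚ.≤-trans (≤-by _ (0≤* (0≤^^ 8 p) (0≤* 0≤⅛ (≤⇒0≤- (ι-mono 8≤j)))) (eq (t ^^ 8) (ι j))) (0≤^^ j p)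
  where
  eq : ∀ a b → 0ℚ ≡ a * (1ℚ - ½ * (½ * ½) * b) + a * (½ * (½ * ½) * (b - ι 8))
  eq = solve-∀ ℚ-ring

-- The bound is affine in `α` and `β`, ready to be summed over colours. If it is positive then both
-- are at least a half, so `a * b` is at least the fourth power of `T` over 16; and as
-- `α + β - 1ℚ - ½` is at most a half, the constant ⅛ suffices.
product-chord : ∀ {T a b e f α β} → 0ℚ ≤ T → 0ℚ ≤ a → 0ℚ ≤ b → e * e ≤ a → f * f ≤ b →
  T * α ≤ e → T * β ≤ f → α ≤ 1ℚ → β ≤ 1ℚ → T * T * (T * T) * ⅛ * (α + β - 1ℚ - ½) ≤ a * b
product-chord {T} {a} {b} {e} {f} {α} {β} 0≤T 0≤a 0≤b ee ff Te Tf α≤1 β≤1 with ℚ.≤-total 0ℚ (α + β - 1ℚ - ½)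
... | inj₂ neg = ℚ.≤-trans (*-monoˡ (0≤* (0≤* (0≤* 0≤T 0≤T) (0≤* 0≤T 0≤T)) 0≤⅛) neg)
      (ℚ.≤-trans (ℚ.≤-reflexive (ℚ.*-zeroʳ (T * T * (T * T) * ⅛))) (0≤* 0≤a 0≤b))
... | inj₁ pos = ℚ.≤-trans
      (≤-by _ (0≤* (0≤* (0≤* (0≤* 0≤T 0≤T) (0≤* 0≤T 0≤T)) 0≤⅛) (0≤+ (≤⇒0≤- α≤1) (≤⇒0≤- β≤1))) (eq T α β))
      (*-mono (0≤sq (T * ½)) (half Te ½≤α ee) (0≤sq (T * ½)) (half Tf ½≤β ff))
  where
  eq : ∀ T a b → T * ½ * (T * ½) * (T * ½ * (T * ½)) ≡ T * T * (T * T) * (½ * (½ * ½)) * (a + b - 1ℚ - ½)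
       + T * T * (T * T) * (½ * (½ * ½)) * ((1ℚ - a) + (1ℚ - b))
  eq = solve-∀ ℚ-ring
  eq₁ : ∀ a b → a ≡ ½ + ((a + b - 1ℚ - ½) + (1ℚ - b))
  eq₁ = solve-∀ ℚ-ring
  eq₂ : ∀ a b → b ≡ ½ + ((a + b - 1ℚ - ½) + (1ℚ - a))
  eq₂ = solve-∀ ℚ-ring
  ½≤α : ½ ≤ α
  ½≤α = ≤-by _ (0≤+ pos (≤⇒0≤- β≤1)) (eq₁ α β)
  ½≤β : ½ ≤ β
  ½≤β = ≤-by _ (0≤+ pos (≤⇒0≤- α≤1)) (eq₂ α β)
  half : ∀ {γ e a} → T * γ ≤ e → ½ ≤ γ → e * e ≤ a → T * ½ * (T * ½) ≤ a
  half Tγ p q = ℚ.≤-trans (*-mono (0≤* 0≤T 0≤½) r (0≤* 0≤T 0≤½) r) q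
    where r = ℚ.≤-trans (*-monoˡ 0≤T p) Tγ

length-filter-# : ∀ {n} (B : Region n) (vs : List (Fin n)) →
  ι (length (List.filter (λ v → B v Bool.≟ true) vs)) ≡ ∑ vs (λ v → ⟦ B v ⟧)
length-filter-# B [] = refl
length-filter-# B (v ∷ vs) with B v
... | true  = cong (1ℚ +_) (length-filter-# B vs)
... | false = trans (length-filter-# B vs) (sym (ℚ.+-identityˡ _))

module Poincare {n : ℕ} (G : Graph n) (L : ListAssignment n) (S : Enumeration G L) (deg+2 : IsDegPlus2 G L)
                {m : ℕ} (cls : Fin n → Fin (suc m)) (cls-proper : ∀ u v → adj G u v ≡ true → cls u ≢ cls v) where
  open Enumeration S
  open Averages G L S
  open Vertices G L S

  -- `t⁻¹` is what `Thinning` requires, `T` is the factor in `power-chord`, the eighth in `δ` comes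
  -- from `product-chord`, and its last `½ * ½` is the fraction of the palette left over in
  -- `common`.
  t⁻¹ t T δ : ℚ
  t⁻¹ = 2ℚ * ι (suc m ℕ.+ suc m)
  t = recip t⁻¹
  T = t ^^ 8
  δ = T * T * (T * T) * ⅛ * (½ * ½)

  0<t⁻¹ : 0ℚ < t⁻¹
  0<t⁻¹ = 0<* 0<2 (0<ι (m ℕ.+ suc m))

  0<t : 0ℚ < t
  0<t = 0<recip 0<t⁻¹

  0≤t : 0ℚ ≤ t
  0≤t = ℚ.<⇒≤ 0<t

  1≤t⁻¹ : 1ℚ ≤ t⁻¹
  1≤t⁻¹ = ℚ.≤-trans (≤-by 1ℚ 0≤1 refl) (*-monoˡ 0≤2 (ι-mono {1} {suc m ℕ.+ suc m} (ℕ.s≤s ℕ.z≤n)))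

  t≤1 : t ≤ 1ℚ
  t≤1 = *-cancelˡ 0<t⁻¹ (ℚ.≤-trans (ℚ.≤-reflexive (*-recip 0<t⁻¹)) (ℚ.≤-trans 1≤t⁻¹ (ℚ.≤-reflexive (sym (ℚ.*-identityʳ t⁻¹)))))

  0<T : 0ℚ < T
  0<T = 0<^^ 8 0<t

  0<½ : 0ℚ < ½
  0<½ = ℚ.positive⁻¹ ½

  0<δ : 0ℚ < δ
  0<δ = 0<* (0<* (0<* (0<* 0<T 0<T) (0<* 0<T 0<T)) (0<* 0<½ (0<* 0<½ 0<½))) (0<* 0<½ 0<½)

  module _ (W : Region n) (s : Fin n) (W-s : W s ≡ false) where
    open Hub W s W-s

    Inner : Region n
    Inner v = adj G s v ∧ W v

    us : List (Fin n)
    us = List.filter (λ v → Inner v Bool.≟ true) V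

    us! : Unique us
    us! = Unique.filter⁺ (λ v → Inner v Bool.≟ true) (Unique.allFin⁺ n)

    us⊆W : ∀ u → u ∈ us → W u ≡ true
    us⊆W u u∈ = Bool.∧-conicalʳ (adj G s u) (W u) (proj₂ (∈-filter⁻ (λ v → Inner v Bool.≟ true) {xs = V} u∈))

    ∈us : ∀ {u} → adj G s u ≡ true → W u ≡ true → u ∈ us
    ∈us {u} e w = ∈-filter⁺ (λ v → Inner v Bool.≟ true) (∈-allFin u) (cong₂ _∧_ e w)

    -- The list exceeds the degree, and only outer neighbours take colours from the palette, so
    -- enough remain for the inner ones. Averaged over the palette, at most one inner neighbour has
    -- the colour.
    size≤palette : ∀ x → ι (length us) ≤ palette x
    size≤palette x = ℚ.≤-trans (≤-by _ (0≤+ (≤⇒0≤- (deg+2≤len deg+2 s)) 0≤2) eq) (palette-bound Outer x s)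
      where
      split : # (adj G s) ≡ # Outer + ι (length us)
      split = trans (∑-cong V λ u → lem (adj G s u) (W u)) (trans (∑-+ V _ _) (cong (# Outer +_) (sym (length-filter-# Inner V))))
        where
        lem : ∀ a b → ⟦ a ⟧ ≡ ⟦ a ∧ not b ⟧ + ⟦ a ∧ b ⟧
        lem true  true  = refl
        lem true  false = refl
        lem false _     = refl
      eq₁ : ∀ l o i → l - o ≡ i + ((l - (o + i + 2ℚ)) + 2ℚ)
      eq₁ = solve-∀ ℚ-ring
      eq : len s - # Outer ≡ ι (length us) + ((len s - (# (adj G s) + 2ℚ)) + 2ℚ)
      eq = trans (eq₁ (len s) (# Outer) (ι (length us))) (cong (λ q → ι (length us) + ((len s - (q + 2ℚ)) + 2ℚ)) (sym split))

    module _ (h : ℕ) where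
      open Resampling G L S deg+2 h
      open Thinning cls cls-proper 0≤t (ℚ.≤-reflexive (*-recip 0<t⁻¹))

      outer-none≤free : ∀ x → outer x h * none us x ≤ free x s h
      outer-none≤free x with Free? x s h
      ... | yes _ = ℚ.≤-trans (*-monoʳ (0≤∏ us (0≤miss x)) (𝟙≤1 (Avoids? Outer x h)))
                    (ℚ.≤-trans (ℚ.≤-reflexive (ℚ.*-identityˡ _)) (∏≤1 us (0≤miss x) λ v → ≤-by (col x v h) (0≤col x v h) (eq (col x v h))))
        where
        eq : ∀ a → 1ℚ ≡ (1ℚ - a) + a
        eq = solve-∀ ℚ-ring
      ... | no ¬f with Fin.any? (λ u → (adj G s u Bool.≟ true) ×-dec (st x u ℕ.≟ h))
      ...   | no ¬e = ⊥-elim (¬f λ u e q → ¬e (u , e , q))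
      ...   | yes (u , e , q) with W u Bool.≟ true
      ...     | yes w = ℚ.≤-reflexive (trans (cong (outer x h *_) (∏-zero (∈us e w) (miss x) (cong (λ q → 1ℚ - q) (𝟙-yes (st x u ℕ.≟ h) q)))) (ℚ.*-zeroʳ (outer x h)))
      ...     | no ¬w = ℚ.≤-reflexive (trans (cong (_* none us x) (𝟙-no (Avoids? Outer x h) λ a → a u (cong₂ (λ p q → p ∧ not q) e (Bool.¬-not ¬w)) q)) (ℚ.*-zeroˡ (none us x)))

      mean load : State → ℚ
      mean = A W (weight t us)
      load = A W (λ y → ∑ us (hit y))

      avail-≥ : ∀ x → outer x h * (mean x * mean x) ≤ avail h x
      avail-≥ x = ℚ.≤-trans (*-monoˡ (0≤𝟙 (Avoids? Outer x h)) (thinning W us! us⊆W x))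
        (ℚ.≤-trans (ℚ.≤-reflexive (sym (A-pull W {λ x → outer x h} (λ x y p → outer-inv h x y (~-weaken (⊆-∪ {W} {s}) p)) (none us) x)))
          (A-mono W x λ y _ → outer-none≤free y))

      count : ∀ y vs → ∃[ i ] (weight t vs y ≡ t ^^ i × ∑ vs (hit y) ≡ ι i)
      count y [] = 0 , refl , refl
      count y (v ∷ vs) with count y vs | st y v ℕ.≟ h
      ... | i , p , q | yes _ = suc i , cong₂ _*_ (eq t) p , cong (1ℚ +_) q
        where
        eq : ∀ t → (1ℚ - 1ℚ) + t * 1ℚ ≡ t
        eq = solve-∀ ℚ-ring
      ... | i , p , q | no _ = i , trans (cong (_* weight t vs y) (eq t)) (trans (ℚ.*-identityˡ (weight t vs y)) p) , trans (ℚ.+-identityˡ _) q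
        where
        eq : ∀ t → (1ℚ - 0ℚ) + t * 0ℚ ≡ 1ℚ
        eq = solve-∀ ℚ-ring

      -- The chord is affine in the number of hits, so averaging replaces that number by its mean
      -- `load`.
      mean-≥ : ∀ x → T * (1ℚ - ⅛ * load x) ≤ mean x
      mean-≥ x = ℚ.≤-trans (ℚ.≤-reflexive linear) (A-mono W x λ y _ → pointwise y)
        where
        pointwise : ∀ y → T * (1ℚ - ⅛ * ∑ us (hit y)) ≤ weight t us y
        pointwise y with count y us
        ... | i , p , q = subst (λ w → T * (1ℚ - ⅛ * ∑ us (hit y)) ≤ w) (sym p)
              (subst (λ c → T * (1ℚ - ⅛ * c) ≤ t ^^ i) (sym q) (power-chord 0≤t t≤1 i))
        linear : T * (1ℚ - ⅛ * load x) ≡ A W (λ y → T * (1ℚ - ⅛ * ∑ us (hit y))) x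
        linear = sym (trans (A-*ˡ W T _ x) (cong (T *_) (trans (A-- W (λ _ → 1ℚ) _ x) (cong₂ _-_ (A-const W 1ℚ x) (A-*ˡ W ⅛ _ x)))))

      0≤load : ∀ x → 0ℚ ≤ load x
      0≤load x = 0≤A W x λ y → 0≤∑ us λ v → 0≤col y v h

      α : State → ℚ
      α x = 1ℚ - ⅛ * load x

      α≤1 : ∀ x → α x ≤ 1ℚ
      α≤1 x = ≤-by _ (0≤* 0≤⅛ (0≤load x)) (eq (⅛ * load x))
        where
        eq : ∀ a → 1ℚ ≡ (1ℚ - a) + a
        eq = solve-∀ ℚ-ring

      avail-pair : ∀ x y → x ~[ W⁺ ] y → outer x h * (T * T * (T * T) * ⅛ * (α x + α y - 1ℚ - ½)) ≤ avail h x * avail h y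
      avail-pair x y p with Avoids? Outer x h in eqx
      ... | no _ = ℚ.≤-trans (ℚ.≤-reflexive (ℚ.*-zeroˡ (T * T * (T * T) * ⅛ * (α x + α y - 1ℚ - ½)))) (0≤* (0≤avail h x) (0≤avail h y))
      ... | yes a = ℚ.≤-trans (ℚ.≤-reflexive (ℚ.*-identityˡ _)) (product-chord (ℚ.<⇒≤ 0<T) (0≤avail h x) (0≤avail h y)
              (lower x (cong 𝟙 eqx)) (lower y (trans (sym (outer-inv h x y p)) (cong 𝟙 eqx)))
              (mean-≥ x) (mean-≥ y) (α≤1 x) (α≤1 y))
        where
        lower : ∀ z → outer z h ≡ 1ℚ → mean z * mean z ≤ avail h z
        lower z q = subst (_≤ avail h z) (trans (cong (_* (mean z * mean z)) q) (ℚ.*-identityˡ (mean z * mean z))) (avail-≥ z)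

    load-sum : ∀ x → ∑ (colours L s) (λ h → load h x) ≤ ι (length us)
    load-sum x = ℚ.≤-trans (ℚ.≤-reflexive (sym (A-∑ W (colours L s) _ x))) (ℚ.≤-trans
      (A-mono W x λ y _ → ℚ.≤-trans (ℚ.≤-reflexive (∑-swap (colours L s) us _)) (ℚ.≤-trans
        (∑-mono us λ u → ∑-𝟙≤1 (distinct L s) (st y u)) (ℚ.≤-reflexive (∑-1 us))))
      (ℚ.≤-reflexive (A-const W (ι (length us)) x)))

    -- Up to the factor `B`, the lower bounds add up to half the palette less an eighth of the two
    -- total loads. Each total load is at most the palette, so a quarter of the palette is left.
    common : ∀ x y → x ~[ W⁺ ] y → δ * palette x ≤ ∑ (colours L s) (λ h → avail h x * avail h y)
    common x y p = ℚ.≤-trans (≤-by _ (0≤* (0≤* (0≤* (0≤* 0≤T 0≤T) (0≤* 0≤T 0≤T)) 0≤⅛) slack) (eq B (palette x) Λ)) (ℚ.≤-trans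
        (ℚ.≤-reflexive (sym linear)) (∑-mono (colours L s) λ h → avail-pair h x y p))
      where
      0≤T = ℚ.<⇒≤ 0<T
      B = T * T * (T * T) * ⅛
      Λ = ∑ (colours L s) (λ h → outer x h * (load h x + load h y))
      linear : ∑ (colours L s) (λ h → outer x h * (B * (α h x + α h y - 1ℚ - ½))) ≡ B * (½ * palette x - ⅛ * Λ)
      linear = trans (∑-cong (colours L s) λ h → eq₁ (outer x h) B (load h x) (load h y)) (trans (∑-*ˡ (colours L s) B _)
        (cong (B *_) (trans (∑-- (colours L s) _ _) (cong₂ _-_ (∑-*ˡ (colours L s) ½ _) (∑-*ˡ (colours L s) ⅛ _)))))
        where
        eq₁ : ∀ o B a b → o * (B * ((1ℚ - ½ * (½ * ½) * a) + (1ℚ - ½ * (½ * ½) * b) - 1ℚ - ½)) ≡ B * (½ * o - ½ * (½ * ½) * (o * (a + b)))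
        eq₁ = solve-∀ ℚ-ring
      eq : ∀ B p l → B * (½ * p - ½ * (½ * ½) * l) ≡ B * (½ * ½) * p + B * ((½ * ½) * p - ½ * (½ * ½) * l)
      eq = solve-∀ ℚ-ring
      Λ≤ : Λ ≤ palette x + palette x
      Λ≤ = ℚ.≤-trans (∑-mono (colours L s) λ h → ℚ.≤-trans (*-monoʳ (0≤+ (0≤load h x) (0≤load h y)) (𝟙≤1 (Avoids? Outer x h))) (ℚ.≤-reflexive (ℚ.*-identityˡ _)))
        (ℚ.≤-trans (ℚ.≤-reflexive (∑-+ (colours L s) _ _)) (ℚ.+-mono-≤ (ℚ.≤-trans (load-sum x) (size≤palette x)) (ℚ.≤-trans (load-sum y) (size≤palette x))))
      slack : 0ℚ ≤ (½ * ½) * palette x - ⅛ * Λ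
      slack = subst (0ℚ ≤_) (eq₂ (palette x) Λ) (0≤* 0≤⅛ (≤⇒0≤- Λ≤))
        where
        eq₂ : ∀ p l → ½ * (½ * ½) * ((p + p) - l) ≡ (½ * ½) * p - ½ * (½ * ½) * l
        eq₂ = solve-∀ ℚ-ring

  K κ : ℚ
  K = 2ℚ * 2ℚ * recip δ
  κ = 2ℚ * K + 1ℚ

  0≤K : 0ℚ ≤ K
  0≤K = 0≤* (0≤* 0≤2 0≤2) (0≤recip 0<δ)

  1≤κ : 1ℚ ≤ κ
  1≤κ = ≤-by _ (0≤* 0≤2 0≤K) (ℚ.+-comm (2ℚ * K) 1ℚ)

  0≤κ : 0ℚ ≤ κ
  0≤κ = ℚ.≤-trans 0≤1 1≤κ

  energy : Region n → (State → ℚ) → ℚ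
  energy W f = ∑ V λ v → ⟦ W v ⟧ * E ❴ v ❵ f

  energy-add : ∀ {W W₁ W₂} → (∀ v → W₁ v ≡ true → W₂ v ≡ false) → (∀ v → W v ≡ W₁ v ∨ W₂ v) →
               ∀ f → energy W f ≡ energy W₁ f + energy W₂ f
  energy-add {W} {W₁} {W₂} disj u f = trans (∑-cong V λ v → trans (cong (_* E ❴ v ❵ f) (lem v)) (ℚ.*-distribʳ-+ (E ❴ v ❵ f) ⟦ W₁ v ⟧ ⟦ W₂ v ⟧)) (∑-+ V _ _)
    where
    lem : ∀ v → ⟦ W v ⟧ ≡ ⟦ W₁ v ⟧ + ⟦ W₂ v ⟧
    lem v rewrite u v with W₁ v in p
    ... | true rewrite disj v p = refl
    ... | false = sym (ℚ.+-identityˡ _)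

  energy-❴❵ : ∀ s f → energy ❴ s ❵ f ≡ E ❴ s ❵ f
  energy-❴❵ s f = trans (∑-single (Unique.allFin⁺ n) (∈-allFin s) _ λ v ne → trans (cong (λ b → ⟦ b ⟧ * E ❴ v ❵ f) (≢⇒❴❵ ne)) (ℚ.*-zeroˡ (E ❴ v ❵ f)))
    (trans (cong (λ b → ⟦ b ⟧ * E ❴ s ❵ f) (dec-true (s Fin.≟ s) refl)) (ℚ.*-identityˡ (E ❴ s ❵ f)))

  0≤energy : ∀ W f → 0ℚ ≤ energy W f
  0≤energy W f = 0≤∑ V λ v → 0≤* (0≤⟦⟧ (W v)) (0≤E ❴ v ❵ f)

  poincare : ∀ {W d} → TreeDepth G W d → ∀ f → E W f ≤ κ ^^ d * energy W f
  poincare {W} {d} (empty p) f = ℚ.≤-trans (ℚ.≤-reflexive (E-empty p f)) (0≤* (0≤^^ d 0≤κ) (0≤energy W f))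
  poincare {W} {d} (union {W₁} {W₂} t₁ t₂ disj ne u) f = ℚ.≤-trans (E-union (record { disjoint = disj ; no-edge = ne }) u f)
    (ℚ.≤-trans (ℚ.+-mono-≤ (poincare t₁ f) (poincare t₂ f)) (ℚ.≤-reflexive
      (trans (sym (ℚ.*-distribˡ-+ (κ ^^ d) (energy W₁ f) (energy W₂ f))) (cong (κ ^^ d *_) (sym (energy-add disj u f))))))
  poincare {W′} {suc d} (root {W} s td W-s u) f = begin
    E W′ f                                  ≡⟨ E-resp u f ⟩
    E W⁺ f                                  ≤⟨ E-add 0≤K (λ g g-inv → hub-inequality g-inv 0<δ (common W s W-s)) f ⟩
    -- `2ℚ * K` is below `κ`, hence below `κ * κ ^^ d`, so `s` enters the energy with the same
    -- factor as the other vertices.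
    κ * E W f + 2ℚ * K * E ❴ s ❵ f           ≤⟨ ℚ.+-mono-≤ (*-monoˡ 0≤κ (poincare td f)) (*-monoʳ (0≤E ❴ s ❵ f)
        (ℚ.≤-trans (≤-by {b = κ} {a = 2ℚ * K} 1ℚ 0≤1 refl) (ℚ.≤-trans (ℚ.≤-reflexive (sym (ℚ.*-identityʳ κ))) (*-monoˡ 0≤κ (1≤^^ d 1≤κ))))) ⟩
    κ * (κ ^^ d * energy W f) + κ * κ ^^ d * E ❴ s ❵ f ≡⟨ eq κ (κ ^^ d) (energy W f) (E ❴ s ❵ f) ⟩
    κ * κ ^^ d * (energy W f + E ❴ s ❵ f)    ≡⟨ cong (κ * κ ^^ d *_) (trans (cong (energy W f +_) (sym (energy-❴❵ s f))) (sym (energy-add disj u f))) ⟩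
    κ * κ ^^ d * energy W′ f                 ∎
    where
    open Hub W s W-s
    open ℚ.≤-Reasoning
    eq : ∀ k c a b → k * (c * a) + k * c * b ≡ k * c * (a + b)
    eq = solve-∀ ℚ-ring
    disj : ∀ v → W v ≡ true → ❴ s ❵ v ≡ false
    disj v w = ≢⇒❴❵ {s = s} {v} λ { refl → true≢false w W-s }

-- The transition operator

module Dynamics {n : ℕ} (G : Graph n) (L : ListAssignment n) (S : Enumeration G L) (deg+2 : IsDegPlus2 G L) (0<n : 0 ℕ.< n) where
  open Enumeration S
  open Averages G L S
  open Vertices G L S

  same : State → State → ℚ
  same x y = 𝟙 (x Fin.≟ y)

  same-sum : ∀ x (f : State → ℚ) → ∑ X (λ y → same x y * f y) ≡ f x
  same-sum x f = trans (∑-unique _ x λ y ne → trans (cong (_* f y) (𝟙-no (x Fin.≟ y) (ne ∘ sym))) (ℚ.*-zeroˡ (f y)))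
    (trans (cong (_* f x) (𝟙-yes (x Fin.≟ x) refl)) (ℚ.*-identityˡ (f x)))

  -- The transition matrix once `v` is picked: `len v - N ❴ v ❵ x` proposals are rejected, and each
  -- state of the class, `x` included, is reached by one accepted colour.
  step : Fin n → State → State → ℚ
  step v x y = recip (len v) * ((len v - N ❴ v ❵ x) * same x y + r ❴ v ❵ x y)

  p : State → State → ℚ
  p x y = recip (ι n) * ∑ V λ v → step v x y

  0<ιn : 0ℚ < ι n
  0<ιn = go n 0<n
    where
    go : ∀ n → 0 ℕ.< n → 0ℚ < ι n
    go (suc n) _ = 0<ι n

  step-sym : ∀ v x y → step v x y ≡ step v y x
  step-sym v x y = cong (recip (len v) *_) (cong₂ _+_ (go (x Fin.≟ y) (y Fin.≟ x)) (r-sym ❴ v ❵ x y))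
    where
    go : (d : Dec (x ≡ y)) (e : Dec (y ≡ x)) → (len v - N ❴ v ❵ x) * 𝟙 d ≡ (len v - N ❴ v ❵ y) * 𝟙 e
    go (yes refl) e = cong ((len v - N ❴ v ❵ x) *_) (sym (𝟙-yes e refl))
    go (no ne) e = trans (ℚ.*-zeroʳ (len v - N ❴ v ❵ x)) (sym (trans (cong ((len v - N ❴ v ❵ y) *_) (𝟙-no e (ne ∘ sym))) (ℚ.*-zeroʳ (len v - N ❴ v ❵ y))))

  p-sym : ∀ x y → p x y ≡ p y x
  p-sym x y = cong (recip (ι n) *_) (∑-cong V λ v → step-sym v x y)

  0≤step : ∀ v x y → 0ℚ ≤ step v x y
  0≤step v x y = 0≤* (0≤recip (0<len v x)) (0≤+ (0≤* (≤⇒0≤- (N≤len v x)) (0≤𝟙 (x Fin.≟ y))) (0≤r ❴ v ❵ x y))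

  0≤p : ∀ x y → 0ℚ ≤ p x y
  0≤p x y = 0≤* (0≤recip 0<ιn) (0≤∑ V λ v → 0≤step v x y)

  M : (State → ℚ) → State → ℚ
  M f x = ∑ X λ y → p x y * f y

  step-apply : ∀ v f x → ∑ X (λ y → step v x y * f y) ≡ recip (len v) * ((len v - N ❴ v ❵ x) * f x + ∑ X (λ y → r ❴ v ❵ x y * f y))
  step-apply v f x = trans (∑-cong X λ y → eq (recip (len v)) (len v - N ❴ v ❵ x) (same x y) (r ❴ v ❵ x y) (f y))
    (trans (∑-*ˡ X (recip (len v)) _) (cong (recip (len v) *_) (trans (∑-+ X _ _) (cong (_+ ∑ X (λ y → r ❴ v ❵ x y * f y))
      (trans (∑-*ˡ X (len v - N ❴ v ❵ x) _) (cong ((len v - N ❴ v ❵ x) *_) (same-sum x f)))))))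
    where
    eq : ∀ a b c d f → a * (b * c + d) * f ≡ a * (b * (c * f) + d * f)
    eq = solve-∀ ℚ-ring

  M-apply : ∀ f x → M f x ≡ recip (ι n) * ∑ V λ v → recip (len v) * ((len v - N ❴ v ❵ x) * f x + ∑ X (λ y → r ❴ v ❵ x y * f y))
  M-apply f x = trans (∑-cong X λ y → trans (ℚ.*-assoc (recip (ι n)) _ (f y)) (cong (recip (ι n) *_) (sym (∑-*ʳ V (f y) _))))
    (trans (∑-*ˡ X (recip (ι n)) _) (cong (recip (ι n) *_) (trans (∑-swap X V _) (∑-cong V λ v → step-apply v f x))))

  rate : Fin n → State → ℚ
  rate v x = recip (len v) * N ❴ v ❵ x

  rate≤1 : ∀ v x → rate v x ≤ 1ℚ
  rate≤1 v x = ℚ.≤-trans (*-monoˡ (0≤recip (0<len v x)) (N≤len v x)) (ℚ.≤-reflexive (trans (ℚ.*-comm (recip (len v)) (len v)) (*-recip (0<len v x))))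

  β : ℚ
  β = 2ℚ * recip (ι n + 1ℚ)

  0<n+1 : 0ℚ < ι n + 1ℚ
  0<n+1 = ℚ.<-≤-trans 0<ιn (≤-by 1ℚ 0≤1 refl)

  0≤β : 0ℚ ≤ β
  0≤β = 0≤* 0≤2 (0≤recip 0<n+1)

  β≤rate : ∀ v x → β ≤ rate v x
  β≤rate v x = *-cancelˡ (0<* (0<len v x) 0<n+1) (ℚ.≤-trans (ℚ.≤-reflexive (trans (eq₁ (len v) (ι n + 1ℚ) (recip (ι n + 1ℚ)))
      (trans (cong (2ℚ * len v *_) (*-recip 0<n+1)) (ℚ.*-identityʳ (2ℚ * len v)))))
    (ℚ.≤-trans (2len≤ deg+2 v x) (ℚ.≤-reflexive (sym (trans (eq₂ (len v) (ι n + 1ℚ) (recip (len v)) (N ❴ v ❵ x))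
      (trans (cong (_* ((ι n + 1ℚ) * N ❴ v ❵ x)) (*-recip (0<len v x))) (ℚ.*-identityˡ _)))))))
    where
    eq₁ : ∀ l m r → l * m * (2ℚ * r) ≡ 2ℚ * l * (m * r)
    eq₁ = solve-∀ ℚ-ring
    eq₂ : ∀ l m r N → l * m * (r * N) ≡ (l * r) * (m * N)
    eq₂ = solve-∀ ℚ-ring

  rate-inv : ∀ v → Inv ❴ v ❵ (rate v)
  rate-inv v x y q = cong (recip (len v) *_) (N-inv ❴ v ❵ q)

  ∑r : ∀ v f x → ∑ X (λ y → r ❴ v ❵ x y * f y) ≡ N ❴ v ❵ x * A ❴ v ❵ f x
  ∑r v f x = sym (trans (sym (∑-*ˡ X (N ❴ v ❵ x) _)) (∑-cong X λ y → trans (eq (N ❴ v ❵ x) (r ❴ v ❵ x y) (recip (N ❴ v ❵ x)) (f y))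
    (trans (cong (_* (r ❴ v ❵ x y * f y)) (*-recip (0<N ❴ v ❵ x))) (ℚ.*-identityˡ (r ❴ v ❵ x y * f y)))))
    where
    eq : ∀ N r q f → N * (r * q * f) ≡ (N * q) * (r * f)
    eq = solve-∀ ℚ-ring

  -- An accepted proposal is uniform on the free colours. The update is therefore a lazy resampling
  -- of `v`, with a laziness constant on each class.
  Mᵥ : Fin n → (State → ℚ) → State → ℚ
  Mᵥ v f x = (1ℚ - rate v x) * f x + rate v x * A ❴ v ❵ f x

  M-mean : ∀ f x → M f x ≡ recip (ι n) * ∑ V λ v → Mᵥ v f x
  M-mean f x = trans (M-apply f x) (cong (recip (ι n) *_) (∑-cong V λ v → trans (cong (λ q → recip (len v) * ((len v - N ❴ v ❵ x) * f x + q)) (∑r v f x))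
    (trans (eq (recip (len v)) (len v) (N ❴ v ❵ x) (f x) (A ❴ v ❵ f x)) (cong (λ q → (q - rate v x) * f x + rate v x * A ❴ v ❵ f x) (*-recip (0<len v x))))))
    where
    eq : ∀ r l N f a → r * ((l - N) * f + N * a) ≡ (l * r - r * N) * f + r * N * a
    eq = solve-∀ ℚ-ring

  length-V : length V ≡ n
  length-V = length-tabulate {n = n} id

  jensen : ∀ (a : Fin n → ℚ) → sq (recip (ι n) * ∑ V a) ≤ recip (ι n) * ∑ V (λ v → sq (a v))
  jensen a = ℚ.≤-trans (ℚ.≤-reflexive (eq (recip (ι n)) (∑ V a))) (ℚ.≤-trans
    (*-monoˡ (0≤sq (recip (ι n))) (ℚ.≤-trans (ℚ.≤-reflexive (cong (λ q → q * q) (∑-cong V λ v → sym (ℚ.*-identityˡ (a v)))))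
      (cauchy-schwarz V (λ _ → 1ℚ) a λ _ → 0≤1)))
    (ℚ.≤-reflexive (trans (cong₂ (λ b c → recip (ι n) * recip (ι n) * (b * c)) (trans (∑-1 V) (cong ι length-V)) (∑-cong V λ v → ℚ.*-identityˡ (sq (a v))))
      (trans (eq′ (recip (ι n)) (ι n) (∑ V (λ v → sq (a v)))) (cong (λ q → q * (recip (ι n) * ∑ V (λ v → sq (a v)))) (*-recip 0<ιn) ⟨ trans ⟩ ℚ.*-identityˡ _)))))
    where
    open import Function using (_⟨_⟩_)
    eq : ∀ r s → (r * s) * (r * s) ≡ (r * r) * (s * s)
    eq = solve-∀ ℚ-ring
    eq′ : ∀ r n s → r * r * (n * s) ≡ (n * r) * (r * s)
    eq′ = solve-∀ ℚ-ring

  variance : Fin n → (State → ℚ) → State → ℚ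
  variance v f x = A ❴ v ❵ (λ y → sq (f y)) x - sq (A ❴ v ❵ f x)

  0≤variance : ∀ v f x → 0ℚ ≤ variance v f x
  0≤variance v f x = ≤⇒0≤- (ℚ.≤-trans (cauchy-schwarz X (k ❴ v ❵ x) f (0≤k ❴ v ❵ x))
    (ℚ.≤-reflexive (trans (cong (_* A ❴ v ❵ (λ y → sq (f y)) x) (k-row ❴ v ❵ x)) (ℚ.*-identityˡ (A ❴ v ❵ (λ y → sq (f y)) x)))))

  ∑-variance : ∀ v f → ∑ X (variance v f) ≡ E ❴ v ❵ f
  ∑-variance v f = trans (∑-- X _ _) (cong₂ _-_ (∑-A ❴ v ❵ (λ y → sq (f y))) (sym (⟨f,Af⟩ ❴ v ❵ f)))

  -- Convexity of the square compares the update with a mixture. As `rate v` is constant on classes,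
  -- the loss is the conditional variance weighted by `rate v`, which is at least `β` everywhere.
  Mᵥ-norm : ∀ v f → ⟨ Mᵥ v f , Mᵥ v f ⟩ ≤ ⟨ f , f ⟩ - β * E ❴ v ❵ f
  Mᵥ-norm v f = begin
    ⟨ Mᵥ v f , Mᵥ v f ⟩ ≤⟨ ∑-mono X (λ x → convex (rate v x) (f x) (A ❴ v ❵ f x) (ℚ.≤-trans 0≤β (β≤rate v x)) (rate≤1 v x)) ⟩
    ∑ X (λ x → sq (f x) - (rate v x * sq (f x) - rate v x * sq (A ❴ v ❵ f x)))
      ≡⟨ trans (∑-- X _ _) (cong (λ q → ⟨ f , f ⟩ - q) (trans (∑-- X _ _) (cong (_- ∑ X (λ x → rate v x * sq (A ❴ v ❵ f x))) (sym averaged)))) ⟩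
    ⟨ f , f ⟩ - (∑ X (λ x → rate v x * A ❴ v ❵ (λ y → sq (f y)) x) - ∑ X (λ x → rate v x * sq (A ❴ v ❵ f x)))
      ≡⟨ cong (λ q → ⟨ f , f ⟩ - q) (trans (sym (∑-- X _ _)) (∑-cong X λ x → eq (rate v x) (A ❴ v ❵ (λ y → sq (f y)) x) (sq (A ❴ v ❵ f x)))) ⟩
    ⟨ f , f ⟩ - ∑ X (λ x → rate v x * variance v f x)
      ≤⟨ ℚ.+-monoʳ-≤ ⟨ f , f ⟩ (ℚ.neg-antimono-≤ (ℚ.≤-trans (ℚ.≤-reflexive (trans (cong (β *_) (sym (∑-variance v f))) (sym (∑-*ˡ X β _))))
           (∑-mono X λ x → *-monoʳ (0≤variance v f x) (β≤rate v x)))) ⟩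
    ⟨ f , f ⟩ - β * E ❴ v ❵ f ∎
    where
    open ℚ.≤-Reasoning
    eq : ∀ a b c → a * b - a * c ≡ a * (b - c)
    eq = solve-∀ ℚ-ring
    averaged : ∑ X (λ x → rate v x * A ❴ v ❵ (λ y → sq (f y)) x) ≡ ∑ X (λ x → rate v x * sq (f x))
    averaged = trans (A-adjoint ❴ v ❵ (rate v) (λ y → sq (f y))) (⟨⟩-cong {g = λ y → sq (f y)} (A-fix ❴ v ❵ (rate-inv v)) λ _ → refl)
    convex : ∀ a u w → 0ℚ ≤ a → a ≤ 1ℚ → sq ((1ℚ - a) * u + a * w) ≤ sq u - (a * sq u - a * sq w)
    convex a u w 0≤a a≤1 = ≤-by (a * (1ℚ - a) * sq (u - w)) (0≤* (0≤* 0≤a (≤⇒0≤- a≤1)) (0≤sq (u - w))) (eq′ a u w)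
      where
      eq′ : ∀ a u w → u * u - (a * (u * u) - a * (w * w)) ≡ ((1ℚ - a) * u + a * w) * ((1ℚ - a) * u + a * w) + a * (1ℚ - a) * ((u - w) * (u - w))
      eq′ = solve-∀ ℚ-ring

  M-norm : ∀ f → ⟨ M f , M f ⟩ ≤ ⟨ f , f ⟩ - recip (ι n) * (β * ∑ V λ v → E ❴ v ❵ f)
  M-norm f = begin
    ⟨ M f , M f ⟩ ≤⟨ ∑-mono X (λ x → ℚ.≤-trans (ℚ.≤-reflexive (cong sq (M-mean f x))) (jensen λ v → Mᵥ v f x)) ⟩
    ∑ X (λ x → recip (ι n) * ∑ V (λ v → sq (Mᵥ v f x))) ≡⟨ trans (∑-*ˡ X (recip (ι n)) _) (cong (recip (ι n) *_) (∑-swap X V _)) ⟩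
    recip (ι n) * ∑ V (λ v → ⟨ Mᵥ v f , Mᵥ v f ⟩) ≤⟨ *-monoˡ (0≤recip 0<ιn) (∑-mono V λ v → Mᵥ-norm v f) ⟩
    recip (ι n) * ∑ V (λ v → ⟨ f , f ⟩ - β * E ❴ v ❵ f)
      ≡⟨ cong (recip (ι n) *_) (trans (∑-- V _ _) (cong₂ _-_ (trans (∑-const V ⟨ f , f ⟩) (cong (λ m → ι m * ⟨ f , f ⟩) length-V)) (∑-*ˡ V β _))) ⟩
    recip (ι n) * (ι n * ⟨ f , f ⟩ - β * ∑ V (λ v → E ❴ v ❵ f))
      ≡⟨ trans (eq (recip (ι n)) (ι n) ⟨ f , f ⟩ (β * ∑ V (λ v → E ❴ v ❵ f))) (cong (_- recip (ι n) * (β * ∑ V (λ v → E ❴ v ❵ f))) (trans (cong (_* ⟨ f , f ⟩) (*-recip 0<ιn)) (ℚ.*-identityˡ ⟨ f , f ⟩))) ⟩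
    ⟨ f , f ⟩ - recip (ι n) * (β * ∑ V λ v → E ❴ v ❵ f) ∎
    where
    open ℚ.≤-Reasoning
    eq : ∀ r n a b → r * (n * a - b) ≡ (n * r) * a - r * b
    eq = solve-∀ ℚ-ring

  M-1 : ∀ x → ∑ X (p x) ≡ 1ℚ
  M-1 x = trans (∑-cong X λ y → sym (ℚ.*-identityʳ (p x y))) (trans (M-mean (λ _ → 1ℚ) x)
    (trans (cong (recip (ι n) *_) (trans (∑-cong V λ v → trans (cong (λ q → (1ℚ - rate v x) * 1ℚ + rate v x * q) (A-const ❴ v ❵ 1ℚ x)) (eq (rate v x)))
      (trans (∑-1 V) (cong ι length-V)))) (trans (ℚ.*-comm (recip (ι n)) (ι n)) (*-recip 0<ιn))))
    where
    eq : ∀ a → (1ℚ - a) * 1ℚ + a * 1ℚ ≡ 1ℚ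
    eq = solve-∀ ℚ-ring

  ∑-M : ∀ f → ∑ X (M f) ≡ ∑ X f
  ∑-M f = trans (∑-swap X X _) (∑-cong X λ y → trans (∑-*ʳ X (f y) _) (trans (cong (_* f y) (trans (∑-cong X λ x → p-sym x y) (M-1 y))) (ℚ.*-identityˡ (f y))))

  M-mono : ∀ {f g} → (∀ x → f x ≤ g x) → ∀ x → M f x ≤ M g x
  M-mono h x = ∑-mono X λ y → *-monoˡ (0≤p x y) (h y)

  0≤M : ∀ {f} → (∀ x → 0ℚ ≤ f x) → ∀ x → 0ℚ ≤ M f x
  0≤M h x = 0≤∑ X λ y → 0≤* (0≤p x y) (h y)

  M-+ : ∀ f g x → M (λ y → f y + g y) x ≡ M f x + M g x
  M-+ f g x = trans (∑-cong X λ y → ℚ.*-distribˡ-+ (p x y) (f y) (g y)) (∑-+ X _ _)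

  M-cong : ∀ {f g} → (∀ x → f x ≡ g x) → ∀ x → M f x ≡ M g x
  M-cong h x = ∑-cong X λ y → cong (p x y *_) (h y)

  -- Global variance and its decay under iteration.

  ⊤ : Region n
  ⊤ _ = true

  r-⊤ : ∀ x y → r ⊤ x y ≡ 1ℚ
  r-⊤ x y = 𝟙-yes (~? x ⊤ y) λ _ ()

  total : ℚ
  total = ι size

  N-⊤ : ∀ x → N ⊤ x ≡ total
  N-⊤ x = trans (∑-cong X (r-⊤ x)) (trans (∑-1 X) (cong ι (length-tabulate {n = size} id)))

  A-⊤ : ∀ f x → A ⊤ f x ≡ recip total * ∑ X f
  A-⊤ f x = trans (∑-cong X λ y → trans (cong₂ (λ a b → a * recip b * f y) (r-⊤ x y) (N-⊤ x)) (cong (_* f y) (ℚ.*-identityˡ (recip total)))) (∑-*ˡ X (recip total) f)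

  E-⊤ : ∀ f → E ⊤ f ≡ ⟨ f , f ⟩ - recip total * (∑ X f * ∑ X f)
  E-⊤ f = cong (λ q → ⟨ f , f ⟩ - q) (trans (∑-cong X λ x → trans (cong (f x *_) (A-⊤ f x)) (eq (f x) (recip total) (∑ X f))) (trans (∑-*ˡ X (recip total) _) (cong (recip total *_) (∑-*ʳ X (∑ X f) f))))
    where
    eq : ∀ a b c → a * (b * c) ≡ b * (a * c)
    eq = solve-∀ ℚ-ring

  E-M : ∀ f → E ⊤ (M f) ≤ E ⊤ f - recip (ι n) * (β * ∑ V λ v → E ❴ v ❵ f)
  E-M f = ℚ.≤-trans (ℚ.≤-reflexive (trans (E-⊤ (M f)) (cong (λ s → ⟨ M f , M f ⟩ - recip total * (s * s)) (∑-M f))))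
    (ℚ.≤-trans (ℚ.+-monoˡ-≤ (- (recip total * (∑ X f * ∑ X f))) (M-norm f))
    (ℚ.≤-reflexive (trans (eq ⟨ f , f ⟩ (recip (ι n) * (β * ∑ V λ v → E ❴ v ❵ f)) (recip total * (∑ X f * ∑ X f))) (cong (_- recip (ι n) * (β * ∑ V λ v → E ❴ v ❵ f)) (sym (E-⊤ f))))))
    where
    eq : ∀ a b c → a - b - c ≡ a - c - b
    eq = solve-∀ ℚ-ring

  iterate : ℕ → (State → ℚ) → State → ℚ
  iterate zero    f = f
  iterate (suc t) f = M (iterate t f)

  ∑-iterate : ∀ t f → ∑ X (iterate t f) ≡ ∑ X f
  ∑-iterate zero    f = refl
  ∑-iterate (suc t) f = trans (∑-M (iterate t f)) (∑-iterate t f)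

  0≤iterate : ∀ t {f} → (∀ x → 0ℚ ≤ f x) → ∀ x → 0ℚ ≤ iterate t f x
  0≤iterate zero    h = h
  0≤iterate (suc t) h = 0≤M (0≤iterate t h)

  iterate-+ : ∀ t f g x → iterate t (λ y → f y + g y) x ≡ iterate t f x + iterate t g x
  iterate-+ zero    f g x = refl
  iterate-+ (suc t) f g x = trans (M-cong (iterate-+ t f g) x) (M-+ (iterate t f) (iterate t g) x)

  iterate-cong : ∀ t {f g} → (∀ x → f x ≡ g x) → ∀ x → iterate t f x ≡ iterate t g x
  iterate-cong zero    h = h
  iterate-cong (suc t) h = M-cong (iterate-cong t h)

  iterate-assoc : ∀ s t f x → iterate (s ℕ.+ t) f x ≡ iterate s (iterate t f) x
  iterate-assoc zero    t f x = refl
  iterate-assoc (suc s) t f x = M-cong (iterate-assoc s t f) x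

  module Contraction {C : ℚ} (1≤C : 1ℚ ≤ C) (gap : ∀ f → E ⊤ f ≤ C * ∑ V λ v → E ❴ v ❵ f) where
    0<C : 0ℚ < C
    0<C = ℚ.<-≤-trans 0<1 1≤C

    γ : ℚ
    γ = recip (ι n) * (β * recip C)

    0≤γ : 0ℚ ≤ γ
    0≤γ = 0≤* (0≤recip 0<ιn) (0≤* 0≤β (0≤recip 0<C))

    contract : ∀ f → E ⊤ (M f) ≤ (1ℚ - γ) * E ⊤ f
    contract f = ℚ.≤-trans (E-M f) (≤-by _ (0≤* (0≤* (0≤recip 0<ιn) 0≤β) (≤⇒0≤- scaled)) (eq (E ⊤ f) (recip (ι n)) β (recip C) (∑ V λ v → E ❴ v ❵ f)))
      where
      scaled : recip C * E ⊤ f ≤ ∑ V (λ v → E ❴ v ❵ f)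
      scaled = ℚ.≤-trans (*-monoˡ (0≤recip 0<C) (gap f)) (ℚ.≤-reflexive (trans (sym (ℚ.*-assoc (recip C) C _))
        (trans (cong (_* ∑ V (λ v → E ❴ v ❵ f)) (trans (ℚ.*-comm (recip C) C) (*-recip 0<C))) (ℚ.*-identityˡ _))))
      eq : ∀ e r b c s → (1ℚ - r * (b * c)) * e ≡ e - r * (b * s) + r * b * (s - c * e)
      eq = solve-∀ ℚ-ring

    iterate-contract : γ ≤ 1ℚ → ∀ t f → E ⊤ (iterate t f) ≤ (1ℚ - γ) ^^ t * E ⊤ f
    iterate-contract γ≤1 zero    f = ℚ.≤-reflexive (sym (ℚ.*-identityˡ (E ⊤ f)))
    iterate-contract γ≤1 (suc t) f = ℚ.≤-trans (contract (iterate t f)) (ℚ.≤-trans (*-monoˡ (≤⇒0≤- γ≤1) (iterate-contract γ≤1 t f))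
      (ℚ.≤-reflexive (sym (ℚ.*-assoc (1ℚ - γ) _ (E ⊤ f)))))

-- The chain of the statement

vec-ext : ∀ {n} {σ τ : Colouring n} → (∀ v → Vec.lookup σ v ≡ Vec.lookup τ v) → σ ≡ τ
vec-ext {σ = σ} {τ} h = trans (sym (tabulate∘lookup σ)) (trans (tabulate-cong h) (tabulate∘lookup τ))

∈-choices⁺ : ∀ {n} (ls : Vec.Vec (List ℕ) n) σ → (∀ v → Vec.lookup σ v ∈ Vec.lookup ls v) → σ ∈ choices ls
∈-choices⁺ Vec.[]       Vec.[]       h = here refl
∈-choices⁺ (l Vec.∷ ls) (c Vec.∷ σ) h = ∈-concatMap⁺ (λ c → map (c Vec.∷_) (choices ls)) (lose (h zero) (∈-map⁺ (c Vec.∷_) (∈-choices⁺ ls σ (h ∘ suc))))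

∈-choices⁻ : ∀ {n} (ls : Vec.Vec (List ℕ) n) σ → σ ∈ choices ls → ∀ v → Vec.lookup σ v ∈ Vec.lookup ls v
∈-choices⁻ (l Vec.∷ ls) σ σ∈ v with find (∈-concatMap⁻ (λ c → map (c Vec.∷_) (choices ls)) {xs = l} σ∈)
... | c , c∈ , σ∈′ with ∈-map⁻ (c Vec.∷_) σ∈′
∈-choices⁻ (l Vec.∷ ls) σ σ∈ zero    | c , c∈ , _ | τ , τ∈ , refl = c∈
∈-choices⁻ (l Vec.∷ ls) σ σ∈ (suc v) | c , c∈ , _ | τ , τ∈ , refl = ∈-choices⁻ ls τ τ∈ v

choices! : ∀ {n} (ls : Vec.Vec (List ℕ) n) → (∀ v → Unique (Vec.lookup ls v)) → Unique (choices ls)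
choices! Vec.[] h = [] ∷ []
choices! (l Vec.∷ ls) h = Unique.concat⁺
  (All.map⁺ (All.tabulate λ {c} _ → Unique.map⁺ ∷-injectiveʳ (choices! ls (h ∘ suc))))
  (AllPairs.map⁺ (AllPairs.map (λ {c} {d} c≢d {σ} → disjoint c≢d) (h zero)))
  where
  disjoint : ∀ {c d σ} → c ≢ d → σ ∈ map (c Vec.∷_) (choices ls) × σ ∈ map (d Vec.∷_) (choices ls) → ⊥
  disjoint {c} {d} c≢d (p , q) with ∈-map⁻ (c Vec.∷_) p | ∈-map⁻ (d Vec.∷_) q
  ... | _ , _ , eq | _ , _ , eq′ = c≢d (∷-injectiveˡ (trans (sym eq) eq′))

∑-tabulate : ∀ {A : Set} {n} (g : Fin n → A) (f : A → ℚ) → ∑ (List.tabulate g) f ≡ ∑ (allFin n) (f ∘ g)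
∑-tabulate {n = zero}  g f = refl
∑-tabulate {n = suc n} g f = cong (f (g zero) +_) (trans (∑-tabulate (g ∘ suc) f) (sym (∑-tabulate suc (f ∘ g))))

∑-index : ∀ {A : Set} (xs : List A) (f : A → ℚ) → ∑ xs f ≡ ∑ (allFin (length xs)) (λ i → f (List.lookup xs i))
∑-index xs f = trans (cong (λ ys → ∑ ys f) (sym (tabulate-lookup xs))) (∑-tabulate (List.lookup xs) f)

lookup-injective : ∀ {A : Set} {xs : List A} → Unique xs → ∀ i j → List.lookup xs i ≡ List.lookup xs j → i ≡ j
lookup-injective (_  ∷ _) zero    zero    eq = refl
lookup-injective (x∉ ∷ _) zero    (suc j) eq = ⊥-elim (All.lookup x∉ (∈-lookup j) eq)
lookup-injective (x∉ ∷ _) (suc i) zero    eq = ⊥-elim (All.lookup x∉ (∈-lookup i) (sym eq))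
lookup-injective (_  ∷ u) (suc i) (suc j) eq = cong suc (lookup-injective u i j eq)

toℚᵘ-ι : ∀ n → ℚ.toℚᵘ (ι n) ≃ᵘ mkℚᵘ (ℤ.+ n) 0
toℚᵘ-ι zero = ℚᵘ.≃-refl
toℚᵘ-ι (suc n) = ℚᵘ.≃-trans (ℚ.toℚᵘ-homo-+ 1ℚ (ι n)) (ℚᵘ.≃-trans (ℚᵘ.+-congʳ (mkℚᵘ (ℤ.+ 1) 0) (toℚᵘ-ι n))
  (*≡* (cong (ℤ._* ℤ.+ 1) (cong (λ i → ℤ.+ 1 ℤ.+ i) (ℤ.*-identityʳ (ℤ.+ n))))))

ι*inv : ∀ m → ι (suc m) * inv (suc m) ≡ 1ℚ
ι*inv m = ℚ.toℚᵘ-injective (ℚᵘ.≃-trans (ℚ.toℚᵘ-homo-* (ι (suc m)) (inv (suc m))) (ℚᵘ.≃-trans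
  (ℚᵘ.*-cong (toℚᵘ-ι (suc m)) (ℚ.toℚᵘ-fromℚᵘ (mkℚᵘ (ℤ.+ 1) m)))
  (*≡* (trans (ℤ.*-identityʳ _) (trans (ℤ.*-identityʳ _) (trans (cong (λ i → ℤ.+ suc i) (sym (ℕ.+-identityʳ m))) (sym (ℤ.*-identityˡ _))))))))

inv≡recip : ∀ {m} → 0 ℕ.< m → inv m ≡ recip (ι m)
inv≡recip {suc m} _ = recip-unique (0<ι m) (ι*inv m)

module Concrete {n : ℕ} (G : Graph n) (L : ListAssignment n) where
  colouring : Fin (length (Ω G L)) → Colouring n
  colouring = List.lookup (Ω G L)

  Ω! : Unique (Ω G L)
  Ω! = Unique.filter⁺ (proper? G) (choices! (Vec.tabulate (colours L)) λ v → subst Unique (sym (lookup∘tabulate (colours L) v)) (distinct L v))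

  ∈Ω : ∀ {σ} → IsLColouring G L σ → σ ∈ Ω G L
  ∈Ω {σ} (σ∈ , pr) = ∈-filter⁺ (proper? G) (∈-choices⁺ (Vec.tabulate (colours L)) σ λ v → subst (Vec.lookup σ v ∈_) (sym (lookup∘tabulate (colours L) v)) (σ∈ v)) pr

  Ω∋ : ∀ {σ} → σ ∈ Ω G L → IsLColouring G L σ
  Ω∋ {σ} σ∈ with ∈-filter⁻ (proper? G) {xs = choices (Vec.tabulate (colours L))} σ∈
  ... | p , pr = (λ v → subst (Vec.lookup σ v ∈_) (lookup∘tabulate (colours L) v) (∈-choices⁻ (Vec.tabulate (colours L)) σ p v)) , pr

  index : ∀ {σ} → IsLColouring G L σ → ∃[ x ] colouring x ≡ σ
  index c = Any.index (∈Ω c) , sym (lookup-index (∈Ω c))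

  enumeration : Enumeration G L
  enumeration = record
    { size     = length (Ω G L)
    ; st       = λ x → Vec.lookup (colouring x)
    ; st-∈     = λ x → proj₁ (Ω∋ (∈-lookup x))
    ; st-edge  = λ x → proj₂ (Ω∋ (∈-lookup x))
    ; complete = λ σ σ∈ σ-edge → let
        at = lookup∘tabulate σ
        x , eq = index {Vec.tabulate σ} ((λ v → subst (_∈ colours L v) (sym (at v)) (σ∈ v)) , λ u v e q → σ-edge u v e (trans (sym (at u)) (trans q (at v))))
        in x , λ v → trans (cong (λ τ → Vec.lookup τ v) eq) (at v)
    ; st-inj   = λ x y h → lookup-injective Ω! x y (vec-ext h)
    }

  module Link (deg+2 : IsDegPlus2 G L) (0<n : 0 ℕ.< n) where
    open Enumeration enumeration using (st; st-inj)
    open Averages G L enumeration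
    open Vertices G L enumeration
    open Dynamics G L enumeration deg+2 0<n

    update-free : ∀ x v c → Free x v c → update G (colouring x) v c ≡ colouring x Vec.[ v ]≔ c
    update-free x v c f with Fin.any? (λ u → (adj G v u Bool.≟ true) ×-dec (Vec.lookup (colouring x) u ℕ.≟ c))
    ... | yes (u , e , eq) = ⊥-elim (f u e eq)
    ... | no _ = refl

    update-blocked : ∀ x v c → ¬ Free x v c → update G (colouring x) v c ≡ colouring x
    update-blocked x v c ¬f with Fin.any? (λ u → (adj G v u Bool.≟ true) ×-dec (Vec.lookup (colouring x) u ℕ.≟ c))
    ... | yes _ = refl
    ... | no ¬e = ⊥-elim (¬f λ u e eq → ¬e (u , e , eq))

    [≡ᶜ]-𝟙 : ∀ (σ τ : Colouring n) → [ σ ≡ᶜ τ ] ≡ 𝟙 (σ ≟ᶜ τ)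
    [≡ᶜ]-𝟙 σ τ with σ ≟ᶜ τ
    ... | yes _ = refl
    ... | no _  = refl

    same-𝟙 : ∀ x y → 𝟙 (colouring x ≟ᶜ colouring y) ≡ same x y
    same-𝟙 x y = 𝟙-⇔ (colouring x ≟ᶜ colouring y) (x Fin.≟ y) (lookup-injective Ω! x y) (cong colouring)

    update-𝟙 : ∀ x y v c → [ update G (colouring x) v c ≡ᶜ colouring y ] ≡ (1ℚ - free x v c) * same x y + free x v c * j v x y c
    update-𝟙 x y v c with Free? x v c
    ... | no ¬f = trans (cong ([_≡ᶜ colouring y ]) (update-blocked x v c ¬f)) (trans ([≡ᶜ]-𝟙 (colouring x) (colouring y)) (trans (same-𝟙 x y) (eq (same x y) (j v x y c))))
      where
      eq : ∀ s j → s ≡ (1ℚ - 0ℚ) * s + 0ℚ * j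
      eq = solve-∀ ℚ-ring
    ... | yes f = trans (cong ([_≡ᶜ colouring y ]) (update-free x v c f)) (trans ([≡ᶜ]-𝟙 σ (colouring y)) (trans matches (eq (same x y) (j v x y c))))
      where
      σ = colouring x Vec.[ v ]≔ c
      eq : ∀ s j → j ≡ (1ℚ - 1ℚ) * s + 1ℚ * j
      eq = solve-∀ ℚ-ring
      matches : 𝟙 (σ ≟ᶜ colouring y) ≡ j v x y c
      matches with σ ≟ᶜ colouring y
      ... | yes q = sym (cong₂ _*_ (𝟙-yes (~? x ❴ v ❵ y) λ u w → trans (sym (lookup∘update′ (❴❵-false {s = v} w) (colouring x) c)) (cong (λ τ → Vec.lookup τ u) q))
                      (𝟙-yes (st y v ℕ.≟ c) (trans (cong (λ τ → Vec.lookup τ v) (sym q)) (lookup∘update v (colouring x) c))))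
      ... | no ¬q = sym (j-zero v x y c λ { (r , eq) → ¬q (vec-ext λ u → agree r eq u (u Fin.≟ v)) })
        where
        agree : x ~[ ❴ v ❵ ] y → st y v ≡ c → ∀ u → Dec (u ≡ v) → Vec.lookup σ u ≡ st y u
        agree r eq u (yes refl) = trans (lookup∘update u (colouring x) c) (sym eq)
        agree r eq u (no u≢v)   = trans (lookup∘update′ u≢v (colouring x) c) (r u (≢⇒❴❵ u≢v))

    free*j : ∀ x y v c → free x v c * j v x y c ≡ j v x y c
    free*j x y v c = trans (ℚ.*-comm (free x v c) (j v x y c)) (trans (j-mult v x y c λ { r refl → 𝟙-yes (Free? x v c) (~-free r) }) (ℚ.*-identityʳ (j v x y c)))

    0<length : ∀ v → State → 0 ℕ.< length (colours L v)
    0<length v x with colours L v | Enumeration.st-∈ enumeration x v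
    ... | _ ∷ _ | _ = ℕ.s≤s ℕ.z≤n

    P-kernel : ∀ x y → Defs.P G L (colouring x) (colouring y) ≡ p x y
    P-kernel x y = trans (sumℚ-map V _) (trans (∑-cong V λ v → trans (sumℚ-map (colours L v) _) (per-vertex v)) (∑-*ˡ V (recip (ι n)) _))
      where
      per-vertex : ∀ v → ∑ (colours L v) (λ c → inv (n ℕ.* length (colours L v)) * [ update G (colouring x) v c ≡ᶜ colouring y ]) ≡ recip (ι n) * step v x y
      per-vertex v = begin
        ∑ (colours L v) (λ c → inv (n ℕ.* length (colours L v)) * [ update G (colouring x) v c ≡ᶜ colouring y ])
          ≡⟨ ∑-*ˡ (colours L v) (inv (n ℕ.* length (colours L v))) _ ⟩
        inv (n ℕ.* length (colours L v)) * ∑ (colours L v) (λ c → [ update G (colouring x) v c ≡ᶜ colouring y ])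
          ≡⟨ cong₂ _*_ weight′ (trans (∑-cong (colours L v) λ c → trans (update-𝟙 x y v c) (cong ((1ℚ - free x v c) * same x y +_) (free*j x y v c)))
               (trans (∑-+ (colours L v) _ _) (cong₂ _+_ (trans (∑-*ʳ (colours L v) (same x y) _) (cong (_* same x y) rejected)) accepted))) ⟩
        recip (ι n) * recip (len v) * ((len v - N ❴ v ❵ x) * same x y + r ❴ v ❵ x y)
          ≡⟨ ℚ.*-assoc (recip (ι n)) (recip (len v)) _ ⟩
        recip (ι n) * step v x y ∎
        where
        open ≡-Reasoning
        weight′ : inv (n ℕ.* length (colours L v)) ≡ recip (ι n) * recip (len v)
        weight′ = trans (inv≡recip (ℕ.*-mono-< 0<n (0<length v x))) (trans (cong recip (ι-* n (length (colours L v)))) (recip-* 0<ιn (0<len v x)))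
        rejected : ∑ (colours L v) (λ c → 1ℚ - free x v c) ≡ len v - N ❴ v ❵ x
        rejected = trans (∑-- (colours L v) _ _) (cong₂ _-_ (∑-1 (colours L v)) (sym (N-free v x)))
        accepted : ∑ (colours L v) (λ c → j v x y c) ≡ r ❴ v ❵ x y
        accepted = trans (∑-*ˡ (colours L v) (r ❴ v ❵ x y) _) (trans (cong (r ❴ v ❵ x y *_) (col-sum y v)) (ℚ.*-identityʳ (r ❴ v ❵ x y)))

    -- `ν` pushes laws forward while `M` acts on functions; `p-sym` identifies the two.
    ν-iterate : ∀ t x y → Defs.ν G L t (colouring x) (colouring y) ≡ iterate t (same x) y
    ν-iterate zero    x y = trans ([≡ᶜ]-𝟙 (colouring x) (colouring y)) (same-𝟙 x y)
    ν-iterate (suc t) x y = trans (sumℚ-map (Ω G L) _) (trans (∑-index (Ω G L) _) (∑-cong X λ z →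
      trans (cong₂ _*_ (ν-iterate t x z) (trans (P-kernel z y) (p-sym z y))) (ℚ.*-comm (iterate t (same x) z) (p y z))))

    dTV-iterate : ∀ t x → Defs.dTV G L t (colouring x) ≡ ½ * ∑ X (λ y → ∣ iterate t (same x) y - recip total ∣)
    dTV-iterate t x = cong (½ *_) (trans (sumℚ-map (Ω G L) _) (trans (∑-index (Ω G L) _) (∑-cong X λ y →
      cong₂ (λ a b → ∣ a - b ∣) (ν-iterate t x y) (inv≡recip (0<size x)))))
      where
      0<size : ∀ {m} → Fin m → 0 ℕ.< m
      0<size {suc m} _ = ℕ.s≤s ℕ.z≤n

-- Warm start

∏-replace : ∀ {A : Set} {xs : List A} → Unique xs → ∀ {a} → a ∈ xs → (f g : A → ℚ) →
            (∀ x → x ≢ a → f x ≡ g x) → ∏ xs f * g a ≡ ∏ xs g * f a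
∏-replace {xs = x ∷ xs} (x∉ ∷ u) (here refl) f g h = trans
  (cong (λ q → f x * q * g x) (∏-cong-∈ xs λ y y∈ → h y λ { refl → All.lookup x∉ y∈ refl })) (eq (f x) (∏ xs g) (g x))
  where
  eq : ∀ a p b → a * p * b ≡ b * p * a
  eq = solve-∀ ℚ-ring
∏-replace {xs = x ∷ xs} (x∉ ∷ u) {a} (there a∈) f g h = trans (ℚ.*-assoc (f x) (∏ xs f) (g a)) (trans
  (cong₂ _*_ (h x λ { refl → All.lookup x∉ a∈ refl }) (∏-replace u a∈ f g h)) (sym (ℚ.*-assoc (g x) (∏ xs g) (f a))))

∏-1- : ∀ {A : Set} (xs : List A) (f : A → ℚ) → (∀ x → 0ℚ ≤ f x) → (∀ x → f x ≤ 1ℚ) → 1ℚ - ∑ xs f ≤ ∏ xs (λ x → 1ℚ - f x)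
∏-1- []       f p q = ℚ.≤-refl
∏-1- (x ∷ xs) f p q = ℚ.≤-trans (≤-by _ (0≤* (p x) (0≤∑ xs p)) (eq (f x) (∑ xs f))) (*-monoˡ (≤⇒0≤- (q x)) (∏-1- xs f p q))
  where
  eq : ∀ a s → (1ℚ - a) * (1ℚ - s) ≡ (1ℚ - (a + s)) + a * s
  eq = solve-∀ ℚ-ring

∏-1+ : ∀ {A : Set} (xs : List A) (f : A → ℚ) → (∀ x → 0ℚ ≤ f x) → 1ℚ + ∑ xs f ≤ ∏ xs (λ x → 1ℚ + f x)
∏-1+ []       f p = ℚ.≤-refl
∏-1+ (x ∷ xs) f p = ℚ.≤-trans (≤-by _ (0≤* (p x) (0≤∑ xs p)) (eq (f x) (∑ xs f))) (*-monoˡ (0≤+ 0≤1 (p x)) (∏-1+ xs f p))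
  where
  eq : ∀ a s → (1ℚ + a) * (1ℚ + s) ≡ (1ℚ + (a + s)) + a * s
  eq = solve-∀ ℚ-ring

-- After t steps the law started at x₀ is dominated by the product of the weights aₜ [y_v = x₀_v] + θₜ / |L(v)|,
-- where aₜ decays and θₜ stays bounded.
module WarmStart {n : ℕ} (G : Graph n) (L : ListAssignment n) (S : Enumeration G L) (deg+2 : IsDegPlus2 G L)
                 (0<n : 0 ℕ.< n) (x₀ : Fin (Enumeration.size S)) where
  open Enumeration S
  open Averages G L S
  open Vertices G L S
  open Dynamics G L S deg+2 0<n

  kept : Fin n → State → ℚ
  kept v y = col y v (st x₀ v)

  factor : ℚ → ℚ → Fin n → State → ℚ
  factor a θ v y = a * kept v y + θ * recip (len v)

  Θ : ℚ → ℚ → State → ℚ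
  Θ a θ y = ∏ V λ v → factor a θ v y

  0<recip-len : ∀ v → 0ℚ < recip (len v)
  0<recip-len v = 0<recip (0<len v x₀)

  -- The pick probability times half the acceptance bound `β`. The halving ensures that `ε * ι n` is
  -- at most ½, as `product-bound` needs.
  ε : ℚ
  ε = recip (ι n) * recip (ι n + 1ℚ)

  0≤ε : 0ℚ ≤ ε
  0≤ε = 0≤* (0≤recip 0<ιn) (0≤recip 0<n+1)

  1≤ιn : 1ℚ ≤ ι n
  1≤ιn = ι-mono 0<n

  recip-n+1≤½ : recip (ι n + 1ℚ) ≤ ½
  recip-n+1≤½ = ℚ.≤-trans (recip-anti 0<2 (ℚ.+-monoˡ-≤ 1ℚ 1≤ιn)) (ℚ.≤-reflexive (sym (recip-unique 0<2 refl)))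

  ε*n : ε * ι n ≡ recip (ι n + 1ℚ)
  ε*n = trans (eq (recip (ι n)) (recip (ι n + 1ℚ)) (ι n)) (trans (cong (_* recip (ι n + 1ℚ)) (*-recip 0<ιn)) (ℚ.*-identityˡ _))
    where
    eq : ∀ a b n → a * b * n ≡ (n * a) * b
    eq = solve-∀ ℚ-ring

  module _ {a θ : ℚ} (0≤a : 0ℚ ≤ a) (0<θ : 0ℚ < θ) (y : State) where
    private
      F : Fin n → ℚ
      F v = factor a θ v y

      0<F : ∀ v → 0ℚ < F v
      0<F v = ℚ.+-mono-≤-< {0ℚ} {a * kept v y} (0≤* 0≤a (0≤col y v (st x₀ v))) (0<* 0<θ (0<recip-len v))

      -- The share of the factor at `v` that stems from the starting colour.
      ρ : Fin n → ℚ
      ρ v = a * kept v y * recip (F v)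

      1-ρ : ∀ v → 1ℚ - ρ v ≡ θ * recip (len v) * recip (F v)
      1-ρ v = trans (cong (_- ρ v) (sym (*-recip (0<F v)))) (eq (a * kept v y) (θ * recip (len v)) (recip (F v)))
        where
        eq : ∀ p q r → (p + q) * r - p * r ≡ q * r
        eq = solve-∀ ℚ-ring

      0≤ρ : ∀ v → 0ℚ ≤ ρ v
      0≤ρ v = 0≤* (0≤* 0≤a (0≤col y v (st x₀ v))) (0≤recip (0<F v))

      0≤1-ρ : ∀ v → 0ℚ ≤ 1ℚ - ρ v
      0≤1-ρ v = subst (0ℚ ≤_) (sym (1-ρ v)) (0≤* (ℚ.<⇒≤ (0<* 0<θ (0<recip-len v))) (0≤recip (0<F v)))

      κ₀ κ₁ Σρ : ℚ
      κ₀ = a * recip θ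
      κ₁ = κ₀ * recip (ι n)
      Σρ = ∑ V ρ

      0≤κ₀ : 0ℚ ≤ κ₀
      0≤κ₀ = 0≤* 0≤a (0≤recip 0<θ)

      0≤κ₁ : 0ℚ ≤ κ₁
      0≤κ₁ = 0≤* 0≤κ₀ (0≤recip 0<ιn)

      ∑1-ρ : ∑ V (λ v → 1ℚ - ρ v) ≡ ι n - Σρ
      ∑1-ρ = trans (∑-- V _ _) (cong (_- Σρ) (trans (∑-1 V) (cong ι length-V)))

      Θ-swap : ∀ v z → y ~[ ❴ v ❵ ] z → Θ a θ z ≡ Θ a θ y * recip (F v) * factor a θ v z
      Θ-swap v z r = *-cancelˡ-≡ (0<F v) (trans (ℚ.*-comm (F v) (Θ a θ z)) (trans
        (∏-replace (Unique.allFin⁺ n) (∈-allFin v) (λ u → factor a θ u z) F λ u ne → cong (λ c → a * 𝟙 (c ℕ.≟ st x₀ u) + θ * recip (len u)) (sym (r u (≢⇒❴❵ ne))))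
        (sym (trans (eq (F v) (Θ a θ y) (recip (F v)) (factor a θ v z)) (trans (cong (_* (Θ a θ y * factor a θ v z)) (*-recip (0<F v))) (ℚ.*-identityˡ _))))))
        where
        eq : ∀ f t r g → f * (t * r * g) ≡ (f * r) * (t * g)
        eq = solve-∀ ℚ-ring

      ∑-factor : ∀ v → ∑ X (λ z → r ❴ v ❵ y z * factor a θ v z) ≤ a + N ❴ v ❵ y * (θ * recip (len v))
      ∑-factor v = ℚ.≤-trans (ℚ.≤-reflexive (trans (∑-cong X λ z → eq (r ❴ v ❵ y z) a (kept v z) (θ * recip (len v))) (trans (∑-+ X _ _) (cong₂ _+_ (∑-*ˡ X a _) (∑-*ʳ X (θ * recip (len v)) _)))))
        (ℚ.+-monoˡ-≤ (N ❴ v ❵ y * (θ * recip (len v))) (ℚ.≤-trans (*-monoˡ 0≤a (ℚ.≤-trans (ℚ.≤-reflexive (j-sum v y (st x₀ v) (st-∈ x₀ v))) (𝟙≤1 (Free? y v (st x₀ v))))) (ℚ.≤-reflexive (ℚ.*-identityʳ a))))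
        where
        eq : ∀ r a c q → r * (a * c + q) ≡ a * (r * c) + r * q
        eq = solve-∀ ℚ-ring

      0≤Θ : 0ℚ ≤ Θ a θ y
      0≤Θ = 0≤∏ V λ v → ℚ.<⇒≤ (0<F v)

      -- Resampling erodes the share `ρ v`. At most one recolouring restores the starting colour,
      -- and its contribution `a` is measured against the flat share `1ℚ - ρ v`, where the list
      -- length cancels and `κ₀` is left.
      vertex-bound : ∀ v → recip (len v) * ((len v - N ❴ v ❵ y) * Θ a θ y + ∑ X (λ z → r ❴ v ❵ y z * Θ a θ z)) ≤
                     Θ a θ y * (1ℚ - recip (ι n + 1ℚ) * ρ v + κ₀ * (1ℚ - ρ v))
      vertex-bound v = begin
        recip (len v) * ((len v - N ❴ v ❵ y) * Θ a θ y + ∑ X (λ z → r ❴ v ❵ y z * Θ a θ z))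
          ≡⟨ cong (λ q → recip (len v) * ((len v - N ❴ v ❵ y) * Θ a θ y + q)) (trans (∑-cong X λ z → trans (r-mult ❴ v ❵ y z (Θ-swap v z)) (eq₁ (r ❴ v ❵ y z) (Θ a θ y) (recip (F v)) (factor a θ v z))) (∑-*ˡ X (Θ a θ y * recip (F v)) _)) ⟩
        recip (len v) * ((len v - N ❴ v ❵ y) * Θ a θ y + Θ a θ y * recip (F v) * ∑ X (λ z → r ❴ v ❵ y z * factor a θ v z))
          ≤⟨ *-monoˡ (ℚ.<⇒≤ (0<recip-len v)) (ℚ.+-monoʳ-≤ ((len v - N ❴ v ❵ y) * Θ a θ y) (*-monoˡ (0≤* 0≤Θ (0≤recip (0<F v))) (∑-factor v))) ⟩
        recip (len v) * ((len v - N ❴ v ❵ y) * Θ a θ y + Θ a θ y * recip (F v) * (a + N ❴ v ❵ y * (θ * recip (len v))))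
          ≡⟨ eq₂ (recip (len v)) (len v) (N ❴ v ❵ y) (Θ a θ y) (recip (F v)) a (θ * recip (len v)) ⟩
        Θ a θ y * ((len v * recip (len v) - rate v y) + (recip (len v) * recip (F v) * a + rate v y * (θ * recip (len v) * recip (F v))))
          ≡⟨ cong (Θ a θ y *_) (cong₂ _+_ (cong (_- rate v y) (*-recip (0<len v y))) (cong₂ _+_ jumped (cong (rate v y *_) (sym (1-ρ v))))) ⟩
        Θ a θ y * ((1ℚ - rate v y) + (κ₀ * (1ℚ - ρ v) + rate v y * (1ℚ - ρ v)))
          ≤⟨ *-monoˡ 0≤Θ (≤-by _ (0≤* (≤⇒0≤- slow) (0≤ρ v)) (eq₃ (rate v y) (ρ v) (recip (ι n + 1ℚ)) κ₀)) ⟩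
        Θ a θ y * (1ℚ - recip (ι n + 1ℚ) * ρ v + κ₀ * (1ℚ - ρ v)) ∎
        where
        open ℚ.≤-Reasoning
        eq₁ : ∀ r t f g → r * (t * f * g) ≡ t * f * (r * g)
        eq₁ = solve-∀ ℚ-ring
        eq₂ : ∀ i l N t f a q → i * ((l - N) * t + t * f * (a + N * q)) ≡ t * ((l * i - i * N) + (i * f * a + i * N * (q * f)))
        eq₂ = solve-∀ ℚ-ring
        eq₃ : ∀ w p m k → 1ℚ - m * p + k * (1ℚ - p) ≡ (1ℚ - w) + (k * (1ℚ - p) + w * (1ℚ - p)) + (w - m) * p
        eq₃ = solve-∀ ℚ-ring
        eq₄ : ∀ a t i l f → a * t * (i * l * f) ≡ l * f * a * (i * t)
        eq₄ = solve-∀ ℚ-ring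
        jumped : recip (len v) * recip (F v) * a ≡ κ₀ * (1ℚ - ρ v)
        jumped = sym (trans (cong (κ₀ *_) (1-ρ v)) (trans (eq₄ a (recip θ) θ (recip (len v)) (recip (F v)))
          (trans (cong (recip (len v) * recip (F v) * a *_) (*-recip 0<θ)) (ℚ.*-identityʳ _))))
        slow : recip (ι n + 1ℚ) ≤ rate v y
        slow = ℚ.≤-trans (≤-by _ (0≤recip 0<n+1) (eq₅ (recip (ι n + 1ℚ)))) (β≤rate v y)
          where
          eq₅ : ∀ a → 2ℚ * a ≡ a + a
          eq₅ = solve-∀ ℚ-ring

      -- The 2 in `τ` absorbs the cross term when the decay and growth factors are multiplied, as
      -- the decay is at most ½; `θ′` is `θ` times `1ℚ + τ`.
      a′ θ′ τ : ℚ
      a′ = (1ℚ - ε) * a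
      θ′ = θ + 2ℚ * recip (ι n) * a
      τ = 2ℚ * κ₁

      -- Weierstrass' product inequalities for the factors 1 - ε ρ and 1 + τ (1 - ρ).
      product-bound : 1ℚ - ε * Σρ + κ₁ * (ι n - Σρ) ≤ ∏ V (λ v → 1ℚ - ε * ρ v + τ * (1ℚ - ρ v))
      product-bound = begin
        1ℚ - ε * Σρ + κ₁ * (ι n - Σρ)
          ≤⟨ ≤-by _ (0≤* (0≤* (0≤* 0≤2 0≤κ₁) 0≤n-Σρ) (≤⇒0≤- εΣ≤½)) (eq (ε * Σρ) κ₁ (ι n - Σρ)) ⟩
        (1ℚ - ε * Σρ) * (1ℚ + τ * (ι n - Σρ))
          ≤⟨ *-mono (≤⇒0≤- (ℚ.≤-trans εΣ≤½ ½≤1)) decay (0≤+ 0≤1 (0≤* 0≤τ 0≤n-Σρ)) growth ⟩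
        ∏ V (λ v → 1ℚ - ε * ρ v) * ∏ V (λ v → 1ℚ + τ * (1ℚ - ρ v))
          ≡⟨ ∏-* V _ _ ⟨
        ∏ V (λ v → (1ℚ - ε * ρ v) * (1ℚ + τ * (1ℚ - ρ v)))
          ≤⟨ ∏-mono-∈ V (λ v → 0≤* (≤⇒0≤- (ερ≤1 v)) (0≤+ 0≤1 (0≤* 0≤τ (0≤1-ρ v)))) (λ v _ → ≤-by _ (0≤* (0≤* 0≤ε (0≤ρ v)) (0≤* 0≤τ (0≤1-ρ v))) (eq′ (ε * ρ v) (τ * (1ℚ - ρ v)))) ⟩
        ∏ V (λ v → 1ℚ - ε * ρ v + τ * (1ℚ - ρ v)) ∎
        where
        open ℚ.≤-Reasoning
        ½≤1 : ½ ≤ 1ℚ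
        ½≤1 = ≤-by ½ 0≤½ refl
        0≤τ : 0ℚ ≤ τ
        0≤τ = 0≤* 0≤2 0≤κ₁
        0≤n-Σρ : 0ℚ ≤ ι n - Σρ
        0≤n-Σρ = subst (0ℚ ≤_) ∑1-ρ (0≤∑ V 0≤1-ρ)
        εΣ≤½ : ε * Σρ ≤ ½
        εΣ≤½ = ℚ.≤-trans (*-monoˡ 0≤ε (0≤-⇒≤ 0≤n-Σρ)) (ℚ.≤-trans (ℚ.≤-reflexive ε*n) recip-n+1≤½)
        ε≤1 : ε ≤ 1ℚ
        ε≤1 = ℚ.≤-trans (ℚ.≤-reflexive (sym (ℚ.*-identityʳ ε))) (ℚ.≤-trans (*-monoˡ 0≤ε 1≤ιn) (ℚ.≤-trans (ℚ.≤-reflexive ε*n) (ℚ.≤-trans recip-n+1≤½ ½≤1)))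
        ερ≤1 : ∀ v → ε * ρ v ≤ 1ℚ
        ερ≤1 v = ℚ.≤-trans (*-mono 0≤ε ε≤1 (0≤ρ v) (0≤-⇒≤ (0≤1-ρ v))) (ℚ.≤-reflexive (ℚ.*-identityˡ 1ℚ))
        decay : 1ℚ - ε * Σρ ≤ ∏ V (λ v → 1ℚ - ε * ρ v)
        decay = ℚ.≤-trans (ℚ.≤-reflexive (cong (λ q → 1ℚ - q) (sym (∑-*ˡ V ε ρ)))) (∏-1- V (λ v → ε * ρ v) (λ v → 0≤* 0≤ε (0≤ρ v)) ερ≤1)
        growth : 1ℚ + τ * (ι n - Σρ) ≤ ∏ V (λ v → 1ℚ + τ * (1ℚ - ρ v))
        growth = ℚ.≤-trans (ℚ.≤-reflexive (cong (1ℚ +_) (trans (cong (τ *_) (sym ∑1-ρ)) (sym (∑-*ˡ V τ _))))) (∏-1+ V (λ v → τ * (1ℚ - ρ v)) (λ v → 0≤* 0≤τ (0≤1-ρ v)))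
        eq : ∀ e k d → (1ℚ - e) * (1ℚ + 2ℚ * k * d) ≡ (1ℚ - e + k * d) + 2ℚ * k * d * (½ - e)
        eq = solve-∀ ℚ-ring
        eq′ : ∀ e d → 1ℚ - e + d ≡ (1ℚ - e) * (1ℚ + d) + e * d
        eq′ = solve-∀ ℚ-ring

      factor-step : ∀ v → factor a′ θ′ v y ≡ F v * (1ℚ - ε * ρ v + τ * (1ℚ - ρ v))
      factor-step v = sym (begin
        F v * (1ℚ - ε * ρ v + τ * (1ℚ - ρ v))
          ≡⟨ cong (λ q → F v * (1ℚ - ε * ρ v + τ * q)) (1-ρ v) ⟩
        F v * (1ℚ - ε * (a * kept v y * recip (F v)) + τ * (θ * recip (len v) * recip (F v)))
          ≡⟨ eq (F v) ε (a * kept v y) (recip (F v)) τ (θ * recip (len v)) ⟩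
        F v - F v * recip (F v) * (ε * (a * kept v y)) + F v * recip (F v) * (τ * (θ * recip (len v)))
          ≡⟨ cong (λ q → F v - q * (ε * (a * kept v y)) + q * (τ * (θ * recip (len v)))) (*-recip (0<F v)) ⟩
        F v - 1ℚ * (ε * (a * kept v y)) + 1ℚ * (2ℚ * (a * recip θ * recip (ι n)) * (θ * recip (len v)))
          ≡⟨ eq′ a (kept v y) θ (recip (len v)) ε (recip θ) (recip (ι n)) ⟩
        (1ℚ - ε) * a * kept v y + (θ + 2ℚ * recip (ι n) * a * (θ * recip θ)) * recip (len v)
          ≡⟨ cong (λ q → (1ℚ - ε) * a * kept v y + (θ + q) * recip (len v)) (trans (cong (2ℚ * recip (ι n) * a *_) (*-recip 0<θ)) (ℚ.*-identityʳ _)) ⟩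
        factor a′ θ′ v y ∎)
        where
        open ≡-Reasoning
        eq : ∀ f e p r t q → f * (1ℚ - e * (p * r) + t * (q * r)) ≡ f - f * r * (e * p) + f * r * (t * q)
        eq = solve-∀ ℚ-ring
        eq′ : ∀ a c h l e i m → (a * c + h * l) - 1ℚ * (e * (a * c)) + 1ℚ * (2ℚ * (a * i * m) * (h * l)) ≡ (1ℚ - e) * a * c + (h + 2ℚ * m * a * (h * i)) * l
        eq′ = solve-∀ ℚ-ring

    -- The mean over `v` of the changes of a single factor is at most the effect of changing all
    -- factors slightly, so the bound stays a product.
    Θ-step : M (Θ a θ) y ≤ Θ ((1ℚ - ε) * a) (θ + 2ℚ * recip (ι n) * a) y
    Θ-step = begin
      M (Θ a θ) y
        ≡⟨ M-apply (Θ a θ) y ⟩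
      recip (ι n) * ∑ V (λ v → recip (len v) * ((len v - N ❴ v ❵ y) * Θ a θ y + ∑ X (λ z → r ❴ v ❵ y z * Θ a θ z)))
        ≤⟨ *-monoˡ (0≤recip 0<ιn) (∑-mono V vertex-bound) ⟩
      recip (ι n) * ∑ V (λ v → Θ a θ y * (1ℚ - recip (ι n + 1ℚ) * ρ v + κ₀ * (1ℚ - ρ v)))
        ≡⟨ cong (recip (ι n) *_) (trans (∑-*ˡ V (Θ a θ y) _) (cong (Θ a θ y *_) (trans (∑-+ V _ _) (cong₂ _+_
             (trans (∑-- V _ _) (cong₂ _-_ (trans (∑-1 V) (cong ι length-V)) (∑-*ˡ V (recip (ι n + 1ℚ)) ρ))) (trans (∑-*ˡ V κ₀ _) (cong (κ₀ *_) ∑1-ρ)))))) ⟩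
      recip (ι n) * (Θ a θ y * (ι n - recip (ι n + 1ℚ) * Σρ + κ₀ * (ι n - Σρ)))
        ≡⟨ eq (recip (ι n)) (Θ a θ y) (ι n) (recip (ι n + 1ℚ)) Σρ κ₀ ⟩
      Θ a θ y * (ι n * recip (ι n) - ε * Σρ + κ₁ * (ι n - Σρ))
        ≡⟨ cong (λ q → Θ a θ y * (q - ε * Σρ + κ₁ * (ι n - Σρ))) (*-recip 0<ιn) ⟩
      Θ a θ y * (1ℚ - ε * Σρ + κ₁ * (ι n - Σρ))
        ≤⟨ *-monoˡ 0≤Θ product-bound ⟩
      Θ a θ y * ∏ V (λ v → 1ℚ - ε * ρ v + τ * (1ℚ - ρ v))
        ≡⟨ sym (trans (∏-cong-∈ V λ v _ → factor-step v) (∏-* V F _)) ⟩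
      Θ a′ θ′ y ∎
      where
      open ℚ.≤-Reasoning
      eq : ∀ i t n m s k → i * (t * (n - m * s + k * (n - s))) ≡ t * (n * i - i * m * s + k * i * (n - s))
      eq = solve-∀ ℚ-ring

  -- The increments `2ℚ * recip (ι n) * aₜ t` of `θₜ` form a geometric series of ratio `1ℚ - ε`, and
  -- this is its sum.
  B : ℚ
  B = 2ℚ * (ι n + 1ℚ)

  0≤B : 0ℚ ≤ B
  0≤B = 0≤* 0≤2 (ℚ.<⇒≤ 0<n+1)

  ε≤1 : ε ≤ 1ℚ
  ε≤1 = ℚ.≤-trans (ℚ.≤-reflexive (sym (ℚ.*-identityʳ ε))) (ℚ.≤-trans (*-monoˡ 0≤ε 1≤ιn) (ℚ.≤-trans (ℚ.≤-reflexive ε*n) (ℚ.≤-trans recip-n+1≤½ (≤-by ½ 0≤½ refl))))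

  aₜ θₜ : ℕ → ℚ
  aₜ t = (1ℚ - ε) ^^ t
  θₜ t = 1ℚ + B * (1ℚ - aₜ t)

  0≤aₜ : ∀ t → 0ℚ ≤ aₜ t
  0≤aₜ t = 0≤^^ t (≤⇒0≤- ε≤1)

  aₜ≤1 : ∀ t → aₜ t ≤ 1ℚ
  aₜ≤1 t = ^^-≤1 t (≤⇒0≤- ε≤1) (≤-by ε 0≤ε (eq ε))
    where
    eq : ∀ e → 1ℚ ≡ (1ℚ - e) + e
    eq = solve-∀ ℚ-ring

  θ-step : ∀ t → θₜ t + 2ℚ * recip (ι n) * aₜ t ≡ θₜ (suc t)
  θ-step t = trans (cong (λ q → θₜ t + q * aₜ t) (sym B*ε)) (eq B ε (aₜ t))
    where
    eq : ∀ b e a → 1ℚ + b * (1ℚ - a) + b * e * a ≡ 1ℚ + b * (1ℚ - (1ℚ - e) * a)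
    eq = solve-∀ ℚ-ring
    eq′ : ∀ m i r → 2ℚ * m * (i * r) ≡ 2ℚ * i * (m * r)
    eq′ = solve-∀ ℚ-ring
    B*ε : B * ε ≡ 2ℚ * recip (ι n)
    B*ε = trans (eq′ (ι n + 1ℚ) (recip (ι n)) (recip (ι n + 1ℚ))) (trans (cong (2ℚ * recip (ι n) *_) (*-recip 0<n+1)) (ℚ.*-identityʳ _))

  domination : ∀ t y → iterate t (same x₀) y ≤ Θ (aₜ t) (θₜ t) y
  domination zero y with x₀ Fin.≟ y
  ... | no _ = 0≤∏ V λ v → 0≤+ (0≤* 0≤1 (0≤col y v (st x₀ v))) (0≤* (0≤+ 0≤1 (0≤* 0≤B (≤⇒0≤- (ℚ.≤-refl {1ℚ})))) (ℚ.<⇒≤ (0<recip-len v)))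
  ... | yes refl = 1≤∏ V λ v → ≤-by _ (0≤* (0≤+ 0≤1 (0≤* 0≤B (≤⇒0≤- (ℚ.≤-refl {1ℚ})))) (ℚ.<⇒≤ (0<recip-len v)))
      (cong (λ q → 1ℚ * q + θₜ zero * recip (len v)) (𝟙-yes (st x₀ v ℕ.≟ st x₀ v) refl))
  domination (suc t) y = ℚ.≤-trans (M-mono (domination t) y) (ℚ.≤-trans (Θ-step (0≤aₜ t) 0<θₜ y)
    (ℚ.≤-reflexive (cong (λ q → Θ (aₜ (suc t)) q y) (θ-step t))))
    where
    0<θₜ : 0ℚ < θₜ t
    0<θₜ = ℚ.<-≤-trans 0<1 (≤-by _ (0≤* 0≤B (≤⇒0≤- (aₜ≤1 t))) refl)

  Θ-bound : ∀ t y → iterate t (same x₀) y ≤ Θ (aₜ t) (1ℚ + B) y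
  Θ-bound t y = ℚ.≤-trans (domination t y) (∏-mono-∈ V
    (λ v → 0≤+ (0≤* (0≤aₜ t) (0≤col y v (st x₀ v))) (0≤* (0≤+ 0≤1 (0≤* 0≤B (≤⇒0≤- (aₜ≤1 t)))) (ℚ.<⇒≤ (0<recip-len v))))
    (λ v _ → ℚ.+-monoʳ-≤ (aₜ t * kept v y) (*-monoʳ (ℚ.<⇒≤ (0<recip-len v)) (≤-by {a = θₜ t} _ (0≤* 0≤B (0≤aₜ t)) (eq B (aₜ t))))))
    where
    eq : ∀ b a → 1ℚ + b ≡ 1ℚ + b * (1ℚ - a) + b * a
    eq = solve-∀ ℚ-ring

-- From the Poincaré inequality to total variation

∑-filter : ∀ {A : Set} {Q : A → Set} (Q? : ∀ x → Dec (Q x)) (xs : List A) {f : A → ℚ} → (∀ x → 0ℚ ≤ f x) →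
           ∑ (List.filter Q? xs) f ≤ ∑ xs f
∑-filter Q? []       h = ℚ.≤-refl
∑-filter Q? (x ∷ xs) {f} h with does (Q? x)
... | true  = ℚ.+-monoʳ-≤ (f x) (∑-filter Q? xs h)
... | false = ℚ.≤-trans (∑-filter Q? xs h) (≤-by (f x) (h x) (ℚ.+-comm (f x) (∑ xs f)))

∑-++ : ∀ {A : Set} (xs ys : List A) (f : A → ℚ) → ∑ (xs ++ ys) f ≡ ∑ xs f + ∑ ys f
∑-++ []       ys f = sym (ℚ.+-identityˡ (∑ ys f))
∑-++ (x ∷ xs) ys f = trans (cong (f x +_) (∑-++ xs ys f)) (sym (ℚ.+-assoc (f x) (∑ xs f) (∑ ys f)))

∑-concatMap : ∀ {A B : Set} (g : A → List B) (xs : List A) (f : B → ℚ) → ∑ (List.concatMap g xs) f ≡ ∑ xs (λ x → ∑ (g x) f)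
∑-concatMap g []       f = refl
∑-concatMap g (x ∷ xs) f = trans (∑-++ (g x) (List.concatMap g xs) f) (cong (∑ (g x) f +_) (∑-concatMap g xs f))

∑-map : ∀ {A B : Set} (g : A → B) (xs : List A) (f : B → ℚ) → ∑ (map g xs) f ≡ ∑ xs (f ∘ g)
∑-map g []       f = refl
∑-map g (x ∷ xs) f = cong (f (g x) +_) (∑-map g xs f)

∏-tabulate : ∀ {A : Set} {n} (g : Fin n → A) (f : A → ℚ) → ∏ (List.tabulate g) f ≡ ∏ (allFin n) (f ∘ g)
∏-tabulate {n = zero}  g f = refl
∏-tabulate {n = suc n} g f = cong (f (g zero) *_) (trans (∏-tabulate (g ∘ suc) f) (sym (∏-tabulate suc (f ∘ g))))

∑-choices : ∀ {n} (ls : Vec.Vec (List ℕ) n) (F : Fin n → ℕ → ℚ) →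
  ∑ (choices ls) (λ σ → ∏ (allFin n) λ v → F v (Vec.lookup σ v)) ≡ ∏ (allFin n) λ v → ∑ (Vec.lookup ls v) (F v)
∑-choices Vec.[] F = refl
∑-choices {suc n} (l Vec.∷ ls) F = begin
  ∑ (choices (l Vec.∷ ls)) (λ σ → ∏ (allFin (suc n)) λ v → F v (Vec.lookup σ v))
    ≡⟨ ∑-concatMap (λ c → map (c Vec.∷_) (choices ls)) l _ ⟩
  ∑ l (λ c → ∑ (map (c Vec.∷_) (choices ls)) (λ σ → ∏ (allFin (suc n)) λ v → F v (Vec.lookup σ v)))
    ≡⟨ ∑-cong l (λ c → trans (∑-map (c Vec.∷_) (choices ls) _) (trans (∑-cong (choices ls) λ σ → cong (F zero c *_) (∏-tabulate Fin.suc (λ v → F v (Vec.lookup (c Vec.∷ σ) v)))) (trans (∑-*ˡ (choices ls) (F zero c) _) (cong (F zero c *_) (∑-choices ls (F ∘ suc)))))) ⟩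
  ∑ l (λ c → F zero c * ∏ (allFin n) (λ v → ∑ (Vec.lookup ls v) (F (suc v))))
    ≡⟨ ∑-*ʳ l _ (F zero) ⟩
  ∑ l (F zero) * ∏ (allFin n) (λ v → ∑ (Vec.lookup ls v) (F (suc v)))
    ≡⟨ cong (∑ l (F zero) *_) (∏-tabulate suc (λ v → ∑ (Vec.lookup (l Vec.∷ ls) v) (F v))) ⟨
  ∏ (allFin (suc n)) (λ v → ∑ (Vec.lookup (l Vec.∷ ls) v) (F v)) ∎
  where open ≡-Reasoning

-- A mean value bound. The base `θ + 2ℚ` exceeds `a + θ` by at least 1, which absorbs the usual
-- factor `n`.
power-increment : ∀ {a θ} n → 0ℚ ≤ a → a ≤ 1ℚ → 0ℚ ≤ θ → (a + θ) ^^ n - θ ^^ n ≤ a * (θ + 2ℚ) ^^ n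
power-increment {a} {θ} zero p q r = ℚ.≤-trans (ℚ.≤-reflexive refl) (0≤* p 0≤1)
power-increment {a} {θ} (suc n) p q r = ℚ.≤-trans
  (ℚ.≤-reflexive (eq a θ ((a + θ) ^^ n) (θ ^^ n)))
  (ℚ.≤-trans (ℚ.+-mono-≤ (*-monoˡ (0≤+ p r) (power-increment n p q r)) (*-monoˡ p (^^-mono n r (≤-by 2ℚ 0≤2 refl))))
  (≤-by _ (0≤* (0≤* p (0≤^^ n (0≤+ r 0≤2))) (≤⇒0≤- q)) (eq′ a θ ((θ + 2ℚ) ^^ n))))
  where
  eq : ∀ a t x y → (a + t) * x - t * y ≡ (a + t) * (x - y) + a * y
  eq = solve-∀ ℚ-ring
  eq′ : ∀ a t z → a * ((t + 2ℚ) * z) ≡ (a + t) * (a * z) + a * z + a * z * (1ℚ - a)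
  eq′ = solve-∀ ℚ-ring

-- By Bernoulli's inequality `(1ℚ + x) ^^ m` is at least 2, and its product with the left-hand side
-- is at most 1.
halving : ∀ {x} m → 0ℚ ≤ x → x ≤ 1ℚ → 1ℚ ≤ ι m * x → (1ℚ - x) ^^ m ≤ ½
halving {x} m p q h = *-cancelˡ 0<2 (begin
  2ℚ * (1ℚ - x) ^^ m               ≡⟨ ℚ.*-comm 2ℚ ((1ℚ - x) ^^ m) ⟩
  (1ℚ - x) ^^ m * 2ℚ               ≤⟨ *-monoˡ (0≤^^ m (≤⇒0≤- q)) (ℚ.≤-trans (ℚ.+-monoʳ-≤ 1ℚ h) (bernoulli m p)) ⟩
  (1ℚ - x) ^^ m * (1ℚ + x) ^^ m    ≡⟨ ^^-*-distrib (1ℚ - x) (1ℚ + x) m ⟨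
  ((1ℚ - x) * (1ℚ + x)) ^^ m       ≤⟨ ^^-≤1 m (0≤* (≤⇒0≤- q) (0≤+ 0≤1 p)) (≤-by (x * x) (0≤sq x) (eq x)) ⟩
  1ℚ                               ≡⟨⟩
  2ℚ * ½                           ∎)
  where
  open ℚ.≤-Reasoning
  eq : ∀ x → 1ℚ ≡ (1ℚ - x) * (1ℚ + x) + x * x
  eq = solve-∀ ℚ-ring

halving-^ : ∀ {x} m q → 0ℚ ≤ x → x ≤ 1ℚ → 1ℚ ≤ ι m * x → (1ℚ - x) ^^ (m ℕ.* q) ≤ ½ ^^ q
halving-^ {x} m q p r h = ℚ.≤-trans (ℚ.≤-reflexive (sym (^^-^^ (1ℚ - x) m q))) (^^-mono q (0≤^^ m (≤⇒0≤- r)) (halving m p r h))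

module Mixing {n : ℕ} (G : Graph n) (L : ListAssignment n) (deg+2 : IsDegPlus2 G L) (0<n : 0 ℕ.< n) where
  open Concrete G L
  open Link deg+2 0<n
  open Averages G L enumeration
  open Vertices G L enumeration
  open Dynamics G L enumeration deg+2 0<n

  ¼ : ℚ
  ¼ = ℤ.+ 1 ℚ./ 4

  sq-∣∣ : ∀ u → ∣ u ∣ * ∣ u ∣ ≡ u * u
  sq-∣∣ u = trans (sym (ℚ.∣p*q∣≡∣p∣*∣q∣ u u)) (ℚ.0≤p⇒∣p∣≡p (0≤sq u))

  0<total : State → 0ℚ < total
  0<total x = subst (0ℚ <_) (N-⊤ x) (0<N ⊤ x)

  -- Cauchy-Schwarz costs a factor `total`, the number of states, which depends on the lists;
  -- `total*cap` later cancels it.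
  deviation : ∀ f → sq (∑ X λ y → ∣ f y - recip total * ∑ X f ∣) ≤ total * E ⊤ f
  deviation f = begin
    sq (∑ X λ y → ∣ u y ∣)                    ≡⟨ cong sq (∑-cong X λ y → sym (ℚ.*-identityˡ ∣ u y ∣)) ⟩
    sq (∑ X λ y → 1ℚ * ∣ u y ∣)               ≤⟨ cauchy-schwarz X (λ _ → 1ℚ) (λ y → ∣ u y ∣) (λ _ → 0≤1) ⟩
    ∑ X (λ _ → 1ℚ) * ∑ X (λ y → 1ℚ * sq ∣ u y ∣) ≡⟨ cong₂ _*_ (trans (∑-1 X) (cong ι (length-tabulate {n = length (Ω G L)} id)))
                                                     (∑-cong X λ y → trans (ℚ.*-identityˡ (sq ∣ u y ∣)) (sq-∣∣ (u y))) ⟩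
    total * ⟨ u , u ⟩                          ≡⟨ cong (total *_) (trans (⟨⟩-cong u≡ u≡) (sym (E-residual ⊤ f))) ⟩
    total * E ⊤ f                              ∎
    where
    open ℚ.≤-Reasoning
    u : State → ℚ
    u y = f y - recip total * ∑ X f
    u≡ : ∀ y → u y ≡ f y - A ⊤ f y
    u≡ y = cong (λ q → f y - q) (sym (A-⊤ f y))

  ∑-same : ∀ x → ∑ X (same x) ≡ 1ℚ
  ∑-same x = trans (∑-cong X λ y → sym (ℚ.*-identityʳ (same x y))) (same-sum x (λ _ → 1ℚ))

  ≤½⇒dTV : ∀ t x → ∑ X (λ y → ∣ iterate t (same x) y - recip total ∣) ≤ ½ → Defs.dTV G L t (colouring x) ≤ ¼
  ≤½⇒dTV t x h = ℚ.≤-trans (ℚ.≤-reflexive (dTV-iterate t x)) (*-monoˡ 0≤½ h)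

  mixed-if-flat : ∀ t → (∀ x → E ⊤ (iterate t (same x)) ≤ 0ℚ) → MixedAt G L t
  mixed-if-flat t flat σ σ-ok with index {σ} σ-ok
  ... | x , refl = ≤½⇒dTV t x (ℚ.≤-trans (sq-mono⁻¹ ℚ.≤-refl (subst (λ m → sq (∑ X λ y → ∣ iterate t (same x) y - m ∣) ≤ 0ℚ * 0ℚ)
        (trans (cong (recip total *_) (trans (∑-iterate t (same x)) (∑-same x))) (ℚ.*-identityʳ (recip total)))
        (ℚ.≤-trans (deviation (iterate t (same x))) (ℚ.≤-trans (*-monoˡ (ℚ.<⇒≤ (0<total x)) (flat x)) (ℚ.≤-reflexive (ℚ.*-zeroʳ total)))))) 0≤½)

  module _ {C : ℚ} (1≤C : 1ℚ ≤ C) (gap : ∀ f → E ⊤ f ≤ C * ∑ V λ v → E ❴ v ❵ f) where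
    open Contraction 1≤C gap

    module _ (x₀ : State) (T t : ℕ) where
      open WarmStart G L enumeration deg+2 0<n x₀

      top-θ : ℚ
      top-θ = 1ℚ + B

      0≤top : 0ℚ ≤ top-θ
      0≤top = 0≤+ 0≤1 0≤B

      -- The value of `Θ` at `a = 0`: `top-θ ^^ n` times the uniform law on all choices from the
      -- lists, proper or not.
      cap : ℚ
      cap = ∏ V λ v → top-θ * recip (len v)

      0≤cap : 0ℚ ≤ cap
      0≤cap = 0≤∏ V λ v → 0≤* 0≤top (ℚ.<⇒≤ (0<recip-len v))

      private
        a = aₜ T

        weights : Fin n → ℕ → ℚ
        weights v c = a * 𝟙 (c ℕ.≟ st x₀ v) + top-θ * recip (len v)
          where open Enumeration enumeration using (st)

        flat : ∀ v → ∑ (colours L v) (λ _ → top-θ * recip (len v)) ≡ top-θ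
        flat v = trans (∑-const (colours L v) _) (trans (eq (len v) top-θ (recip (len v))) (trans (cong (top-θ *_) (*-recip (0<len v x₀))) (ℚ.*-identityʳ top-θ)))
          where
          eq : ∀ l t r → l * (t * r) ≡ t * (l * r)
          eq = solve-∀ ℚ-ring

        sum-weights : ∀ v → ∑ (colours L v) (weights v) ≡ a + top-θ
        sum-weights v = trans (∑-+ (colours L v) _ _) (cong₂ _+_
          (trans (∑-*ˡ (colours L v) a _) (trans (cong (a *_) (trans (∑-cong (colours L v) λ c → 𝟙-⇔ (c ℕ.≟ _) (_ ℕ.≟ c) sym sym) (col-sum x₀ v))) (ℚ.*-identityʳ a)))
          (flat v))

        over-choices : (F : Fin n → ℕ → ℚ) → ∑ (choices (Vec.tabulate (colours L))) (λ σ → ∏ V λ v → F v (Vec.lookup σ v)) ≡ ∏ V (λ v → ∑ (colours L v) (F v))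
        over-choices F = trans (∑-choices (Vec.tabulate (colours L)) F) (∏-cong-∈ V λ v _ → cong (λ l → ∑ l (F v)) (lookup∘tabulate (colours L) v))

        ∑caps : ∑ (choices (Vec.tabulate (colours L))) (λ _ → cap) ≡ top-θ ^^ n
        ∑caps = trans (over-choices λ v _ → top-θ * recip (len v)) (trans (∏-cong-∈ V λ v _ → flat v) (trans (∏-const V top-θ) (cong (top-θ ^^_) length-V)))

        total*cap : total * cap ≤ top-θ ^^ n
        total*cap = ℚ.≤-trans (ℚ.≤-reflexive (sym (∑-const (Ω G L) cap))) (ℚ.≤-trans (∑-filter (proper? G) (choices (Vec.tabulate (colours L))) λ _ → 0≤cap) (ℚ.≤-reflexive ∑caps))

        -- The summand is nonnegative, so the sum may be extended to all choices from the lists,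
        -- where both products factorise over the vertices and the list lengths cancel.
        excess : ∑ X (λ y → Θ a top-θ y - cap) ≤ (a + top-θ) ^^ n - top-θ ^^ n
        excess = ℚ.≤-trans (ℚ.≤-reflexive (sym (∑-index (Ω G L) (λ σ → (∏ V λ v → weights v (Vec.lookup σ v)) - cap))))
          (ℚ.≤-trans (∑-filter (proper? G) (choices (Vec.tabulate (colours L))) λ σ → ≤⇒0≤- (∏-mono-∈ V (λ v → 0≤* 0≤top (ℚ.<⇒≤ (0<recip-len v))) λ v _ →
              ≤-by _ (0≤* (0≤aₜ T) (0≤𝟙 (Vec.lookup σ v ℕ.≟ _))) (ℚ.+-comm (a * _) (top-θ * recip (len v)))))
          (ℚ.≤-reflexive (trans (∑-- (choices (Vec.tabulate (colours L))) _ _) (cong₂ _-_ (trans (over-choices weights)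
            (trans (∏-cong-∈ V λ v _ → sum-weights v) (trans (∏-const V (a + top-θ)) (cong ((a + top-θ) ^^_) length-V)))) ∑caps))))

        -- The law after `T` steps is truncated at `cap`. The part `g` has bounded density and is
        -- contracted in the quadratic norm; of the rest `r⁺` only its small mass matters, which the
        -- chain preserves.
        f g r⁺ : State → ℚ
        f = iterate T (same x₀)
        g y = f y ℚ.⊓ cap
        r⁺ y = f y - g y

        0≤f : ∀ y → 0ℚ ≤ f y
        0≤f = 0≤iterate T λ y → 0≤𝟙 (x₀ Fin.≟ y)

        0≤g : ∀ y → 0ℚ ≤ g y
        0≤g y = ℚ.⊓-glb (0≤f y) 0≤cap

        0≤r⁺ : ∀ y → 0ℚ ≤ r⁺ y
        0≤r⁺ y = ≤⇒0≤- (ℚ.p⊓q≤p (f y) cap)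

        r⁺≤ : ∀ y → r⁺ y ≤ Θ a top-θ y - cap
        r⁺≤ y = go (ℚ.≤-total (f y) cap)
          where
          cap≤Θ : cap ≤ Θ a top-θ y
          cap≤Θ = ∏-mono-∈ V (λ v → 0≤* 0≤top (ℚ.<⇒≤ (0<recip-len v))) λ v _ → ≤-by _ (0≤* (0≤aₜ T) (0≤col y v _)) (ℚ.+-comm (a * kept v y) (top-θ * recip (len v)))
          go : f y ≤ cap ⊎ cap ≤ f y → r⁺ y ≤ Θ a top-θ y - cap
          go (inj₁ p) = ℚ.≤-trans (ℚ.≤-reflexive (trans (cong (λ q → f y - q) (ℚ.p≤q⇒p⊓q≡p p)) (ℚ.+-inverseʳ (f y)))) (≤⇒0≤- cap≤Θ)
          go (inj₂ p) = ℚ.≤-trans (ℚ.≤-reflexive (cong (λ q → f y - q) (ℚ.p≥q⇒p⊓q≡q p))) (ℚ.+-monoˡ-≤ (- cap) (Θ-bound T y))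

        ∑f : ∑ X f ≡ 1ℚ
        ∑f = trans (∑-iterate T (same x₀)) (∑-same x₀)

        ∑g≤1 : ∑ X g ≤ 1ℚ
        ∑g≤1 = ℚ.≤-trans (∑-mono X λ y → ℚ.p⊓q≤p (f y) cap) (ℚ.≤-reflexive ∑f)

      module _ (γ≤1 : γ ≤ 1ℚ) (warm : (aₜ T + top-θ) ^^ n - top-θ ^^ n ≤ ½ * ½ * ½)
               (cold : (1ℚ - γ) ^^ t * top-θ ^^ n ≤ ½ * ½ * (½ * ½)) where
        private
          ∑r⁺ : ∑ X r⁺ ≤ ½ * ½ * ½
          ∑r⁺ = ℚ.≤-trans (∑-mono X r⁺≤) (ℚ.≤-trans excess warm)

          mean : ℚ
          mean = recip total * ∑ X g

          G⁺ R⁺ : State → ℚ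
          G⁺ = iterate t g
          R⁺ = iterate t r⁺

          -- The quadratic norm of `g` is at most its maximum `cap` times its mass, so `total` meets
          -- `cap` and the size of the state space drops out.
          variance-bound : total * E ⊤ G⁺ ≤ ½ * ½ * (½ * ½)
          variance-bound = begin
            total * E ⊤ G⁺                              ≤⟨ *-monoˡ (ℚ.<⇒≤ (0<total x₀)) (iterate-contract γ≤1 t g) ⟩
            total * ((1ℚ - γ) ^^ t * E ⊤ g)             ≤⟨ *-monoˡ (ℚ.<⇒≤ (0<total x₀)) (*-monoˡ (0≤^^ t (≤⇒0≤- γ≤1)) (ℚ.≤-trans (E≤norm ⊤ g) norm)) ⟩
            total * ((1ℚ - γ) ^^ t * cap)               ≡⟨ eq total ((1ℚ - γ) ^^ t) cap ⟩
            (1ℚ - γ) ^^ t * (total * cap)               ≤⟨ *-monoˡ (0≤^^ t (≤⇒0≤- γ≤1)) total*cap ⟩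
            (1ℚ - γ) ^^ t * top-θ ^^ n                  ≤⟨ cold ⟩
            ½ * ½ * (½ * ½)                             ∎
            where
            open ℚ.≤-Reasoning
            eq : ∀ a b c → a * (b * c) ≡ b * (a * c)
            eq = solve-∀ ℚ-ring
            norm : ⟨ g , g ⟩ ≤ cap
            norm = ℚ.≤-trans (∑-mono X λ y → *-monoʳ (0≤g y) (ℚ.p⊓q≤q (f y) cap)) (ℚ.≤-trans (ℚ.≤-reflexive (∑-*ˡ X cap g))
              (ℚ.≤-trans (*-monoˡ 0≤cap ∑g≤1) (ℚ.≤-reflexive (ℚ.*-identityʳ cap))))

          bulk : ∑ X (λ y → ∣ G⁺ y - mean ∣) ≤ ½ * ½
          bulk = sq-mono⁻¹ (0≤* 0≤½ 0≤½) (ℚ.≤-trans (subst (λ s → sq (∑ X λ y → ∣ G⁺ y - recip total * s ∣) ≤ total * E ⊤ G⁺) (∑-iterate t g) (deviation G⁺)) variance-bound)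

          split : ∀ y → iterate (t ℕ.+ T) (same x₀) y ≡ G⁺ y + R⁺ y
          split y = trans (iterate-assoc t T (same x₀) y) (trans (iterate-cong t (λ z → eq (f z) (g z)) y) (iterate-+ t g r⁺ y))
            where
            eq : ∀ a b → a ≡ b + (a - b)
            eq = solve-∀ ℚ-ring

          -- Truncation may have removed mass: the mean of `g` differs from `recip total` by the
          -- mean of `r⁺`, which gives the last term.
          triangle : ∀ y → ∣ iterate (t ℕ.+ T) (same x₀) y - recip total ∣ ≤ (∣ G⁺ y - mean ∣ + R⁺ y) + recip total * ∑ X r⁺
          triangle y = ℚ.≤-trans (ℚ.≤-reflexive (cong ∣_∣ (trans (cong (_- recip total) (split y)) regroup)))
            (ℚ.≤-trans (ℚ.∣p+q∣≤∣p∣+∣q∣ (G⁺ y - mean + R⁺ y) (- (recip total * ∑ X r⁺))) (ℚ.+-mono-≤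
              (ℚ.≤-trans (ℚ.∣p+q∣≤∣p∣+∣q∣ (G⁺ y - mean) (R⁺ y)) (ℚ.+-monoʳ-≤ ∣ G⁺ y - mean ∣ (ℚ.≤-reflexive (ℚ.0≤p⇒∣p∣≡p (0≤iterate t 0≤r⁺ y)))))
              (ℚ.≤-reflexive (trans (ℚ.∣-p∣≡∣p∣ (recip total * ∑ X r⁺)) (ℚ.0≤p⇒∣p∣≡p (0≤* (0≤recip (0<total x₀)) (0≤∑ X 0≤r⁺)))))))
            where
            eq : ∀ G R i s → G + R - i * (1ℚ) ≡ G - i * s + R + - (i * (1ℚ - s))
            eq = solve-∀ ℚ-ring
            regroup : G⁺ y + R⁺ y - recip total ≡ G⁺ y - mean + R⁺ y + - (recip total * ∑ X r⁺)
            regroup = trans (cong (λ q → G⁺ y + R⁺ y - q) (sym (ℚ.*-identityʳ (recip total)))) (trans (eq (G⁺ y) (R⁺ y) (recip total) (∑ X g))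
              (cong (λ q → G⁺ y - mean + R⁺ y + - (recip total * q)) (trans (cong (_- ∑ X g) (sym ∑f)) (sym (∑-- X f g)))))

        mixed-from : Defs.dTV G L (t ℕ.+ T) (colouring x₀) ≤ ¼
        mixed-from = ≤½⇒dTV (t ℕ.+ T) x₀ (begin
          ∑ X (λ y → ∣ iterate (t ℕ.+ T) (same x₀) y - recip total ∣)
            ≤⟨ ∑-mono X triangle ⟩
          ∑ X (λ y → (∣ G⁺ y - mean ∣ + R⁺ y) + recip total * ∑ X r⁺)
            ≡⟨ trans (∑-+ X _ _) (cong₂ _+_ (∑-+ X _ _) (trans (∑-const X (recip total * ∑ X r⁺)) (trans (cong (λ m → ι m * (recip total * ∑ X r⁺)) (length-tabulate {n = length (Ω G L)} id))
                 (trans (sym (ℚ.*-assoc total (recip total) (∑ X r⁺))) (trans (cong (_* ∑ X r⁺) (*-recip (0<total x₀))) (ℚ.*-identityˡ (∑ X r⁺))))))) ⟩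
          ∑ X (λ y → ∣ G⁺ y - mean ∣) + ∑ X R⁺ + ∑ X r⁺
            -- A quarter for the contracted part, an eighth for the remainder, and an eighth for the
            -- mass that `g` lacks.
            ≤⟨ ℚ.+-mono-≤ (ℚ.+-mono-≤ bulk (ℚ.≤-trans (ℚ.≤-reflexive (∑-iterate t r⁺)) ∑r⁺)) ∑r⁺ ⟩
          ½ * ½ + ½ * ½ * ½ + ½ * ½ * ½ ≡⟨⟩
          ½ ∎)
          where open ℚ.≤-Reasoning

-- Tree decompositions

size : ∀ {n} → Region n → ℕ
size {zero}  W = 0
size {suc n} W = (if W zero then 1 else 0) ℕ.+ size (W ∘ suc)

size-card : ∀ {n} (p : Subset.Subset n) → size (Vec.lookup p) ≡ Subset.∣ p ∣
size-card Vec.[]            = refl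
size-card (true  Vec.∷ p) = cong suc (size-card p)
size-card (false Vec.∷ p) = size-card p

size-mono : ∀ {n} (W W′ : Region n) → (∀ v → W v ≡ true → W′ v ≡ true) → size W ℕ.≤ size W′
size-mono {zero}  W W′ h = ℕ.z≤n
size-mono {suc n} W W′ h = ℕ.+-mono-≤ first (size-mono (W ∘ suc) (W′ ∘ suc) (h ∘ suc))
  where
  first : (if W zero then 1 else 0) ℕ.≤ (if W′ zero then 1 else 0)
  first with W zero in eq
  ... | false = ℕ.z≤n
  ... | true rewrite h zero eq = ℕ.≤-refl

size-∪ : ∀ {n} (W W′ : Region n) → size (λ v → W v ∨ W′ v) ℕ.≤ size W ℕ.+ size W′
size-∪ {zero} W W′ = ℕ.z≤n
size-∪ {suc n} W W′ = ℕ.≤-trans (ℕ.+-mono-≤ (first (W zero) (W′ zero)) (size-∪ (W ∘ suc) (W′ ∘ suc)))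
  (ℕ.≤-reflexive (interchange ℕ.+-commutativeSemigroup (if W zero then 1 else 0) (if W′ zero then 1 else 0) (size (W ∘ suc)) (size (W′ ∘ suc))))
  where
  first : ∀ a b → (if a ∨ b then 1 else 0) ℕ.≤ (if a then 1 else 0) ℕ.+ (if b then 1 else 0)
  first true  b     = ℕ.s≤s ℕ.z≤n
  first false true  = ℕ.≤-refl
  first false false = ℕ.≤-refl

size-split : ∀ {n} (W D : Region n) → size (λ v → W v ∧ D v) ℕ.+ size (λ v → W v ∧ not (D v)) ≡ size W
size-split {zero} W D = refl
size-split {suc n} W D = trans (interchange ℕ.+-commutativeSemigroup (if W zero ∧ D zero then 1 else 0) (size (λ v → W (suc v) ∧ D (suc v))) (if W zero ∧ not (D zero) then 1 else 0) (size (λ v → W (suc v) ∧ not (D (suc v)))))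
  (cong₂ ℕ._+_ (first (W zero) (D zero)) (size-split (W ∘ suc) (D ∘ suc)))
  where
  first : ∀ a b → (if a ∧ b then 1 else 0) ℕ.+ (if a ∧ not b then 1 else 0) ≡ (if a then 1 else 0)
  first true  true  = refl
  first true  false = refl
  first false _     = refl

size≤n : ∀ {n} (W : Region n) → size W ℕ.≤ n
size≤n {zero} W = ℕ.z≤n
size≤n {suc n} W with W zero
... | true  = ℕ.s≤s (size≤n (W ∘ suc))
... | false = ℕ.m≤n⇒m≤1+n (size≤n (W ∘ suc))

size-0 : ∀ {n} (W : Region n) → size W ≡ 0 → ∀ v → W v ≡ false
size-0 {suc n} W eq v with W zero in w
size-0 {suc n} W eq zero    | false = w
size-0 {suc n} W eq (suc v) | false = size-0 (W ∘ suc) eq v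

size<n : ∀ {n} (W : Region n) → size W ℕ.< n → ∃[ v ] W v ≡ false
size<n {suc n} W lt with W zero in w
... | false = zero , w
... | true  with size<n (W ∘ suc) (ℕ.s<s⁻¹ lt)
...   | v , p = suc v , p

size-empty : ∀ {n} (W : Region n) → (∀ v → W v ≡ false) → size W ≡ 0
size-empty {zero}  W h = refl
size-empty {suc n} W h rewrite h zero = size-empty (W ∘ suc) (h ∘ suc)

size-❴❵≤1 : ∀ {n} (s : Fin n) → size ❴ s ❵ ℕ.≤ 1
size-❴❵≤1 {suc n} zero = ℕ.s≤s (ℕ.≤-reflexive (size-empty (❴_❵ {suc n} zero ∘ suc) λ _ → refl))
size-❴❵≤1 {suc n} (suc s) = ℕ.≤-trans (size-mono (❴ suc s ❵ ∘ suc) ❴ s ❵ λ v p → dec-true (v Fin.≟ s) (Fin.suc-injective (❴❵-true {s = suc s} p))) (size-❴❵≤1 s)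

_∖_ : ∀ {n} → Region n → Fin n → Region n
(W ∖ s) v = W v ∧ not (❴ s ❵ v)

does-true : {Q : Set} (d : Dec Q) → does d ≡ true → Q
does-true (yes q) _ = q

∧-true : ∀ {a b} → a ∧ b ≡ true → a ≡ true × b ≡ true
∧-true {true} {true} refl = refl , refl

not-true : ∀ {a} → not a ≡ true → a ≡ false
not-true {false} refl = refl

not-false : ∀ {a} → a ≡ false → not a ≡ true
not-false refl = refl

≡false : ∀ {a} → ¬ a ≡ true → a ≡ false
≡false = Bool.¬-not

size-∖ : ∀ {n} (W : Region n) s → W s ≡ true → suc (size (W ∖ s)) ℕ.≤ size W
size-∖ {n} W s w = ℕ.≤-trans (ℕ.+-monoˡ-≤ (size (W ∖ s)) (pos (λ v → W v ∧ ❴ s ❵ v) s (cong₂ _∧_ w (dec-true (s Fin.≟ s) refl)))) (ℕ.≤-reflexive (size-split W ❴ s ❵))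
  where
  pos : ∀ {n} (D : Region n) s → D s ≡ true → 1 ℕ.≤ size D
  pos D zero    eq rewrite eq = ℕ.s≤s ℕ.z≤n
  pos D (suc s) eq = ℕ.≤-trans (pos (D ∘ suc) s eq) (ℕ.m≤n+m _ _)

largest : ∀ {n} {Q : Fin n → Set} → (∀ i → Dec (Q i)) → ∃ Q → ∃[ i ] (Q i × (∀ j → i Fin.< j → ¬ Q j))
largest {suc n} {Q} Q? (i , q) with Fin.any? (Q? ∘ suc)
... | yes e with largest (Q? ∘ suc) e
...   | i′ , q′ , max = suc i′ , q′ , λ { (suc j) (ℕ.s≤s lt) → max j lt }
largest {suc n} {Q} Q? (zero  , q) | no ¬e = zero , q , λ { (suc j) _ q′ → ¬e (j , q′) }
largest {suc n} {Q} Q? (suc i , q) | no ¬e = ⊥-elim (¬e (i , q))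

least : ∀ {n} {Q : Fin n → Set} → (∀ i → Dec (Q i)) → ∃ Q → ∃[ i ] (Q i × (∀ j → Q j → i Fin.≤ j))
least {suc n} {Q} Q? (i , q) with Q? zero
... | yes q₀ = zero , q₀ , λ _ _ → ℕ.z≤n
least {suc n} {Q} Q? (zero  , q) | no ¬q = ⊥-elim (¬q q)
least {suc n} {Q} Q? (suc i , q) | no ¬q with least (Q? ∘ suc) (i , q)
... | i′ , q′ , min = suc i′ , q′ , λ { zero q₀ → ⊥-elim (¬q q₀) ; (suc j) qj → ℕ.s≤s (min j qj) }

-- Closure properties of bounded tree depth.

module _ {n : ℕ} {G : Graph n} where
  -- Pointwise equal regions need not be equal; a union with the empty region carries the equation.
  TreeDepth-resp : ∀ {W W′ d} → (∀ v → W′ v ≡ W v) → TreeDepth G W d → TreeDepth G W′ d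
  TreeDepth-resp {W} h t = union t (empty {W = λ _ → false} λ _ → refl) (λ _ _ → refl) (λ _ _ _ ())
    λ v → trans (h v) (sym (Bool.∨-identityʳ (W v)))

  TreeDepth-suc : ∀ {W d} → TreeDepth G W d → TreeDepth G W (suc d)
  TreeDepth-suc (empty h)           = empty h
  TreeDepth-suc (union t t′ a b c)  = union (TreeDepth-suc t) (TreeDepth-suc t′) a b c
  TreeDepth-suc (root s t a b)      = root s (TreeDepth-suc t) a b

  TreeDepth-+ : ∀ e {W d} → TreeDepth G W d → TreeDepth G W (e ℕ.+ d)
  TreeDepth-+ zero t = t
  TreeDepth-+ (suc e) t = TreeDepth-suc (TreeDepth-+ e t)

  TreeDepth-grow : ∀ e {W₀ W d} → (∀ v → W₀ v ≡ true → W v ≡ true) → size (λ v → W v ∧ not (W₀ v)) ℕ.≤ e →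
                   TreeDepth G W₀ d → TreeDepth G W (e ℕ.+ d)
  TreeDepth-grow e {W₀} {W} {d} sub le t with Fin.any? (λ v → (W v ∧ not (W₀ v)) Bool.≟ true)
  ... | no ¬e = TreeDepth-+ e (TreeDepth-resp same t)
    where
    same : ∀ v → W v ≡ W₀ v
    same v with W₀ v in w₀
    ... | true = sub v w₀
    ... | false = ≡false λ w → ¬e (v , cong₂ _∧_ w (not-false w₀))
  TreeDepth-grow zero {W₀} {W} sub le t | yes (s , p) = ⊥-elim (true≢false p (size-0 _ (ℕ.n≤0⇒n≡0 le) s))
  TreeDepth-grow (suc e) {W₀} {W} {d} sub le t | yes (s , p) = subst (TreeDepth G W) (ℕ.+-suc e d)
    (TreeDepth-grow e {W₁} sub₁ (ℕ.≤-pred (ℕ.≤-trans (ℕ.s≤s (size-mono _ _ shrink)) (ℕ.≤-trans (size-∖ _ s p) le)))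
      (root s t (not-true (proj₂ (∧-true p))) λ _ → refl))
    where
    W₁ : Region n
    W₁ v = W₀ v ∨ ❴ s ❵ v
    sub₁ : ∀ v → W₁ v ≡ true → W v ≡ true
    sub₁ v q with W₀ v in w₀
    ... | true  = sub v w₀
    ... | false = subst (λ u → W u ≡ true) (sym (❴❵-true {s = s} q)) (proj₁ (∧-true p))
    shrink : ∀ v → W v ∧ not (W₁ v) ≡ true → ((λ v → W v ∧ not (W₀ v)) ∖ s) v ≡ true
    shrink v q with W v | W₀ v | ❴ s ❵ v
    ... | true | false | false = refl

  -- No edge of `W` joins different labels, so the classes can be joined one label at a time by
  -- unions, at no cost in depth. Connected components never have to be computed.
  TreeDepth-labels : ∀ {W d} (ℓ : Fin n → ℕ) →
    (∀ u v → W u ≡ true → W v ≡ true → adj G u v ≡ true → ℓ u ≡ ℓ v) →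
    (∀ a → TreeDepth G (λ v → W v ∧ does (ℓ v ℕ.≟ a)) d) → ∀ b → (∀ v → ℓ v ℕ.< b) → TreeDepth G W d
  TreeDepth-labels {W} {d} ℓ same cls b bound = TreeDepth-resp (λ v → sym (trans (cong (W v ∧_) (dec-true (ℓ v ℕ.<? b) (bound v))) (Bool.∧-identityʳ (W v)))) (below b)
    where
    below : ∀ b → TreeDepth G (λ v → W v ∧ does (ℓ v ℕ.<? b)) d
    below zero = empty λ v → trans (cong (W v ∧_) (dec-false (ℓ v ℕ.<? 0) λ ())) (Bool.∧-zeroʳ (W v))
    below (suc b) = union (below b) (cls b) disj none split
      where
      lt : ∀ {v} → W v ∧ does (ℓ v ℕ.<? b) ≡ true → ℓ v ℕ.< b
      lt {v} p = does-true (ℓ v ℕ.<? b) (proj₂ (∧-true {W v} p))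
      eq : ∀ {v} → W v ∧ does (ℓ v ℕ.≟ b) ≡ true → ℓ v ≡ b
      eq {v} p = does-true (ℓ v ℕ.≟ b) (proj₂ (∧-true {W v} p))
      disj : ∀ v → W v ∧ does (ℓ v ℕ.<? b) ≡ true → W v ∧ does (ℓ v ℕ.≟ b) ≡ false
      disj v p = ≡false λ q → ℕ.<-irrefl (eq q) (lt p)
      none : ∀ u v → W u ∧ does (ℓ u ℕ.<? b) ≡ true → W v ∧ does (ℓ v ℕ.≟ b) ≡ true → adj G u v ≡ false
      none u v p q = ≡false λ e → ℕ.<-irrefl (trans (same u v (proj₁ (∧-true p)) (proj₁ (∧-true q)) e) (eq q)) (lt p)
      split : ∀ v → W v ∧ does (ℓ v ℕ.<? suc b) ≡ (W v ∧ does (ℓ v ℕ.<? b)) ∨ (W v ∧ does (ℓ v ℕ.≟ b))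
      split v with W v
      ... | false = refl
      ... | true = go (ℕ.<-cmp (ℓ v) b)
        where
        go : Tri (ℓ v ℕ.< b) (ℓ v ≡ b) (b ℕ.< ℓ v) → does (ℓ v ℕ.<? suc b) ≡ does (ℓ v ℕ.<? b) ∨ does (ℓ v ℕ.≟ b)
        go (tri< a _ _) = trans (dec-true (ℓ v ℕ.<? suc b) (ℕ.m≤n⇒m≤1+n a)) (sym (cong (_∨ does (ℓ v ℕ.≟ b)) (dec-true (ℓ v ℕ.<? b) a)))
        go (tri≈ ¬a e _) = trans (dec-true (ℓ v ℕ.<? suc b) (ℕ.s≤s (ℕ.≤-reflexive e))) (sym (cong₂ _∨_ (dec-false (ℓ v ℕ.<? b) ¬a) (dec-true (ℓ v ℕ.≟ b) e)))
        go (tri> ¬a ¬e c) = trans (dec-false (ℓ v ℕ.<? suc b) (ℕ.<⇒≱ (ℕ.s≤s c))) (sym (cong₂ _∨_ (dec-false (ℓ v ℕ.<? b) ¬a) (dec-false (ℓ v ℕ.≟ b) ¬e)))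

-- Centroid bags.

module Decomposition {n : ℕ} {G : Graph n} (T : TreeDecomposition G) where

  Node : Set
  Node = Fin (suc (m T))

  In : Node → Region n
  In i v = Vec.lookup (bag T i) v

  ∈⇒In : ∀ {i v} → v Subset.∈ bag T i → In i v ≡ true
  ∈⇒In = []=⇒lookup

  In⇒∈ : ∀ {i v} → In i v ≡ true → v Subset.∈ bag T i
  In⇒∈ {i} {v} = lookup⇒[]= v (bag T i)

  -- `i` is the index or one of its ancestors.
  data Below (i : Node) : Node → Set where
    self : Below i i
    up   : ∀ {j} → j ≢ zero → Below i (parent T j) → Below i j

  Below⇒≤ : ∀ {i j} → Below i j → i Fin.≤ j
  Below⇒≤ self = ℕ.≤-refl
  Below⇒≤ (up {j} j≢0 b) = ℕ.≤-trans (Below⇒≤ b) (ℕ.<⇒≤ (parent< T j j≢0))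

  Below? : ∀ i j → Dec (Below i j)
  Below? i j = go j (Fin-<-wf j)
    where
    go : ∀ j → Acc Fin._<_ j → Dec (Below i j)
    go j (acc rec) with i Fin.≟ j
    ... | yes refl = yes self
    ... | no i≢j with j Fin.≟ zero
    ...   | yes refl = no λ { self → i≢j refl ; (up z _) → z refl }
    ...   | no j≢0 with go (parent T j) (rec (parent< T j j≢0))
    ...     | yes b = yes (up j≢0 b)
    ...     | no ¬b = no λ { self → i≢j refl ; (up _ b) → ¬b b }

  root-above : ∀ j → Below zero j
  root-above j = go j (Fin-<-wf j)
    where
    go : ∀ j → Acc Fin._<_ j → Below zero j
    go j (acc rec) with j Fin.≟ zero
    ... | yes refl = self
    ... | no j≢0 = up j≢0 (go (parent T j) (rec (parent< T j j≢0)))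

  module _ (i : Node) where
    -- `c` is the child of `i` whose branch contains `j`.
    Child : Node → Node → Set
    Child c j = c ≢ zero × parent T c ≡ i × Below c j

    Child? : ∀ j c → Dec (Child c j)
    Child? j c = ¬? (c Fin.≟ zero) ×-dec ((parent T c Fin.≟ i) ×-dec Below? c j)

    child-> : ∀ {c j} → Child c j → i Fin.< c
    child-> {c} (c≢0 , refl , _) = parent< T c c≢0

    child-unique : ∀ {c c′ j} → Child c j → Child c′ j → c ≡ c′
    child-unique (_ , _ , self) (_ , _ , self) = refl
    child-unique (_ , refl , self) ch@(_ , _ , up _ b) = ⊥-elim (ℕ.<⇒≱ (child-> ch) (Below⇒≤ b))
    child-unique ch@(_ , _ , up _ b) (_ , refl , self) = ⊥-elim (ℕ.<⇒≱ (child-> ch) (Below⇒≤ b))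
    child-unique (p , q , up _ b) (p′ , q′ , up _ b′) = child-unique (p , q , b) (p′ , q′ , b′)

    child-exists : ∀ {j} → Below i j → j ≢ i → ∃[ c ] Child c j
    child-exists self ne = ⊥-elim (ne refl)
    child-exists (up {j} j≢0 b) ne with parent T j Fin.≟ i
    ... | yes eq = j , j≢0 , eq , self
    ... | no ne′ with child-exists b ne′
    ...   | c , p , q , r = c , p , q , up j≢0 r

    child-edge : ∀ {c j j′} → j ≢ i → j′ ≢ i → TreeEdge T j j′ → Child c j → Child c j′
    child-edge ne ne′ (inj₂ (j′≢0 , refl)) (p , q , b) = p , q , up j′≢0 b
    child-edge ne ne′ (inj₁ (j≢0 , refl)) (p , q , self) = ⊥-elim (ne′ q)
    child-edge ne ne′ (inj₁ (j≢0 , refl)) (p , q , up _ b) = p , q , b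

    TreeEdge-sym : ∀ {j j′} → TreeEdge T j j′ → TreeEdge T j′ j
    TreeEdge-sym (inj₁ e) = inj₂ e
    TreeEdge-sym (inj₂ e) = inj₁ e

    -- 0 off the subtree of i, and otherwise the successor of the child of i above j.
    label : Node → ℕ
    label j with Fin.any? (Child? j)
    ... | yes (c , _) = suc (Fin.toℕ c)
    ... | no _        = 0

    label-edge : ∀ {j j′} → j ≢ i → j′ ≢ i → TreeEdge T j j′ → label j ≡ label j′
    label-edge {j} {j′} ne ne′ e with Fin.any? (Child? j) | Fin.any? (Child? j′)
    ... | yes (c , p) | yes (c′ , p′) = cong (suc ∘ Fin.toℕ) (child-unique (child-edge ne ne′ e p) p′)
    ... | yes (c , p) | no ¬p′ = ⊥-elim (¬p′ (c , child-edge ne ne′ e p))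
    ... | no ¬p | yes (c′ , p′) = ⊥-elim (¬p (c′ , child-edge ne′ ne (TreeEdge-sym e) p′))
    ... | no _ | no _ = refl

    -- The bags of a vertex outside bag `i` are linked by walks avoiding `i`, so they lie in one
    -- component of the tree without `i`.
    label-walk : ∀ {v a b} → In i v ≡ false → Walk (TreeEdge T) (λ l → v Subset.∈ bag T l) a b → label a ≡ label b
    label-walk out (here _) = refl
    label-walk {v} out (there {a} {b} s e w) = trans (label-edge (ne s) (ne (start w)) e) (label-walk out w)
      where
      ne : ∀ {l} → v Subset.∈ bag T l → l ≢ i
      ne s refl = true≢false (∈⇒In s) out
      start : ∀ {a b} → Walk (TreeEdge T) (λ l → v Subset.∈ bag T l) a b → v Subset.∈ bag T a
      start (here s)      = s
      start (there s _ _) = s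

    label-bound : ∀ j → label j ℕ.< suc (suc (m T))
    label-bound j with Fin.any? (Child? j)
    ... | yes (c , _) = ℕ.s≤s (Fin.toℕ<n c)
    ... | no _        = ℕ.s≤s ℕ.z≤n

    label-0 : ∀ {j} → label j ≡ 0 → j ≢ i → ¬ Below i j
    label-0 {j} eq ne b with Fin.any? (Child? j)
    label-0 {j} () ne b | yes _
    ... | no ¬e = ¬e (child-exists b ne)

    label-suc : ∀ {j a} → label j ≡ suc a → ∃[ c ] (Fin.toℕ c ≡ a × Child c j)
    label-suc {j} eq with Fin.any? (Child? j)
    ... | yes (c , p) = c , ℕ.suc-injective eq , p

  home : Fin n → Node
  home v = proj₁ (covers T v)

  module _ {w : ℕ} (width : ∀ i → Subset.∣ bag T i ∣ ℕ.≤ w) where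

    subtree : Region n → Node → Region n
    subtree W i v = W v ∧ does (Below? i (home v))

    heavy? : ∀ W i → Dec (size W ℕ.< 2 ℕ.* size (subtree W i))
    heavy? W i = size W ℕ.<? 2 ℕ.* size (subtree W i)

    -- The last node whose subtree holds more than half of W is a centroid.
    tree-depth : ∀ p W → size W ℕ.< 2 ℕ.^ p → TreeDepth G W (p ℕ.* w)
    tree-depth zero W lt = empty (size-0 W (ℕ.n<1⇒n≡0 lt))
    tree-depth (suc p) W lt with size W ℕ.≟ 0
    ... | yes eq = empty (size-0 W eq)
    ... | no ne with largest (heavy? W) (zero , heavy-root)
      where
      heavy-root : size W ℕ.< 2 ℕ.* size (subtree W zero)
      heavy-root = ℕ.<-≤-trans (ℕ.m<n+m (size W) (ℕ.n≢0⇒n>0 ne)) (ℕ.≤-trans (ℕ.≤-reflexive (cong (size W ℕ.+_) (sym (ℕ.+-identityʳ (size W)))))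
        (ℕ.*-monoʳ-≤ 2 (size-mono W _ λ v q → cong₂ _∧_ q (dec-true (Below? zero (home v)) (root-above (home v))))))
    ...   | i , heavy , light = TreeDepth-grow w {W₀} (λ v q → proj₁ (∧-true q)) bag-size (TreeDepth-labels (λ v → label i (home v)) same parts (suc (suc (m T))) λ v → label-bound i (home v))
      where
      W₀ : Region n
      W₀ v = W v ∧ not (In i v)
      bag-size : size (λ v → W v ∧ not (W₀ v)) ℕ.≤ w
      bag-size = ℕ.≤-trans (size-mono _ (In i) in-bag) (ℕ.≤-trans (ℕ.≤-reflexive (size-card (bag T i))) (width i))
        where
        in-bag : ∀ v → W v ∧ not (W₀ v) ≡ true → In i v ≡ true
        in-bag v q with W v | In i v
        ... | true | true = refl
      half : ∀ {x} → 2 ℕ.* x ℕ.≤ size W → x ℕ.< 2 ℕ.^ p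
      half {x} le = ℕ.*-cancelˡ-< 2 x (2 ℕ.^ p) (ℕ.≤-<-trans le lt)
      same : ∀ u v → W₀ u ≡ true → W₀ v ≡ true → adj G u v ≡ true → label i (home u) ≡ label i (home v)
      -- Both homes are linked to a common bag `l` by walks avoiding `i`.
      same u v p q e with edges T u v e
      ... | l , u∈ , v∈ = trans (label-walk i (not-true (proj₂ (∧-true p))) (connected T u (home u) l (proj₂ (covers T u)) u∈))
                          (sym (label-walk i (not-true (proj₂ (∧-true q))) (connected T v (home v) l (proj₂ (covers T v)) v∈)))
      at : ∀ {v a} → W₀ v ∧ does (label i (home v) ℕ.≟ a) ≡ true → label i (home v) ≡ a
      at {v} {a} q = does-true (label i (home v) ℕ.≟ a) (proj₂ (∧-true {W₀ v} q))
      parts : ∀ a → TreeDepth G (λ v → W₀ v ∧ does (label i (home v) ℕ.≟ a)) (p ℕ.* w)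
      parts zero = tree-depth p _ (half (ℕ.≤-trans (ℕ.*-monoʳ-≤ 2 (size-mono _ outside off)) few))
        where
        outside : Region n
        outside v = W v ∧ not (does (Below? i (home v)))
        off : ∀ v → W₀ v ∧ does (label i (home v) ℕ.≟ 0) ≡ true → outside v ≡ true
        off v q = cong₂ (λ a b → a ∧ not b) (proj₁ (∧-true (proj₁ (∧-true q)))) (dec-false (Below? i (home v)) (label-0 i (at {v} q)
          λ eq → true≢false (∈⇒In (subst (λ j → v Subset.∈ bag T j) eq (proj₂ (covers T v)))) (not-true (proj₂ (∧-true {W v} (proj₁ (∧-true q)))))))
        -- The subtree of `i` holds more than half of `W`, so at most half lies outside.
        few : 2 ℕ.* size outside ℕ.≤ size W
        few = ℕ.+-cancelˡ-≤ (size W) _ _ (ℕ.≤-trans (ℕ.+-monoˡ-≤ (2 ℕ.* size outside) (ℕ.<⇒≤ heavy))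
          (ℕ.≤-reflexive (trans (sym (ℕ.*-distribˡ-+ 2 (size (subtree W i)) (size outside))) (trans (cong (2 ℕ.*_) (size-split W (λ v → does (Below? i (home v))))) (cong (size W ℕ.+_) (ℕ.+-identityʳ (size W)))))))
      parts (suc a) with suc a ℕ.<? suc (suc (m T))
      ... | no ¬lt = empty λ v → ≡false λ q → ¬lt (subst (ℕ._< suc (suc (m T))) (at {v} q) (label-bound i (home v)))
      ... | yes (ℕ.s≤s a<) = tree-depth p _ small
        where
        c : Node
        c = Fin.fromℕ< a<
        small : size (λ v → W₀ v ∧ does (label i (home v) ℕ.≟ suc a)) ℕ.< 2 ℕ.^ p
        small with i Fin.<? c
        -- `c` comes after the last heavy node, so its subtree is light.
        ... | yes i<c = half (ℕ.≤-trans (ℕ.*-monoʳ-≤ 2 (size-mono _ (subtree W c) inside)) (ℕ.≮⇒≥ (light c i<c)))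
          where
          inside : ∀ v → W₀ v ∧ does (label i (home v) ℕ.≟ suc a) ≡ true → subtree W c v ≡ true
          inside v q with label-suc i (at {v} q)
          ... | c′ , eq , ch@(_ , _ , b) = cong₂ _∧_ (proj₁ (∧-true (proj₁ (∧-true q)))) (dec-true (Below? c (home v)) (subst (λ d → Below d (home v)) (sym c≡c′) b))
            where
            c≡c′ : c ≡ c′
            c≡c′ = Fin.toℕ-injective (trans (Fin.toℕ-fromℕ< a<) (sym eq))
        -- Children are numbered after `i`, so no vertex carries this label.
        ... | no i≮c = subst (ℕ._< 2 ℕ.^ p) (sym (size-empty _ λ v → ≡false λ q → out v q)) (ℕ.m^n>0 2 p)
          where
          out : ∀ v → W₀ v ∧ does (label i (home v) ℕ.≟ suc a) ≡ true → ⊥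
          out v q with label-suc i (at {v} q)
          ... | c′ , eq , ch = i≮c (subst (i Fin.<_) (Fin.toℕ-injective (trans eq (sym (Fin.toℕ-fromℕ< a<)))) (child-> i ch))

  -- A proper colouring with one colour more than the width.

  top-spec : ∀ v → ∃[ i ] (In i v ≡ true × (∀ j → In j v ≡ true → i Fin.≤ j))
  top-spec v = least (λ i → In i v Bool.≟ true) (home v , ∈⇒In (proj₂ (covers T v)))

  -- The bag of `v` nearest to the root, because parents have smaller numbers.
  top : Fin n → Node
  top v = proj₁ (top-spec v)

  private
    step-below : ∀ {t a b} → a ≢ t → Below t a → TreeEdge T a b → Below t b
    step-below a≢t self _ = ⊥-elim (a≢t refl)
    step-below a≢t (up _ b) (inj₁ (_ , refl)) = b
    step-below a≢t b@(up _ _) (inj₂ (b≢0 , refl)) = up b≢0 b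

    walk-start : ∀ {v a b} → Walk (TreeEdge T) (λ l → v Subset.∈ bag T l) a b → v Subset.∈ bag T a
    walk-start (here s)      = s
    walk-start (there s _ _) = s

    walk-below : ∀ {v t a b} → (∀ l → v Subset.∈ bag T l → t Fin.≤ l) → Below t a →
                 Walk (TreeEdge T) (λ l → v Subset.∈ bag T l) a b → Below t b
    walk-below min b (here _) = b
    walk-below {v} {t} min b (there {a} _ e w) with a Fin.≟ t
    ... | no a≢t = walk-below min (step-below a≢t b e) w
    ... | yes refl with e
    ...   | inj₁ (a≢0 , refl) = ⊥-elim (ℕ.<⇒≱ (parent< T a a≢0) (min _ (walk-start w)))
    ...   | inj₂ (b≢0 , refl) = walk-below min (up b≢0 b) w

    -- The subtree of `t` can be left only through `t`, and `t` is its only node with a number at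
    -- most that of `t`.
    walk-through : ∀ {v t a b} → Below t a → b Fin.≤ t → Walk (TreeEdge T) (λ l → v Subset.∈ bag T l) a b → v Subset.∈ bag T t
    walk-through {v} {t} b le (here s) = subst (λ l → v Subset.∈ bag T l) (Fin.≤-antisym le (Below⇒≤ b)) s
    walk-through {v} {t} b le (there {a} s e w) with a Fin.≟ t
    ... | yes refl = s
    ... | no a≢t = walk-through (step-below a≢t b e) le w

  -- A common bag of `u` and `v` lies below `top v`, as all bags of `v` do. The bags of `u` lead
  -- from there to `top u`, which is not numbered after `top v`, so they pass through `top v`.
  neighbour-in-top : ∀ {u v} → adj G u v ≡ true → top u Fin.≤ top v → In (top v) u ≡ true
  neighbour-in-top {u} {v} e le with edges T u v e | top-spec v | top-spec u
  ... | l , u∈ , v∈ | t , t-in , t-min | t′ , t′-in , _ = ∈⇒In (walk-through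
        (walk-below (λ j j∈ → t-min j (∈⇒In j∈)) self (connected T v t l (In⇒∈ t-in) v∈)) le (connected T u l t′ u∈ (In⇒∈ t′-in)))

  module _ {k : ℕ} (width : ∀ i → Subset.∣ bag T i ∣ ℕ.≤ suc k) where
    private
      image : ∀ {n} → Region n → (Fin n → Fin (suc k)) → Region (suc k)
      image {zero}  R f c = false
      image {suc n} R f c = (R zero ∧ ❴ f zero ❵ c) ∨ image (R ∘ suc) (f ∘ suc) c

      image-∈ : ∀ {n} (R : Region n) f u → R u ≡ true → image R f (f u) ≡ true
      image-∈ R f zero    p rewrite p | dec-true (f zero Fin.≟ f zero) refl = refl
      image-∈ R f (suc u) p = trans (cong ((R zero ∧ ❴ f zero ❵ (f (suc u))) ∨_) (image-∈ (R ∘ suc) (f ∘ suc) u p)) (Bool.∨-zeroʳ _)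

      image-size : ∀ {n} (R : Region n) f → size (image R f) ℕ.≤ size R
      image-size {zero} R f = ℕ.≤-reflexive (size-empty {suc k} (λ _ → false) λ _ → refl)
      image-size {suc n} R f = ℕ.≤-trans (size-∪ (λ c → R zero ∧ ❴ f zero ❵ c) (image (R ∘ suc) (f ∘ suc))) (ℕ.+-mono-≤ first (image-size (R ∘ suc) (f ∘ suc)))
        where
        first : size (λ c → R zero ∧ ❴ f zero ❵ c) ℕ.≤ (if R zero then 1 else 0)
        first with R zero
        ... | true  = size-❴❵≤1 (f zero)
        ... | false = ℕ.≤-reflexive (size-empty {suc k} (λ _ → false) λ _ → refl)

    -- Greedy colouring: the vertex with the last top node has its neighbours in one bag.
    greedy : ∀ e W → size W ℕ.≤ e → Σ (Fin n → Fin (suc k)) λ f → (∀ u v → W u ≡ true → W v ≡ true → adj G u v ≡ true → f u ≢ f v)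
    greedy e W le with Fin.any? (λ i → Fin.any? λ v → (W v Bool.≟ true) ×-dec (top v Fin.≟ i))
    ... | no ¬e = (λ _ → zero {n = k}) , λ u _ w → ⊥-elim (¬e (top u , u , w , refl))
    ... | yes ex with largest (λ i → Fin.any? λ v → (W v Bool.≟ true) ×-dec (top v Fin.≟ i)) ex
    greedy zero W le | yes ex | _ , (s , w , _) , _ = ⊥-elim (true≢false w (size-0 W (ℕ.n≤0⇒n≡0 le) s))
    greedy (suc e) W le | yes ex | _ , (s , w , refl) , max with greedy e (W ∖ s) (ℕ.≤-pred (ℕ.≤-trans (size-∖ W s w) le))
    ... | f , f-ok with size<n (image (In (top s) ∖ s) f)
                          (ℕ.≤-<-trans (image-size (In (top s) ∖ s) f) (ℕ.≤-trans (size-∖ (In (top s)) s (proj₁ (proj₂ (top-spec s))))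
                            (ℕ.≤-trans (ℕ.≤-reflexive (size-card (bag T (top s)))) (width (top s)))))
    ...   | c , fresh = g , g-ok
      where
      g : Fin n → Fin (suc k)
      g v = if ❴ s ❵ v then c else f v
      at : g s ≡ c
      at rewrite dec-true (s Fin.≟ s) refl = refl
      off : ∀ {v} → v ≢ s → g v ≡ f v
      off {v} p rewrite dec-false (v Fin.≟ s) p = refl
      new : ∀ u → W u ≡ true → u ≢ s → adj G u s ≡ true → f u ≢ c
      new u wu u≢s e refl = true≢false (image-∈ (In (top s) ∖ s) f u (cong₂ (λ a b → a ∧ not b)
        (neighbour-in-top e (ℕ.≮⇒≥ λ lt → max (top u) lt (u , wu , refl))) (≢⇒❴❵ u≢s))) fresh
      keep : ∀ {v} → v ≢ s → W v ≡ true → (W ∖ s) v ≡ true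
      keep v≢s wv = cong₂ (λ a b → a ∧ not b) wv (≢⇒❴❵ v≢s)
      g-ok : ∀ u v → W u ≡ true → W v ≡ true → adj G u v ≡ true → g u ≢ g v
      g-ok u v wu wv e eq = go (u Fin.≟ s) (v Fin.≟ s)
        where
        go : Dec (u ≡ s) → Dec (v ≡ s) → ⊥
        go (yes refl) (yes refl) = true≢false e (irrefl G s)
        go (yes refl) (no q) = new v wv q (trans (adj-sym G v s) e) (trans (sym (off q)) (trans (sym eq) at))
        go (no p) (yes refl) = new u wu p e (trans (sym (off p)) (trans eq at))
        go (no p) (no q) = f-ok u v (keep p wu) (keep q wv) e (trans (sym (off p)) (trans eq (off q)))

    proper-colouring : Σ (Fin n → Fin (suc k)) λ f → (∀ u v → adj G u v ≡ true → f u ≢ f v)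
    proper-colouring with greedy (size {n} (λ _ → true)) (λ _ → true) ℕ.≤-refl
    ... | f , ok = f , λ u v → ok u v refl refl

-- Numerical bounds

½^*2^ : ∀ q → ½ ^^ q * ι (2 ℕ.^ q) ≡ 1ℚ
½^*2^ q = trans (cong (½ ^^ q *_) (ι-^ 2 q)) (trans (sym (^^-*-distrib ½ (ι 2) q)) (1^^ q))

1≤ι : ∀ {m} → 0 ℕ.< m → 1ℚ ≤ ι m
1≤ι {m} p = ι-mono p

recip≤1 : ∀ {a} → 1ℚ ≤ a → recip a ≤ 1ℚ
recip≤1 p = ℚ.≤-trans (recip-anti 0<1 p) (ℚ.≤-reflexive (sym (recip-unique 0<1 refl)))

-- A rounded logarithm: the strict lower bound starts the centroid recursion, and the upper bound
-- turns powers of `2 ^ p` back into powers of `n`.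
next-power : ∀ n → 0 ℕ.< n → ∃[ p ] (n ℕ.< 2 ℕ.^ p × 2 ℕ.^ p ℕ.≤ 2 ℕ.* n)
next-power (suc zero) _ = 1 , ℕ.≤-refl , ℕ.≤-refl
next-power (suc (suc n)) _ with next-power (suc n) (ℕ.s≤s ℕ.z≤n)
... | p , lt , le with suc (suc n) ℕ.<? 2 ℕ.^ p
...   | yes lt′ = p , lt′ , ℕ.≤-trans le (ℕ.*-monoʳ-≤ 2 (ℕ.n≤1+n (suc n)))
...   | no ≮ = suc p , ℕ.<-≤-trans (ℕ.m<n+m (suc (suc n)) {suc (suc n)} (ℕ.s≤s ℕ.z≤n)) (ℕ.≤-trans (ℕ.≤-reflexive (cong (suc (suc n) ℕ.+_) (sym (ℕ.+-identityʳ (suc (suc n)))))) (ℕ.*-monoʳ-≤ 2 lt))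
                   , ℕ.*-monoʳ-≤ 2 (ℕ.≮⇒≥ ≮)

n<2^n : ∀ n → suc n ℕ.≤ 2 ℕ.^ n
n<2^n zero = ℕ.≤-refl
n<2^n (suc n) = ℕ.≤-trans (ℕ.+-mono-≤ (ℕ.m^n>0 2 n) (n<2^n n)) (ℕ.+-monoʳ-≤ (2 ℕ.^ n) (ℕ.m≤m+n (2 ℕ.^ n) 0))

-- The number `2 * n + 5` is the base `top + 2ℚ` produced by `power-increment`.
2n+5≤2^ : ∀ n → 2 ℕ.* n ℕ.+ 5 ℕ.≤ 2 ℕ.^ (n ℕ.+ 3)
2n+5≤2^ zero = ℕ.m≤m+n 5 3
2n+5≤2^ (suc n) = ℕ.≤-trans (ℕ.≤-reflexive (eq n)) (ℕ.+-mono-≤ (ℕ.≤-trans (ℕ.m≤n+m 2 (2 ℕ.* n ℕ.+ 3)) (ℕ.≤-trans (ℕ.≤-reflexive (eq′ n)) (2n+5≤2^ n))) (ℕ.≤-trans (2n+5≤2^ n) (ℕ.≤-reflexive (sym (ℕ.+-identityʳ (2 ℕ.^ (n ℕ.+ 3)))))))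
  where
  eq : ∀ n → 2 ℕ.* suc n ℕ.+ 5 ≡ 2 ℕ.+ (2 ℕ.* n ℕ.+ 5)
  eq = solveℕ-∀
  eq′ : ∀ n → 2 ℕ.* n ℕ.+ 3 ℕ.+ 2 ≡ 2 ℕ.* n ℕ.+ 5
  eq′ = solveℕ-∀

-- κ ≤ 2 ^ loss k bounds the factor lost per vertex removed in a tree-depth decomposition.
loss : ℕ → ℕ
loss k = 9 ℕ.+ (k ℕ.+ 2) ℕ.* 32

module _ {n : ℕ} (G : Graph n) (L : ListAssignment n) (S : Enumeration G L) (deg+2 : IsDegPlus2 G L)
         {k : ℕ} (cls : Fin n → Fin (suc k)) (cls-proper : ∀ u v → adj G u v ≡ true → cls u ≢ cls v) where
  open Poincare G L S deg+2 cls cls-proper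

  -- The reciprocal of `δ` is 32 times the 32nd power of `t⁻¹`, so `κ` is 256 times that power plus
  -- 1, and 257 is below 2 to the 9. Moreover `t⁻¹`, which is 4 (k + 1), is at most 2 to the k + 2.
  κ≤ : κ ≤ ι (2 ℕ.^ loss k)
  κ≤ = begin
    κ                                              ≡⟨ cong (λ q → 2ℚ * (2ℚ * 2ℚ * q) + 1ℚ) recip-δ ⟩
    2ℚ * (2ℚ * 2ℚ * (32ℚ * u)) + 1ℚ                ≤⟨ ℚ.+-monoʳ-≤ (2ℚ * (2ℚ * 2ℚ * (32ℚ * u))) 1≤u ⟩
    2ℚ * (2ℚ * 2ℚ * (32ℚ * u)) + u                 ≤⟨ ≤-by _ (0≤* (0≤ι 255) (ℚ.≤-trans 0≤1 1≤u)) (eq u) ⟩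
    ι (2 ℕ.^ 9) * u                                ≤⟨ *-monoˡ (0≤ι (2 ℕ.^ 9)) u≤ ⟩
    ι (2 ℕ.^ 9) * ι (2 ℕ.^ ((k ℕ.+ 2) ℕ.* 32))     ≡⟨ trans (cong ι (ℕ.^-distribˡ-+-* 2 9 ((k ℕ.+ 2) ℕ.* 32))) (ι-* (2 ℕ.^ 9) (2 ℕ.^ ((k ℕ.+ 2) ℕ.* 32))) ⟨
    ι (2 ℕ.^ loss k)                               ∎
    where
    open ℚ.≤-Reasoning
    32ℚ U u b : ℚ
    32ℚ = 2ℚ * 2ℚ * 2ℚ * (2ℚ * 2ℚ)
    U = t⁻¹ ^^ 8
    u = U * U * (U * U)
    b = ι (2 ℕ.^ (k ℕ.+ 2))
    eq : ∀ u → ι (2 ℕ.^ 9) * u ≡ 2ℚ * (2ℚ * 2ℚ * (2ℚ * 2ℚ * 2ℚ * (2ℚ * 2ℚ) * u)) + u + ι 255 * u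
    eq = solve-∀ ℚ-ring
    T*U : T * U ≡ 1ℚ
    T*U = trans (sym (^^-*-distrib t t⁻¹ 8)) (trans (cong (_^^ 8) (trans (ℚ.*-comm t t⁻¹) (*-recip 0<t⁻¹))) (1^^ 8))
    recip-δ : recip δ ≡ 32ℚ * u
    recip-δ = sym (recip-unique 0<δ (trans (eq′ T U) (cong (λ q → q * q * (q * q)) T*U)))
      where
      eq′ : ∀ T U → T * T * (T * T) * (½ * (½ * ½)) * (½ * ½) * (2ℚ * 2ℚ * 2ℚ * (2ℚ * 2ℚ) * (U * U * (U * U))) ≡ T * U * (T * U) * (T * U * (T * U))
      eq′ = solve-∀ ℚ-ring
    1≤U : 1ℚ ≤ U
    1≤U = 1≤^^ 8 1≤t⁻¹
    1≤UU : 1ℚ ≤ U * U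
    1≤UU = *-mono 0≤1 1≤U 0≤1 1≤U
    1≤u : 1ℚ ≤ u
    1≤u = *-mono 0≤1 1≤UU 0≤1 1≤UU
    t⁻¹≤b : t⁻¹ ≤ b
    t⁻¹≤b = ℚ.≤-trans (ℚ.≤-reflexive (sym (ι-* 2 (suc k ℕ.+ suc k)))) (ι-mono (ℕ.≤-trans (ℕ.*-monoʳ-≤ 2 (ℕ.≤-trans (ℕ.+-monoʳ-≤ (suc k) (ℕ.m≤m+n (suc k) 0)) (ℕ.*-monoʳ-≤ 2 (n<2^n k))))
      (ℕ.≤-reflexive (cong (2 ℕ.^_) (ℕ.+-comm 2 k)))))
    0≤t⁻¹ : 0ℚ ≤ t⁻¹
    0≤t⁻¹ = ℚ.<⇒≤ 0<t⁻¹
    u≤ : u ≤ ι (2 ℕ.^ ((k ℕ.+ 2) ℕ.* 32))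
    u≤ = ℚ.≤-trans (ℚ.≤-reflexive (eq₄ U)) (ℚ.≤-trans (ℚ.≤-reflexive (^^-^^ t⁻¹ 8 4)) (ℚ.≤-trans (^^-mono 32 0≤t⁻¹ t⁻¹≤b)
      (ℚ.≤-reflexive (trans (sym (ι-^ (2 ℕ.^ (k ℕ.+ 2)) 32)) (cong ι (ℕ.^-*-assoc 2 (k ℕ.+ 2) 32))))))
      where
      eq₄ : ∀ U → U * U * (U * U) ≡ U * (U * (U * (U * 1ℚ)))
      eq₄ = solve-∀ ℚ-ring

module _ {n : ℕ} (G : Graph n) (L : ListAssignment n) (deg+2 : IsDegPlus2 G L) (0<n : 0 ℕ.< n) {C : ℕ} (0<C : 0 ℕ.< C) where
  open Concrete G L
  open Averages G L enumeration
  open Vertices G L enumeration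
  open Dynamics G L enumeration deg+2 0<n

  -- The time for the variance to decay plus the warm-up time. Since `ε` is 1 over n (n + 1), that
  -- many steps halve `aₜ`, and `C` times as many halve the variance. The first (n + 3) n halvings
  -- pay for the power of `top + 2ℚ`; the extra 4 and 3 leave a sixteenth and an eighth.
  mixing-time : ℕ
  mixing-time = n ℕ.* (n ℕ.+ 1) ℕ.* C ℕ.* ((n ℕ.+ 3) ℕ.* n ℕ.+ 4) ℕ.+ n ℕ.* (n ℕ.+ 1) ℕ.* ((n ℕ.+ 3) ℕ.* n ℕ.+ 3)

  module _ (gap : ∀ f → E ⊤ f ≤ ι C * ∑ V λ v → E ❴ v ❵ f) where
    private
      1≤C : 1ℚ ≤ ι C
      1≤C = 1≤ι 0<C

    mixed-from-state : (x₀ : State) → Defs.dTV G L mixing-time (colouring x₀) ≤ Mixing.¼ G L deg+2 0<n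
    mixed-from-state x₀ = Mixing.mixed-from G L deg+2 0<n 1≤C gap x₀ T t γ≤1 warm cold
      where
      T t s : ℕ
      T = n ℕ.* (n ℕ.+ 1) ℕ.* ((n ℕ.+ 3) ℕ.* n ℕ.+ 3)
      t = n ℕ.* (n ℕ.+ 1) ℕ.* C ℕ.* ((n ℕ.+ 3) ℕ.* n ℕ.+ 4)
      s = (n ℕ.+ 3) ℕ.* n
      open Contraction 1≤C gap
      open WarmStart G L enumeration deg+2 0<n x₀
      top : ℚ
      top = 1ℚ + B
      0≤top : 0ℚ ≤ top
      0≤top = 0≤+ 0≤1 0≤B
      n+1 : ι (n ℕ.+ 1) ≡ ι n + 1ℚ
      n+1 = ι-+ n 1
      γ≤1 : γ ≤ 1ℚ
      γ≤1 = ℚ.≤-trans (*-mono (0≤recip 0<ιn) (recip≤1 1≤ιn) (0≤* 0≤β (0≤recip 0<C′)) (*-mono 0≤β β≤1 (0≤recip 0<C′) (recip≤1 1≤C))) (ℚ.≤-reflexive refl)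
        where
        0<C′ = ℚ.<-≤-trans 0<1 1≤C
        β≤1 : β ≤ 1ℚ
        β≤1 = *-monoˡ 0≤2 recip-n+1≤½
      top+2≤ : top + 2ℚ ≤ ι (2 ℕ.^ (n ℕ.+ 3))
      top+2≤ = ℚ.≤-trans (ℚ.≤-reflexive (trans (eq (ι n)) (sym (trans (ι-+ (2 ℕ.* n) 5) (cong (_+ ι 5) (ι-* 2 n)))))) (ι-mono (2n+5≤2^ n))
        where
        eq : ∀ n → 1ℚ + 2ℚ * (n + 1ℚ) + 2ℚ ≡ ι 2 * n + ι 5
        eq = solve-∀ ℚ-ring
      power : ∀ {a} → 0ℚ ≤ a → a ≤ top + 2ℚ → a ^^ n ≤ ι (2 ℕ.^ s)
      power p q = ℚ.≤-trans (^^-mono n p (ℚ.≤-trans q top+2≤)) (ℚ.≤-reflexive (trans (sym (ι-^ (2 ℕ.^ (n ℕ.+ 3)) n)) (cong ι (ℕ.^-*-assoc 2 (n ℕ.+ 3) n))))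
      cancel : ∀ c → ½ ^^ (s ℕ.+ c) * ι (2 ℕ.^ s) ≡ ½ ^^ c
      cancel c = trans (cong (_* ι (2 ℕ.^ s)) (^^-+ ½ s c)) (trans (eq (½ ^^ s) (½ ^^ c) (ι (2 ℕ.^ s))) (trans (cong (½ ^^ c *_) (½^*2^ s)) (ℚ.*-identityʳ (½ ^^ c))))
        where
        eq : ∀ a b c → a * b * c ≡ b * (a * c)
        eq = solve-∀ ℚ-ring
      warm : (aₜ T + top) ^^ n - top ^^ n ≤ ½ * ½ * ½
      warm = ℚ.≤-trans (power-increment n (0≤aₜ T) (aₜ≤1 T) 0≤top) (ℚ.≤-trans
        (*-mono (0≤aₜ T) (halving-^ (n ℕ.* (n ℕ.+ 1)) (s ℕ.+ 3) 0≤ε ε≤1 enough) (0≤^^ n (0≤+ 0≤top 0≤2)) (power (0≤+ 0≤top 0≤2) ℚ.≤-refl))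
        (ℚ.≤-reflexive (cancel 3)))
        where
        eq : ∀ n m i j → n * m * (i * j) ≡ (n * i) * (m * j)
        eq = solve-∀ ℚ-ring
        enough : 1ℚ ≤ ι (n ℕ.* (n ℕ.+ 1)) * ε
        enough = ℚ.≤-reflexive (sym (trans (cong (_* ε) (trans (ι-* n (n ℕ.+ 1)) (cong (ι n *_) n+1))) (trans (eq (ι n) (ι n + 1ℚ) (recip (ι n)) (recip (ι n + 1ℚ)))
          (trans (cong₂ _*_ (*-recip 0<ιn) (*-recip 0<n+1)) refl))))
      cold : (1ℚ - γ) ^^ t * top ^^ n ≤ ½ * ½ * (½ * ½)
      cold = ℚ.≤-trans (*-mono (0≤^^ t (≤⇒0≤- γ≤1)) (halving-^ (n ℕ.* (n ℕ.+ 1) ℕ.* C) (s ℕ.+ 4) 0≤γ γ≤1 enough) (0≤^^ n 0≤top) (power 0≤top (≤-by 2ℚ 0≤2 refl)))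
        (ℚ.≤-reflexive (cancel 4))
        where
        eq : ∀ n m c i j l → n * m * c * (i * (2ℚ * j * l)) ≡ 2ℚ * ((n * i) * (m * j) * (c * l))
        eq = solve-∀ ℚ-ring
        enough : 1ℚ ≤ ι (n ℕ.* (n ℕ.+ 1) ℕ.* C) * γ
        enough = ℚ.≤-trans (≤-by 1ℚ 0≤1 refl) (ℚ.≤-reflexive (sym (trans (cong (_* γ) (trans (ι-* (n ℕ.* (n ℕ.+ 1)) C) (cong (_* ι C) (trans (ι-* n (n ℕ.+ 1)) (cong (ι n *_) n+1)))))
          (trans (eq (ι n) (ι n + 1ℚ) (ι C) (recip (ι n)) (recip (ι n + 1ℚ)) (recip (ι C)))
          (cong (2ℚ *_) (trans (cong₂ _*_ (cong₂ _*_ (*-recip 0<ιn) (*-recip 0<n+1)) (*-recip (ℚ.<-≤-trans 0<1 1≤C))) refl))))))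

    mixed : MixedAt G L mixing-time
    mixed σ σ-ok with index {σ} σ-ok
    ... | x₀ , refl = mixed-from-state x₀

-- The exponent obtained is quadratic in `k`, and 154 is its value `8 + 2 * loss 0` at `k = 0`. As 2
-- and `2 ^ p` are at most `n` and the square of `n`, every factor becomes a power of `n`.
time-bound : ∀ n k p → 2 ℕ.≤ n → 2 ℕ.^ p ℕ.≤ 2 ℕ.* n →
  n ℕ.* (n ℕ.+ 1) ℕ.* 2 ℕ.^ (loss k ℕ.* (p ℕ.* suc k)) ℕ.* ((n ℕ.+ 3) ℕ.* n ℕ.+ 4) ℕ.+ n ℕ.* (n ℕ.+ 1) ℕ.* ((n ℕ.+ 3) ℕ.* n ℕ.+ 3)
  ℕ.≤ n ℕ.^ (154 ℕ.* (suc k ℕ.^ 3))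
time-bound n@(suc _) k p 2≤n 2^p≤ = begin
  n ℕ.* (n ℕ.+ 1) ℕ.* D ℕ.* q ℕ.+ n ℕ.* (n ℕ.+ 1) ℕ.* ((n ℕ.+ 3) ℕ.* n ℕ.+ 3)
    ≤⟨ ℕ.+-monoʳ-≤ (n ℕ.* (n ℕ.+ 1) ℕ.* D ℕ.* q) (ℕ.*-mono-≤ (ℕ.≤-trans (ℕ.≤-reflexive (sym (ℕ.*-identityʳ (n ℕ.* (n ℕ.+ 1))))) (ℕ.*-monoʳ-≤ (n ℕ.* (n ℕ.+ 1)) (ℕ.m^n>0 2 (loss k ℕ.* (p ℕ.* w))))) (ℕ.+-monoʳ-≤ ((n ℕ.+ 3) ℕ.* n) (ℕ.n≤1+n 3))) ⟩
  n ℕ.* (n ℕ.+ 1) ℕ.* D ℕ.* q ℕ.+ n ℕ.* (n ℕ.+ 1) ℕ.* D ℕ.* q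
    ≡⟨ eq n D q ⟩
  2 ℕ.* (n ℕ.* (n ℕ.+ 1) ℕ.* D ℕ.* q)
    -- Of the eight separate factors `n`, one bounds the leading 2, three bound `n * (n + 1)` and
    -- four bound `q`.
    ≤⟨ ℕ.*-mono-≤ 2≤n (ℕ.*-mono-≤ (ℕ.*-mono-≤ (ℕ.*-monoʳ-≤ n n+1≤) D≤) q≤) ⟩
  n ℕ.* (n ℕ.* (n ℕ.* n) ℕ.* n ℕ.^ (2 ℕ.* (loss k ℕ.* w)) ℕ.* (n ℕ.* n ℕ.* (n ℕ.* n)))
    ≡⟨ eq′ n (n ℕ.^ (2 ℕ.* (loss k ℕ.* w))) ⟩
  n ℕ.^ 8 ℕ.* n ℕ.^ (2 ℕ.* (loss k ℕ.* w))
    ≡⟨ ℕ.^-distribˡ-+-* n 8 (2 ℕ.* (loss k ℕ.* w)) ⟨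
  n ℕ.^ (8 ℕ.+ 2 ℕ.* (loss k ℕ.* w))
    ≤⟨ ℕ.^-monoʳ-≤ n exponent ⟩
  n ℕ.^ (154 ℕ.* (w ℕ.^ 3)) ∎
  where
  open ℕ.≤-Reasoning
  w D q : ℕ
  w = suc k
  D = 2 ℕ.^ (loss k ℕ.* (p ℕ.* w))
  q = (n ℕ.+ 3) ℕ.* n ℕ.+ 4
  eq : ∀ n D q → n ℕ.* (n ℕ.+ 1) ℕ.* D ℕ.* q ℕ.+ n ℕ.* (n ℕ.+ 1) ℕ.* D ℕ.* q ≡ 2 ℕ.* (n ℕ.* (n ℕ.+ 1) ℕ.* D ℕ.* q)
  eq = solveℕ-∀
  eq′ : ∀ n D → n ℕ.* (n ℕ.* (n ℕ.* n) ℕ.* D ℕ.* (n ℕ.* n ℕ.* (n ℕ.* n))) ≡ n ℕ.* (n ℕ.* (n ℕ.* (n ℕ.* (n ℕ.* (n ℕ.* (n ℕ.* (n ℕ.* 1))))))) ℕ.* D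
  eq′ = solveℕ-∀
  n+1≤ : n ℕ.+ 1 ℕ.≤ n ℕ.* n
  n+1≤ = ℕ.≤-trans (ℕ.+-monoʳ-≤ n (ℕ.s≤s ℕ.z≤n)) (ℕ.≤-trans (ℕ.≤-reflexive (cong (n ℕ.+_) (sym (ℕ.+-identityʳ n)))) (ℕ.*-monoˡ-≤ n 2≤n))
  4≤ : 4 ℕ.≤ n ℕ.* n
  4≤ = ℕ.*-mono-≤ 2≤n 2≤n
  q≤ : q ℕ.≤ n ℕ.* n ℕ.* (n ℕ.* n)
  q≤ = ℕ.≤-trans (ℕ.≤-reflexive (eq₁ n)) (ℕ.≤-trans (ℕ.+-mono-≤ (ℕ.+-monoʳ-≤ (n ℕ.* n) (ℕ.*-monoˡ-≤ n (ℕ.≤-trans (ℕ.n≤1+n 3) (ℕ.*-monoʳ-≤ 2 2≤n)))) 4≤)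
    (ℕ.≤-trans (ℕ.≤-reflexive (eq₂ n)) (ℕ.*-monoˡ-≤ (n ℕ.* n) 4≤)))
    where
    eq₁ : ∀ n → (n ℕ.+ 3) ℕ.* n ℕ.+ 4 ≡ n ℕ.* n ℕ.+ 3 ℕ.* n ℕ.+ 4
    eq₁ = solveℕ-∀
    eq₂ : ∀ n → n ℕ.* n ℕ.+ 2 ℕ.* n ℕ.* n ℕ.+ n ℕ.* n ≡ 4 ℕ.* (n ℕ.* n)
    eq₂ = solveℕ-∀
  D≤ : D ℕ.≤ n ℕ.^ (2 ℕ.* (loss k ℕ.* w))
  D≤ = begin
    2 ℕ.^ (loss k ℕ.* (p ℕ.* w))       ≡⟨ cong (2 ℕ.^_) (eq₃ (loss k) p w) ⟩
    2 ℕ.^ (p ℕ.* (loss k ℕ.* w))       ≡⟨ ℕ.^-*-assoc 2 p (loss k ℕ.* w) ⟨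
    (2 ℕ.^ p) ℕ.^ (loss k ℕ.* w)       ≤⟨ ℕ.^-monoˡ-≤ (loss k ℕ.* w) (ℕ.≤-trans 2^p≤ (ℕ.≤-trans (ℕ.*-monoˡ-≤ n 2≤n) (ℕ.≤-reflexive (cong (n ℕ.*_) (sym (ℕ.*-identityʳ n)))))) ⟩
    (n ℕ.^ 2) ℕ.^ (loss k ℕ.* w)       ≡⟨ ℕ.^-*-assoc n 2 (loss k ℕ.* w) ⟩
    n ℕ.^ (2 ℕ.* (loss k ℕ.* w))       ∎
    where
    eq₃ : ∀ l p w → l ℕ.* (p ℕ.* w) ≡ p ℕ.* (l ℕ.* w)
    eq₃ = solveℕ-∀
  exponent : 8 ℕ.+ 2 ℕ.* (loss k ℕ.* w) ℕ.≤ 154 ℕ.* (w ℕ.^ 3)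
  exponent = ℕ.≤-trans (ℕ.m≤m+n _ (154 ℕ.* k ℕ.* k ℕ.* k ℕ.+ 398 ℕ.* k ℕ.* k ℕ.+ 252 ℕ.* k)) (ℕ.≤-reflexive (eq₄ k))
    where
    eq₄ : ∀ k → 8 ℕ.+ 2 ℕ.* ((9 ℕ.+ (k ℕ.+ 2) ℕ.* 32) ℕ.* suc k) ℕ.+ (154 ℕ.* k ℕ.* k ℕ.* k ℕ.+ 398 ℕ.* k ℕ.* k ℕ.+ 252 ℕ.* k) ≡ 154 ℕ.* (suc k ℕ.* (suc k ℕ.* (suc k ℕ.* 1)))
    eq₄ = solveℕ-∀

-- Small vertex sets and the conclusion.

mixing-time-0 : (G : Graph 0) (L : ListAssignment 0) → MixedAt G L 0
mixing-time-0 G L Vec.[] _ = from-yes (Defs.dTV G L 0 Vec.[] ℚ.≤? (ℤ.+ 1 ℚ./ 4))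

-- Powers of 1 leave time for a single step. With one vertex the gap constant is 1 and every
-- proposal is accepted, so `γ` is 1 and one step removes all variance.
mixing-time-1 : (G : Graph 1) (L : ListAssignment 1) → IsDegPlus2 G L → MixedAt G L 1
mixing-time-1 G L deg+2 = Mixing.mixed-if-flat G L deg+2 0<1ℕ 1 λ x →
    ℚ.≤-trans (contract (same x)) (ℚ.≤-reflexive (trans (cong (λ q → (1ℚ - q) * E ⊤ (same x)) γ≡1) (ℚ.*-zeroˡ (E ⊤ (same x)))))
  where
  0<1ℕ : 0 ℕ.< 1
  0<1ℕ = ℕ.s≤s ℕ.z≤n
  open Concrete G L
  open Averages G L enumeration
  open Vertices G L enumeration
  open Dynamics G L enumeration deg+2 0<1ℕ
  gap : ∀ f → E ⊤ f ≤ 1ℚ * ∑ V λ v → E ❴ v ❵ f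
  gap f = ℚ.≤-reflexive (trans (E-resp {⊤} {❴ zero ❵} (λ { zero → refl }) f) (sym (trans (ℚ.*-identityˡ (E ❴ zero ❵ f + 0ℚ)) (ℚ.+-identityʳ (E ❴ zero ❵ f)))))
  open Contraction ℚ.≤-refl gap
  γ≡1 : γ ≡ 1ℚ
  γ≡1 = cong₂ (λ a b → a * (2ℚ * b * a)) (sym (recip-unique {1ℚ} {1ℚ} 0<1 refl)) (sym (recip-unique {2ℚ} {½} 0<2 refl))

mixing-time-bound : (n : ℕ) (G : Graph n) (L : ListAssignment n) → IsDegPlus2 G L →
                    (k : ℕ) → WidthAtMost G k → MixingTimeAtMost G L (n ℕ.^ (154 ℕ.* (suc k ℕ.^ 3)))
mixing-time-bound zero G L deg+2 k _ = 0 , ℕ.z≤n , mixing-time-0 G L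
mixing-time-bound (suc zero) G L deg+2 k _ = 1 , ℕ.≤-reflexive (sym (ℕ.^-zeroˡ (154 ℕ.* (suc k ℕ.^ 3)))) , mixing-time-1 G L deg+2
mixing-time-bound n@(suc (suc _)) G L deg+2 k (T , width) = mixing-time G L deg+2 0<n 0<C , time-bound n k p (ℕ.s≤s (ℕ.s≤s ℕ.z≤n)) p≤ , mixed G L deg+2 0<n 0<C gap
  where
  0<n : 0 ℕ.< n
  0<n = ℕ.s≤s ℕ.z≤n
  open Concrete G L using (enumeration)
  open Averages G L enumeration using (E)
  open Vertices G L enumeration using (V)
  open Dynamics G L enumeration deg+2 0<n using (⊤)
  open Decomposition T using (tree-depth; proper-colouring)
  cls = proj₁ (proper-colouring width)
  cls-proper = proj₂ (proper-colouring width)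
  open Poincare G L enumeration deg+2 cls cls-proper using (κ; 0≤κ; poincare; energy; 0≤energy)
  p = proj₁ (next-power n 0<n)
  n< = proj₁ (proj₂ (next-power n 0<n))
  p≤ = proj₂ (proj₂ (next-power n 0<n))
  0<C : 0 ℕ.< 2 ℕ.^ (loss k ℕ.* (p ℕ.* suc k))
  0<C = ℕ.m^n>0 2 (loss k ℕ.* (p ℕ.* suc k))
  gap : ∀ f → E ⊤ f ≤ ι (2 ℕ.^ (loss k ℕ.* (p ℕ.* suc k))) * ∑ V λ v → E ❴ v ❵ f
  gap f = ℚ.≤-trans (poincare (tree-depth width p ⊤ (ℕ.≤-<-trans (size≤n ⊤) n<)) f) (ℚ.≤-trans
    (*-monoʳ (0≤energy ⊤ f) (ℚ.≤-trans (^^-mono (p ℕ.* suc k) 0≤κ (κ≤ G L enumeration deg+2 cls cls-proper))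
      (ℚ.≤-reflexive (trans (sym (ι-^ (2 ℕ.^ loss k) (p ℕ.* suc k))) (cong ι (ℕ.^-*-assoc 2 (loss k) (p ℕ.* suc k)))))))
    (ℚ.≤-reflexive (cong (ι (2 ℕ.^ (loss k ℕ.* (p ℕ.* suc k))) *_) (∑-cong V λ v → ℚ.*-identityˡ (E ❴ v ❵ f)))))

theorem1 : ∃[ C ] ((n : ℕ) (G : Graph n) (L : ListAssignment n) → IsDegPlus2 G L →
    (k : ℕ) → Treewidth G k → MixingTimeAtMost G L (n ℕ.^ (C ℕ.* (suc k ℕ.^ 3))))
theorem1 = 154 , λ n G L deg+2 k tw → mixing-time-bound n G L deg+2 k (proj₁ tw)
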